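{- Let $n>4$ be an even integer and let $P=(A_1,\dots,A_n)$ be a cyclic $n$-gon (distinct vertices on a circle) with vertices ordered anticlockwise. Then \[\sum_{m=1}^{n}(-1)^{m+1}x(m)S(m)=0,\] where \[ x(m)=\begin{cases} x_{12}\,x_{34}^{c}\displaystyle\prod_{\substack{l=m\\ l\text{ even}}}^{n-2}x_{l,l+1}^{\frac{l-2}{2}}\prod_{\substack{l=5\\ l\text{ odd}}}^{m-1}x_{l,l+1}^{\frac{l-3}{2}}, & m \text{ even};\\[2ex] x_{12}^{a}\displaystyle\prod_{\substack{l=m-1\\ l\text{ even}}}^{n-2}x_{l,l+1}^{\frac{l-2}{2}}\prod_{\substack{l=5\\ l\text{ odd}}}^{m}x_{l,l+1}^{\frac{l-3}{2}}, & m\text{ odd},\ n=6;\\[2ex] x_{12}^{a}x_{34}^{b}\,x_{m-2,m-1}^{\frac{m-5}{2}}\,x_{m,m+1}^{\frac{m-3}{2}}\displaystyle\prod_{\substack{l=m-1\\ l\text{ even}}}^{n-2}x_{l,l+1}^{\frac{l-2}{2}}\prod_{\substack{l=5\\ l\text{ odd}}}^{m-4}x_{l,l+1}^{\frac{l-5}{2}}, & m\text{ odd},\ n>6; \end{cases} \] \[ S(m)=\left(\prod_{k=1}^{m-1}\Big(\prod_{\substack{l=k+1\\ l\text{ even}}}^{m-2}S_{k,l,l+1}\prod_{\substack{l=m+1\\ l\text{ odd}}}^{n-1}S_{k,l,l+1}\Big)\right)\left(\prod_{k=m}^{n-3}\prod_{\substack{l=k+2\\ l\text{ odd}}}^{n-1}S_{k+1,l,l+1}\right)\quad\text{for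 } m \text{ even}, \] \[ \begin{aligned} S(m)={}&S_{m-2,m-1,m+1}\left(\prod_{\substack{l=m+2\\ l\text{ odd}}}^{n-1}S_{m-1,l,l+1}S_{m-2,l,l+1}S_{m-3,l,l+1}\right)\left(\prod_{k=m}^{n-3}\prod_{\substack{l=k+2\\ l\text{ odd}}}^{n-1}S_{k+1,l,l+1}\right)\\ &\cdot\prod_{k=1}^{m-4}\left(\big(S_{k,k+1,k+2}S_{k,k+1,m-1}S_{k,k+1,m+1}\big)^{(k\bmod 2)}\prod_{\substack{l=k+2\\ l\text{ even}}}^{m-2}S_{k,l,l+1}\prod_{\substack{l=m+2\\ l\text{ odd}}}^{n-1}S_{k,l,l+1}\right)\quad\text{for } m\text{ odd}, \end{aligned} \] with $a=1$ if $m\in\{1,3\}$ and $a=0$ otherwise; $b=1$ if $m\in\{1,3,5\}$ and $b=0$ otherwise; $c=0$ if $n=6$ and $c=1$ if $n\ge 8$.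
   Context: For points $A_p=(x_p,y_p)$, $x_{pq}:=(x_q-x_p)^2+(y_q-y_p)^2$ is the squared distance between $A_p$ and $A_q$, and $S_{pqr}:=2[(x_q-x_p)(y_r-y_p)-(y_q-y_p)(x_r-x_p)]$ is four times the signed area of triangle $A_pA_qA_r$; these are entries of the polygonal Heronian frieze of $P$. Conventions: if some index is $\le 0$, then $S_{pqr}=1$ and $x_{pq}=1$; $x_{pq}^{e}=1$ whenever the exponent $e<0$; a product $\prod_{l=\alpha}^{\beta}$ with $\alpha>\beta$ (or with no index of the required parity in range) equals $1$; a subscript "$l$ even/odd" restricts the product to indices of that parity; $k \bmod 2\in\{0,1\}$. -}

module Defs where

open import Algebra.Bundles.Raw using (RawRing)
import Algebra.Definitions.RawSemiring as RawSemiringDefinitions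
open import Data.Bool.Base using (if_then_else_; _∨_)
open import Data.Fin.Base as Fin using (Fin; fromℕ<)
open import Data.List.Base using (List; map; foldr; filter; upTo)
open import Data.Maybe.Base using (Maybe; just; nothing)
open import Data.Nat.Base as ℕ using (ℕ; zero; suc; _∸_; _/_; _%_)
open import Data.Nat.Divisibility using (_∣?_)
import Data.Nat.Properties as ℕₚ
open import Data.Product.Base using (Σ; ∃; _×_; _,_; proj₁; proj₂)
open import Data.Rational.Base as ℚ using (ℚ; 0ℚ; 1ℚ; ½; ∣_∣)
import Data.Rational.Properties as ℚₚ
open import Data.Rational.Solver using (module +-*-Solver)
open import Level using (0ℓ)
open import Relation.Binary.PropositionalEquality
  using (_≡_; _≢_; refl; sym; trans; cong; cong₂; subst)
open import Relation.Nullary.Decidable using (does; yes; no; ¬?)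
open import Relation.Nullary.Negation using (¬_)

-- Real numbers are Cauchy sequences of rationals; there is no quotient, so
-- equality of reals is the relation _≈_ below, not _≡_.

IsCauchy : (ℕ → ℚ) → Set
IsCauchy s = ∀ ε → 0ℚ ℚ.< ε → ∃ λ N → ∀ i j → N ℕ.≤ i → N ℕ.≤ j →
  ∣ s i ℚ.- s j ∣ ℚ.< ε

record ℝ : Set where
  no-eta-equality
  constructor mkℝ
  field
    seq    : ℕ → ℚ
    cauchy : IsCauchy seq

open ℝ public

infix 4 _≈_ _<_

-- A record rather than a function, so that x and y can be inferred from
-- a proof of x ≈ y.
record _≈_ (x y : ℝ) : Set where
  constructor *≈*
  field
    converge : ∀ ε → 0ℚ ℚ.< ε → ∃ λ N → ∀ i → N ℕ.≤ i →
      ∣ seq x i ℚ.- seq y i ∣ ℚ.< ε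

_<_ : ℝ → ℝ → Set
x < y = Σ ℚ λ ε → (0ℚ ℚ.< ε) × (∃ λ N → ∀ i → N ℕ.≤ i →
  seq x i ℚ.+ ε ℚ.≤ seq y i)

private
  half : ℚ → ℚ
  half ε = ½ ℚ.* ε

  half-pos : ∀ {ε} → 0ℚ ℚ.< ε → 0ℚ ℚ.< half ε
  half-pos {ε} 0<ε = ℚₚ.*-monoʳ-<-pos ½ 0<ε

  half+half : ∀ ε → half ε ℚ.+ half ε ≡ ε
  half+half ε = trans (sym (ℚₚ.*-distribʳ-+ ε ½ ½)) (ℚₚ.*-identityˡ ε)

  bounded : ∀ {s} → IsCauchy s →
    Σ ℚ λ B → (0ℚ ℚ.< B) × (∃ λ N → ∀ i → N ℕ.≤ i → ∣ s i ∣ ℚ.≤ B)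
  bounded {s} c = B , 0<B , N , bound
    where
    N : ℕ
    N = proj₁ (c 1ℚ (ℚₚ.positive⁻¹ 1ℚ))

    B : ℚ
    B = 1ℚ ℚ.+ ∣ s N ∣

    0<B : 0ℚ ℚ.< B
    0<B = ℚₚ.+-mono-<-≤ (ℚₚ.positive⁻¹ 1ℚ) (ℚₚ.0≤∣p∣ (s N))

    open +-*-Solver

    split : ∀ p q → p ≡ (p ℚ.- q) ℚ.+ q
    split = solve 2 (λ p q → p := (p :- q) :+ q) refl

    bound : ∀ i → N ℕ.≤ i → ∣ s i ∣ ℚ.≤ B
    bound i N≤i = begin
      ∣ s i ∣                          ≡⟨ cong ∣_∣ (split (s i) (s N)) ⟩
      ∣ (s i ℚ.- s N) ℚ.+ s N ∣        ≤⟨ ℚₚ.∣p+q∣≤∣p∣+∣q∣ (s i ℚ.- s N) (s N) ⟩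
      ∣ s i ℚ.- s N ∣ ℚ.+ ∣ s N ∣      ≤⟨ ℚₚ.+-monoˡ-≤ ∣ s N ∣ (ℚₚ.<⇒≤
                                            (proj₂ (c 1ℚ (ℚₚ.positive⁻¹ 1ℚ))
                                              i N N≤i ℕₚ.≤-refl)) ⟩
      B                                ∎
      where open ℚₚ.≤-Reasoning

  divide : ∀ B ε → 0ℚ ℚ.< B → 0ℚ ℚ.< ε →
    Σ ℚ λ δ → (0ℚ ℚ.< δ) × (B ℚ.* δ ≡ ε)
  divide B ε 0<B 0<ε = δ , 0<δ , Bδ≡ε
    where
    instance
      B⁺ : ℚ.Positive B
      B⁺ = ℚ.positive 0<B
      B≢0 : ℚ.NonZero B
      B≢0 = ℚₚ.pos⇒nonZero B
      ε⁺ : ℚ.Positive ε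
      ε⁺ = ℚ.positive 0<ε
      B⁻¹⁺ : ℚ.Positive (ℚ.1/ B)
      B⁻¹⁺ = ℚₚ.1/pos⇒pos B

    δ : ℚ
    δ = ℚ.1/ B ℚ.* ε

    0<δ : 0ℚ ℚ.< δ
    0<δ = ℚₚ.positive⁻¹ δ {{ℚₚ.pos*pos⇒pos (ℚ.1/ B) ε}}

    Bδ≡ε : B ℚ.* δ ≡ ε
    Bδ≡ε = trans (sym (ℚₚ.*-assoc B (ℚ.1/ B) ε))
      (trans (cong (ℚ._* ε) (ℚₚ.*-inverseʳ B)) (ℚₚ.*-identityˡ ε))

  const-cauchy : ∀ q → IsCauchy (λ _ → q)
  const-cauchy q ε 0<ε = 0 , λ _ _ _ _ →
    subst (ℚ._< ε) (sym (cong ∣_∣ (ℚₚ.+-inverseʳ q))) 0<ε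

  +-cauchy : ∀ {s t} → IsCauchy s → IsCauchy t →
    IsCauchy (λ i → s i ℚ.+ t i)
  +-cauchy {s} {t} c d ε 0<ε = M ℕ.⊔ N , close
    where
    M N : ℕ
    M = proj₁ (c (half ε) (half-pos 0<ε))
    N = proj₁ (d (half ε) (half-pos 0<ε))

    open +-*-Solver

    regroup : ∀ a b p q → (a ℚ.+ b) ℚ.- (p ℚ.+ q) ≡ (a ℚ.- p) ℚ.+ (b ℚ.- q)
    regroup = solve 4 (λ a b p q →
      (a :+ b) :- (p :+ q) := (a :- p) :+ (b :- q)) refl

    close : ∀ i j → M ℕ.⊔ N ℕ.≤ i → M ℕ.⊔ N ℕ.≤ j →
      ∣ (s i ℚ.+ t i) ℚ.- (s j ℚ.+ t j) ∣ ℚ.< ε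
    close i j hi hj = begin-strict
      ∣ (s i ℚ.+ t i) ℚ.- (s j ℚ.+ t j) ∣    ≡⟨ cong ∣_∣ (regroup (s i) (t i) (s j) (t j)) ⟩
      ∣ (s i ℚ.- s j) ℚ.+ (t i ℚ.- t j) ∣    ≤⟨ ℚₚ.∣p+q∣≤∣p∣+∣q∣ (s i ℚ.- s j) (t i ℚ.- t j) ⟩
      ∣ s i ℚ.- s j ∣ ℚ.+ ∣ t i ℚ.- t j ∣    <⟨ ℚₚ.+-mono-<
        (proj₂ (c (half ε) (half-pos 0<ε)) i j (ℕₚ.m⊔n≤o⇒m≤o M N hi) (ℕₚ.m⊔n≤o⇒m≤o M N hj))
        (proj₂ (d (half ε) (half-pos 0<ε)) i j (ℕₚ.m⊔n≤o⇒n≤o M N hi) (ℕₚ.m⊔n≤o⇒n≤o M N hj)) ⟩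
      half ε ℚ.+ half ε                      ≡⟨ half+half ε ⟩
      ε                                      ∎
      where open ℚₚ.≤-Reasoning

  neg-cauchy : ∀ {s} → IsCauchy s → IsCauchy (λ i → ℚ.- s i)
  neg-cauchy {s} c ε 0<ε = proj₁ (c ε 0<ε) , λ i j hi hj →
    subst (ℚ._< ε)
      (trans (sym (ℚₚ.∣-p∣≡∣p∣ (s i ℚ.- s j)))
        (cong ∣_∣ (ℚₚ.neg-distrib-+ (s i) (ℚ.- s j))))
      (proj₂ (c ε 0<ε) i j hi hj)

  *-regroup : ∀ a b p q →
    (a ℚ.* b) ℚ.- (p ℚ.* q) ≡ a ℚ.* (b ℚ.- q) ℚ.+ q ℚ.* (a ℚ.- p)
  *-regroup = solve 4 (λ a b p q →
    (a :* b) :- (p :* q) := a :* (b :- q) :+ q :* (a :- p)) refl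
    where open +-*-Solver

  product-bound : ∀ {D} a b {e} → 0ℚ ℚ.< D →
    ∣ a ∣ ℚ.≤ D → ∣ b ∣ ℚ.< e → ∣ a ℚ.* b ∣ ℚ.< D ℚ.* e
  product-bound {D} a b {e} 0<D a≤D b<e = begin-strict
    ∣ a ℚ.* b ∣        ≡⟨ ℚₚ.∣p*q∣≡∣p∣*∣q∣ a b ⟩
    ∣ a ∣ ℚ.* ∣ b ∣    ≤⟨ ℚₚ.*-monoʳ-≤-nonNeg ∣ b ∣ {{ℚ.nonNegative (ℚₚ.0≤∣p∣ b)}} a≤D ⟩
    D ℚ.* ∣ b ∣        <⟨ ℚₚ.*-monoʳ-<-pos D {{ℚ.positive 0<D}} b<e ⟩
    D ℚ.* e            ∎
    where open ℚₚ.≤-Reasoning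

  *-close : ∀ {s t : ℕ → ℚ} {B C δ η : ℚ} {K L M N : ℕ} {ε : ℚ} →
    0ℚ ℚ.< B → 0ℚ ℚ.< C →
    (∀ i → K ℕ.≤ i → ∣ s i ∣ ℚ.≤ B) → (∀ i → L ℕ.≤ i → ∣ t i ∣ ℚ.≤ C) →
    B ℚ.* δ ≡ half ε → C ℚ.* η ≡ half ε →
    (∀ i j → M ℕ.≤ i → M ℕ.≤ j → ∣ s i ℚ.- s j ∣ ℚ.< η) →
    (∀ i j → N ℕ.≤ i → N ℕ.≤ j → ∣ t i ℚ.- t j ∣ ℚ.< δ) →
    ∀ i j → (K ℕ.⊔ L) ℕ.⊔ (M ℕ.⊔ N) ℕ.≤ i → (K ℕ.⊔ L) ℕ.⊔ (M ℕ.⊔ N) ℕ.≤ j →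
    ∣ s i ℚ.* t i ℚ.- s j ℚ.* t j ∣ ℚ.< ε
  *-close {s} {t} {B} {C} {δ} {η} {K} {L} {M} {N} {ε}
    0<B 0<C s≤B t≤C Bδ≡ Cη≡ s-close t-close i j hi hj = begin-strict
    ∣ s i ℚ.* t i ℚ.- s j ℚ.* t j ∣
      ≡⟨ cong ∣_∣ (*-regroup (s i) (t i) (s j) (t j)) ⟩
    ∣ s i ℚ.* (t i ℚ.- t j) ℚ.+ t j ℚ.* (s i ℚ.- s j) ∣
      ≤⟨ ℚₚ.∣p+q∣≤∣p∣+∣q∣ (s i ℚ.* (t i ℚ.- t j)) (t j ℚ.* (s i ℚ.- s j)) ⟩
    ∣ s i ℚ.* (t i ℚ.- t j) ∣ ℚ.+ ∣ t j ℚ.* (s i ℚ.- s j) ∣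
      <⟨ ℚₚ.+-mono-<
           (product-bound (s i) (t i ℚ.- t j) 0<B (s≤B i (ℕₚ.m⊔n≤o⇒m≤o K L KLi))
             (t-close i j (ℕₚ.m⊔n≤o⇒n≤o M N MNi) (ℕₚ.m⊔n≤o⇒n≤o M N MNj)))
           (product-bound (t j) (s i ℚ.- s j) 0<C (t≤C j (ℕₚ.m⊔n≤o⇒n≤o K L KLj))
             (s-close i j (ℕₚ.m⊔n≤o⇒m≤o M N MNi) (ℕₚ.m⊔n≤o⇒m≤o M N MNj))) ⟩
    B ℚ.* δ ℚ.+ C ℚ.* η
      ≡⟨ cong₂ ℚ._+_ Bδ≡ Cη≡ ⟩
    half ε ℚ.+ half ε
      ≡⟨ half+half ε ⟩
    ε ∎
    where
    open ℚₚ.≤-Reasoning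
    KLi : K ℕ.⊔ L ℕ.≤ i
    KLi = ℕₚ.m⊔n≤o⇒m≤o (K ℕ.⊔ L) (M ℕ.⊔ N) hi
    KLj : K ℕ.⊔ L ℕ.≤ j
    KLj = ℕₚ.m⊔n≤o⇒m≤o (K ℕ.⊔ L) (M ℕ.⊔ N) hj
    MNi : M ℕ.⊔ N ℕ.≤ i
    MNi = ℕₚ.m⊔n≤o⇒n≤o (K ℕ.⊔ L) (M ℕ.⊔ N) hi
    MNj : M ℕ.⊔ N ℕ.≤ j
    MNj = ℕₚ.m⊔n≤o⇒n≤o (K ℕ.⊔ L) (M ℕ.⊔ N) hj

  *-cauchy : ∀ {s t} → IsCauchy s → IsCauchy t →
    IsCauchy (λ i → s i ℚ.* t i)
  *-cauchy {s} {t} c d ε 0<ε =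
    let (B , 0<B , K , s≤B) = bounded {s} c
        (C , 0<C , L , t≤C) = bounded {t} d
        (δ , 0<δ , Bδ≡)     = divide B (half ε) 0<B (half-pos 0<ε)
        (η , 0<η , Cη≡)     = divide C (half ε) 0<C (half-pos 0<ε)
        (M , s-close)       = c η 0<η
        (N , t-close)       = d δ 0<δ
    in (K ℕ.⊔ L) ℕ.⊔ (M ℕ.⊔ N) ,
       *-close {s} {t} {B} {C} {δ} {η} {K} {L} {M} {N}
         0<B 0<C s≤B t≤C Bδ≡ Cη≡ s-close t-close

infixl 7 _*_
infixl 6 _+_ _-_
infix  8 -_

fromℚ : ℚ → ℝ
fromℚ q .seq    = λ _ → q
fromℚ q .cauchy = const-cauchy q

0ℝ 1ℝ : ℝ
0ℝ = fromℚ 0ℚ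
1ℝ = fromℚ 1ℚ

_+_ _*_ : ℝ → ℝ → ℝ
(x + y) .seq    = λ i → seq x i ℚ.+ seq y i
(x + y) .cauchy = +-cauchy {seq x} {seq y} (cauchy x) (cauchy y)
(x * y) .seq    = λ i → seq x i ℚ.* seq y i
(x * y) .cauchy = *-cauchy {seq x} {seq y} (cauchy x) (cauchy y)

-_ : ℝ → ℝ
(- x) .seq    = λ i → ℚ.- seq x i
(- x) .cauchy = neg-cauchy {seq x} (cauchy x)

_-_ : ℝ → ℝ → ℝ
x - y = x + (- y)

ℝ-rawRing : RawRing 0ℓ 0ℓ
ℝ-rawRing = record
  { Carrier = ℝ
  ; _≈_     = _≈_
  ; _+_     = _+_
  ; _*_     = _*_
  ; -_      = -_
  ; 0#      = 0ℝ
  ; 1#      = 1ℝ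
  }

open RawSemiringDefinitions (RawRing.rawSemiring ℝ-rawRing) public using (_^_)

-- The list α, α + 1, …, β, empty when β < α.
interval : ℕ → ℕ → List ℕ
interval α β = map (α ℕ.+_) (upTo (suc β ∸ α))

evens odds : List ℕ → List ℕ
evens = filter (2 ∣?_)
odds  = filter (λ l → ¬? (2 ∣? l))

sumOver productOver : List ℕ → (ℕ → ℝ) → ℝ
sumOver     ls f = foldr _+_ 0ℝ (map f ls)
productOver ls f = foldr _*_ 1ℝ (map f ls)

infix 5 ∑[_⋯_]_ ∏[_⋯_]_ ∏ᵉ[_⋯_]_ ∏ᵒ[_⋯_]_

∑[_⋯_]_ ∏[_⋯_]_ : ℕ → ℕ → (ℕ → ℝ) → ℝ
∑[ α ⋯ β ] f = sumOver     (interval α β) f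
∏[ α ⋯ β ] f = productOver (interval α β) f

∏ᵉ[_⋯_]_ ∏ᵒ[_⋯_]_ : ℕ → ℕ → (ℕ → ℝ) → ℝ
∏ᵉ[ α ⋯ β ] f = productOver (evens (interval α β)) f
∏ᵒ[ α ⋯ β ] f = productOver (odds  (interval α β)) f

record Point : Set where
  constructor ⟨_,_⟩
  field
    xᶜ yᶜ : ℝ

open Point public

infix 4 _≈ᴾ_

_≈ᴾ_ : Point → Point → Set
A ≈ᴾ B = (xᶜ A ≈ xᶜ B) × (yᶜ A ≈ yᶜ B)

sqDist : Point → Point → ℝ
sqDist A B = (xᶜ B - xᶜ A) ^ 2 + (yᶜ B - yᶜ A) ^ 2

-- Four times the signed area of the triangle A B C.
area₄ : Point → Point → Point → ℝ
area₄ A B C = (1ℝ + 1ℝ) *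
  ((xᶜ B - xᶜ A) * (yᶜ C - yᶜ A) - (yᶜ B - yᶜ A) * (xᶜ C - xᶜ A))

-- The vertex Aₚ is P (p - 1): elements of Fin n count from zero.
Polygon : ℕ → Set
Polygon n = Fin n → Point

record IsCyclic {n} (P : Polygon n) : Set where
  field
    centre     : Point
    radius     : ℝ
    radius-pos : 0ℝ < radius
    on-circle  : ∀ i → sqDist centre (P i) ≈ radius ^ 2
    distinct   : ∀ i j → i ≢ j → ¬ (P i ≈ᴾ P j)

-- The order A₁ , … , Aₙ of points on a circle is anticlockwise when, for all
-- p < q < r, one meets Aₚ, A_q, Aᵣ in this order while moving anticlockwise
-- along the circle from Aₚ, that is, when the triangle AₚA_qAᵣ is positively
-- oriented.
IsAnticlockwise : ∀ {n} → Polygon n → Set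
IsAnticlockwise P = ∀ i j k → i Fin.< j → j Fin.< k →
  0ℝ < area₄ (P i) (P j) (P k)

-- Indices and exponents below are natural numbers and _∸_ truncates at 0.
-- This agrees with the conventions for nonpositive indices and negative
-- exponents: a nonpositive index becomes the index 0, whose entries are 1, and
-- a negative exponent becomes the exponent 0. An empty product stays empty,
-- since every product with a truncated upper bound starts at a positive index.

module Frieze {n : ℕ} (P : Polygon n) where

  vertex : ℕ → Maybe Point
  vertex zero = nothing
  vertex (suc p) with p ℕₚ.<? n
  ... | yes p<n = just (P (fromℕ< p<n))
  ... | no  _   = nothing

  x : ℕ → ℕ → ℝ
  x p q with vertex p | vertex q
  ... | just A | just B = sqDist A B
  ... | _      | _      = 1ℝ

  S : ℕ → ℕ → ℕ → ℝ
  S p q r with vertex p | vertex q | vertex r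
  ... | just A | just B | just C = area₄ A B C
  ... | _      | _      | _      = 1ℝ

  a b : ℕ → ℕ
  a m = if does (m ℕₚ.≟ 1) ∨ does (m ℕₚ.≟ 3) then 1 else 0
  b m = if does (m ℕₚ.≟ 1) ∨ does (m ℕₚ.≟ 3) ∨ does (m ℕₚ.≟ 5) then 1 else 0

  c : ℕ
  c = if does (n ℕₚ.≟ 6) then 0 else 1

  xᵉ xᵒ₆ xᵒ : ℕ → ℝ
  xᵉ m =
      x 1 2 * x 3 4 ^ c
    * (∏ᵉ[ m ⋯ n ∸ 2 ] λ l → x l (l ℕ.+ 1) ^ ((l ∸ 2) / 2))
    * (∏ᵒ[ 5 ⋯ m ∸ 1 ] λ l → x l (l ℕ.+ 1) ^ ((l ∸ 3) / 2))
  xᵒ₆ m =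
      x 1 2 ^ a m
    * (∏ᵉ[ m ∸ 1 ⋯ n ∸ 2 ] λ l → x l (l ℕ.+ 1) ^ ((l ∸ 2) / 2))
    * (∏ᵒ[ 5 ⋯ m ] λ l → x l (l ℕ.+ 1) ^ ((l ∸ 3) / 2))
  xᵒ m =
      x 1 2 ^ a m * x 3 4 ^ b m
    * x (m ∸ 2) (m ∸ 1) ^ ((m ∸ 5) / 2)
    * x m (m ℕ.+ 1) ^ ((m ∸ 3) / 2)
    * (∏ᵉ[ m ∸ 1 ⋯ n ∸ 2 ] λ l → x l (l ℕ.+ 1) ^ ((l ∸ 2) / 2))
    * (∏ᵒ[ 5 ⋯ m ∸ 4 ] λ l → x l (l ℕ.+ 1) ^ ((l ∸ 5) / 2))

  Sᵉ Sᵒ : ℕ → ℝ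
  Sᵉ m =
      (∏[ 1 ⋯ m ∸ 1 ] λ k →
          (∏ᵉ[ k ℕ.+ 1 ⋯ m ∸ 2 ] λ l → S k l (l ℕ.+ 1))
        * (∏ᵒ[ m ℕ.+ 1 ⋯ n ∸ 1 ] λ l → S k l (l ℕ.+ 1)))
    * (∏[ m ⋯ n ∸ 3 ] λ k →
          ∏ᵒ[ k ℕ.+ 2 ⋯ n ∸ 1 ] λ l → S (k ℕ.+ 1) l (l ℕ.+ 1))
  Sᵒ m =
      S (m ∸ 2) (m ∸ 1) (m ℕ.+ 1)
    * (∏ᵒ[ m ℕ.+ 2 ⋯ n ∸ 1 ] λ l →
          S (m ∸ 1) l (l ℕ.+ 1) * S (m ∸ 2) l (l ℕ.+ 1) * S (m ∸ 3) l (l ℕ.+ 1))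
    * (∏[ m ⋯ n ∸ 3 ] λ k →
          ∏ᵒ[ k ℕ.+ 2 ⋯ n ∸ 1 ] λ l → S (k ℕ.+ 1) l (l ℕ.+ 1))
    * (∏[ 1 ⋯ m ∸ 4 ] λ k →
          (S k (k ℕ.+ 1) (k ℕ.+ 2) * S k (k ℕ.+ 1) (m ∸ 1) * S k (k ℕ.+ 1) (m ℕ.+ 1))
            ^ (k % 2)
        * (∏ᵉ[ k ℕ.+ 2 ⋯ m ∸ 2 ] λ l → S k l (l ℕ.+ 1))
        * (∏ᵒ[ m ℕ.+ 2 ⋯ n ∸ 1 ] λ l → S k l (l ℕ.+ 1)))

  xₘ Sₘ : ℕ → ℝ
  xₘ m = if does (2 ∣? m) then xᵉ m
         else if does (n ℕₚ.≟ 6) then xᵒ₆ m else xᵒ m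
  Sₘ m = if does (2 ∣? m) then Sᵉ m else Sᵒ m

-- Fix a vertex B of the polygon. For a vertex A_i ≠ B let u_i be the chord A_i − B;
-- for A_i = B let u_i be a tangent vector at B. With [i j] = 2 u_i × u_j,
-- ν_i = 1 / ∣u_i∣² and κ the squared radius, the sine rule reads
--   x_{ij} = κ ν_i ν_j [i j]²,   S_{ijk} = κ ν_i ν_j ν_k [i j] [j k] [i k].
-- Apart from one vertex m, the vertices are grouped as a first vertex followed by
-- pairs; each S in S(m) consists, up to squares of brackets [r s] of such pairs,
-- of brackets that occur once in the Vandermonde product V_m of all [i j] with
-- i, j ≠ m, and the powers in x(m) make up for these squares. Hence, with n = 2h + 2,
--   x(m) S(m) = const · V_m · ∏_{i ≠ m} ν_i^h = const′ · V_m · ∣u_m∣^{2h},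
-- where the constants do not depend on m. Finally Σ_m (−1)^m V_m f(u_m) = 0 for
-- every form f of degree n − 2, by induction on n: if f = L g with L linear, then
-- Cramer's rule [v w] L(u_m) = L(u_v) [m w] − L(u_w) [m v] turns [v w] times the sum
-- into multiples of two sums of the same kind with one vector less.
module Submission where

open import Algebra.Bundles using (CommutativeRing)
import Algebra.Properties.CommutativeSemiring.Exp as Exp
import Algebra.Solver.Ring as RingSolver
import Algebra.Solver.Ring.AlmostCommutativeRing as ACR
open import Algebra.Structures using (IsCommutativeRing)
open import Data.Bool.Base using (if_then_else_; true; false)
open import Data.Fin.Base as Fin using (fromℕ<)
import Data.Fin.Properties as Finₚ
open import Data.List.Base
  using (List; []; _∷_; length; map; foldr; filter; applyUpTo; applyDownFrom)
import Data.List.Properties as Listₚ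
open import Data.List.Relation.Unary.AllPairs using (AllPairs; []; _∷_)
import Data.List.Relation.Unary.AllPairs.Properties as AllPairsₚ
open import Data.List.Relation.Unary.All using ([]; _∷_)
open import Data.Maybe.Base as Maybe using (Maybe; just)
open import Data.Nat.Base as ℕ using (ℕ; zero; suc; _∸_; z≤n; s≤s; _%_; _/_)
  renaming (_<_ to _<ℕ_; _+_ to _+ℕ_)
open import Data.Nat.Divisibility using (_∣_; _∣?_; divides; ∣m+n∣m⇒∣n; ∣⇒≤)
open import Data.Nat.DivMod using ([m+kn]%n≡m%n; m*n%n≡0; m*n/n≡m)
import Data.Nat.Properties as ℕₚ
open import Data.Product.Base using (Σ; ∃; _×_; _,_; proj₁; proj₂)
open import Data.Rational.Base as ℚ using (ℚ; 0ℚ; 1ℚ; ½; ∣_∣)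
import Data.Rational.Properties as ℚₚ
open import Data.Rational.Solver using (module +-*-Solver)
open import Data.Sum.Base using (inj₁; inj₂)
open import Function.Base using (_∘_; id)
open import Level using (0ℓ)
open import Relation.Binary.Consequences using (dec⇒weaklyDec)
open import Relation.Binary.PropositionalEquality as ≡ using (_≡_; cong; cong₂; subst)
import Relation.Binary.Reasoning.Setoid as SetoidReasoning
open import Relation.Nullary.Decidable using (Dec; does; yes; no; ¬?; dec-true; dec-false)
open import Relation.Nullary.Negation using (¬_; contradiction)
open import Relation.Unary using (Decidable)
open import Defs

-- The commutative ring of real numbers

-- Real numbers are Cauchy sequences here, so every cancellation needs an explicit inverse. All
-- inverses come from the orientation: a positive area is eventually bounded below by a positive
-- rational, and norms and brackets inherit this. The direction u may be a chord or a tangent alike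
-- because A - B = 2 (u · c) u / ∣u∣², with c the vector from B to the centre, does not change when
-- u is scaled. Origin of the exponents: delete m, list the other vertices as z₀, ..., z_{2h}, and
-- let row j consist of the pair r = z_{2j+1}, s = z_{2j+2} and its areas with the 2j + 1 earlier
-- vertices. Each of these areas contains [r s]; one bracket goes into the Vandermonde product, and
-- j squares turn into x_{rs}^j. Which side rs is depends on whether the pair lies before or after
-- m, so S(m) yields the powers of some sides only. The product x(m) supplies the complementary
-- ones: together they contain x_{2j+2,2j+3}^j and x_{2j+3,2j+4}^j for every j. For odd m > 1 the
-- pair m - 1, m + 1 straddles the gap and is no side at all, which is why S(m) has a different
-- shape there.

Eventually : (ℕ → Set) → Set
Eventually Q = ∃ λ N → ∀ i → N ℕ.≤ i → Q i

Eventually-map₂ : ∀ {Q R T : ℕ → Set} → (∀ i → Q i → R i → T i) →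
  Eventually Q → Eventually R → Eventually T
Eventually-map₂ f (M , q) (N , r) = M ℕ.⊔ N , λ i h →
  f i (q i (ℕₚ.m⊔n≤o⇒m≤o M N h)) (r i (ℕₚ.m⊔n≤o⇒n≤o M N h))

module _ where
  open +-*-Solver

  -‿regroup : ∀ a b p q → (a ℚ.+ b) ℚ.- (p ℚ.+ q) ≡ (a ℚ.- p) ℚ.+ (b ℚ.- q)
  -‿regroup = solve 4 (λ a b p q → (a :+ b) :- (p :+ q) := (a :- p) :+ (b :- q)) ≡.refl

  -‿split : ∀ a p b → a ℚ.- b ≡ (a ℚ.- p) ℚ.+ (p ℚ.- b)
  -‿split = solve 3 (λ a p b → a :- b := (a :- p) :+ (p :- b)) ≡.refl

  -‿swap : ∀ a b → a ℚ.- b ≡ ℚ.- (b ℚ.- a)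
  -‿swap = solve 2 (λ a b → a :- b := :- (b :- a)) ≡.refl

  -‿neg : ∀ a b → ℚ.- a ℚ.- (ℚ.- b) ≡ ℚ.- (a ℚ.- b)
  -‿neg = solve 2 (λ a b → :- a :- (:- b) := :- (a :- b)) ≡.refl

  -‿*ˡ : ∀ a b c → a ℚ.* c ℚ.- b ℚ.* c ≡ c ℚ.* (a ℚ.- b)
  -‿*ˡ = solve 3 (λ a b c → a :* c :- b :* c := c :* (a :- b)) ≡.refl

half-pos : ∀ {ε} → 0ℚ ℚ.< ε → 0ℚ ℚ.< ½ ℚ.* ε
half-pos = ℚₚ.*-monoʳ-<-pos ½

half+half : ∀ ε → ½ ℚ.* ε ℚ.+ ½ ℚ.* ε ≡ ε
half+half ε = ≡.trans (≡.sym (ℚₚ.*-distribʳ-+ ε ½ ½)) (ℚₚ.*-identityˡ ε)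

∣+∣-< : ∀ a b {δ η} → ∣ a ∣ ℚ.< δ → ∣ b ∣ ℚ.< η → ∣ a ℚ.+ b ∣ ℚ.< δ ℚ.+ η
∣+∣-< a b h k = ℚₚ.≤-<-trans (ℚₚ.∣p+q∣≤∣p∣+∣q∣ a b) (ℚₚ.+-mono-< h k)

∣+∣-<-half : ∀ a b {ε} → ∣ a ∣ ℚ.< ½ ℚ.* ε → ∣ b ∣ ℚ.< ½ ℚ.* ε → ∣ a ℚ.+ b ∣ ℚ.< ε
∣+∣-<-half a b {ε} h k = subst (∣ a ℚ.+ b ∣ ℚ.<_) (half+half ε) (∣+∣-< a b h k)

-- Lets the ring laws be inherited from ℚ term by term, as the operations act termwise on sequences.
pointwise : ∀ {x y} → (∀ i → seq x i ≡ seq y i) → x ≈ y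
pointwise {x} {y} eq = *≈* λ ε 0<ε → 0 , λ i _ →
  subst (λ q → ∣ q ∣ ℚ.< ε)
    (≡.sym (≡.trans (cong (ℚ._- seq y i) (eq i)) (ℚₚ.+-inverseʳ (seq y i)))) 0<ε

≈-refl : ∀ {x} → x ≈ x
≈-refl = pointwise λ _ → ≡.refl

≈-sym : ∀ {x y} → x ≈ y → y ≈ x
≈-sym {x} {y} (*≈* h) = *≈* λ ε 0<ε → let (N , c) = h ε 0<ε in N , λ i N≤i →
  subst (ℚ._< ε) (≡.trans (≡.sym (ℚₚ.∣-p∣≡∣p∣ (seq x i ℚ.- seq y i)))
    (cong ∣_∣ (≡.sym (-‿swap (seq y i) (seq x i))))) (c i N≤i)

≈-trans : ∀ {x y z} → x ≈ y → y ≈ z → x ≈ z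
≈-trans {x} {y} {z} (*≈* h) (*≈* k) = *≈* λ ε 0<ε →
  Eventually-map₂ (λ i p q →
    subst (λ r → ∣ r ∣ ℚ.< ε) (≡.sym (-‿split (seq x i) (seq y i) (seq z i)))
      (∣+∣-<-half (seq x i ℚ.- seq y i) (seq y i ℚ.- seq z i) p q))
    (h (½ ℚ.* ε) (half-pos 0<ε)) (k (½ ℚ.* ε) (half-pos 0<ε))

+-cong : ∀ {x x′ y y′} → x ≈ x′ → y ≈ y′ → x + y ≈ x′ + y′
+-cong {x} {x′} {y} {y′} (*≈* h) (*≈* k) = *≈* λ ε 0<ε →
  Eventually-map₂ (λ i p q →
    subst (λ r → ∣ r ∣ ℚ.< ε)
      (≡.sym (-‿regroup (seq x i) (seq y i) (seq x′ i) (seq y′ i)))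
      (∣+∣-<-half (seq x i ℚ.- seq x′ i) (seq y i ℚ.- seq y′ i) p q))
    (h (½ ℚ.* ε) (half-pos 0<ε)) (k (½ ℚ.* ε) (half-pos 0<ε))

-‿cong : ∀ {x y} → x ≈ y → - x ≈ - y
-‿cong {x} {y} (*≈* h) = *≈* λ ε 0<ε → let (N , c) = h ε 0<ε in N , λ i N≤i →
  subst (ℚ._< ε) (≡.trans (≡.sym (ℚₚ.∣-p∣≡∣p∣ (seq x i ℚ.- seq y i)))
    (cong ∣_∣ (≡.sym (-‿neg (seq x i) (seq y i))))) (c i N≤i)

bounded : ∀ x → Σ ℚ λ B → (0ℚ ℚ.< B) × Eventually λ i → ∣ seq x i ∣ ℚ.≤ B
bounded x with cauchy x 1ℚ (ℚₚ.positive⁻¹ 1ℚ)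
... | N , close = 1ℚ ℚ.+ ∣ seq x N ∣ ,
  ℚₚ.+-mono-<-≤ (ℚₚ.positive⁻¹ 1ℚ) (ℚₚ.0≤∣p∣ (seq x N)) , N , λ i N≤i → begin
    ∣ seq x i ∣                            ≡⟨ cong ∣_∣ (≡.sym (p-q+q≡p (seq x i) (seq x N))) ⟩
    ∣ (seq x i ℚ.- seq x N) ℚ.+ seq x N ∣  ≤⟨ ℚₚ.∣p+q∣≤∣p∣+∣q∣ (seq x i ℚ.- seq x N) (seq x N) ⟩
    ∣ seq x i ℚ.- seq x N ∣ ℚ.+ ∣ seq x N ∣
      ≤⟨ ℚₚ.+-monoˡ-≤ ∣ seq x N ∣ (ℚₚ.<⇒≤ (close i N N≤i ℕₚ.≤-refl)) ⟩
    1ℚ ℚ.+ ∣ seq x N ∣                     ∎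
  where
  open ℚₚ.≤-Reasoning
  open +-*-Solver
  p-q+q≡p : ∀ p q → (p ℚ.- q) ℚ.+ q ≡ p
  p-q+q≡p = solve 2 (λ p q → (p :- q) :+ q := p) ≡.refl

divide : ∀ B ε → 0ℚ ℚ.< B → 0ℚ ℚ.< ε → Σ ℚ λ δ → (0ℚ ℚ.< δ) × (B ℚ.* δ ≡ ε)
divide B ε 0<B 0<ε = ℚ.1/ B ℚ.* ε ,
  ℚₚ.positive⁻¹ _ {{ℚₚ.pos*pos⇒pos (ℚ.1/ B) {{ℚₚ.1/pos⇒pos B}} ε {{ℚ.positive 0<ε}}}} ,
  ≡.trans (≡.sym (ℚₚ.*-assoc B (ℚ.1/ B) ε))
    (≡.trans (cong (ℚ._* ε) (ℚₚ.*-inverseʳ B)) (ℚₚ.*-identityˡ ε))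
  where
  instance
    B⁺ : ℚ.Positive B
    B⁺ = ℚ.positive 0<B
    B≢0 : ℚ.NonZero B
    B≢0 = ℚₚ.pos⇒nonZero B

∣*∣-< : ∀ {D} a b {e} → 0ℚ ℚ.< D → ∣ a ∣ ℚ.≤ D → ∣ b ∣ ℚ.< e → ∣ a ℚ.* b ∣ ℚ.< D ℚ.* e
∣*∣-< {D} a b {e} 0<D a≤D b<e = begin-strict
  ∣ a ℚ.* b ∣      ≡⟨ ℚₚ.∣p*q∣≡∣p∣*∣q∣ a b ⟩
  ∣ a ∣ ℚ.* ∣ b ∣  ≤⟨ ℚₚ.*-monoʳ-≤-nonNeg ∣ b ∣ {{ℚ.nonNegative (ℚₚ.0≤∣p∣ b)}} a≤D ⟩
  D ℚ.* ∣ b ∣      <⟨ ℚₚ.*-monoʳ-<-pos D {{ℚ.positive 0<D}} b<e ⟩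
  D ℚ.* e          ∎
  where open ℚₚ.≤-Reasoning

-- With an eventual bound B on `z`, it is enough to bring `x` and `x′` closer than ε / B.
*-congʳ : ∀ {x x′ z} → x ≈ x′ → x * z ≈ x′ * z
*-congʳ {x} {x′} {z} (*≈* h) = *≈* λ ε 0<ε →
  let (B , 0<B , z≤B) = bounded z
      (δ , 0<δ , Bδ≡ε) = divide B ε 0<B 0<ε
  in Eventually-map₂ (λ i p q →
       ≡.subst₂ (λ r s → ∣ r ∣ ℚ.< s) (≡.sym (-‿*ˡ (seq x i) (seq x′ i) (seq z i))) Bδ≡ε
         (∣*∣-< (seq z i) (seq x i ℚ.- seq x′ i) 0<B p q))
     z≤B (h δ 0<δ)

*-comm : ∀ x y → x * y ≈ y * x
*-comm x y = pointwise λ i → ℚₚ.*-comm (seq x i) (seq y i)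

*-cong : ∀ {x x′ y y′} → x ≈ x′ → y ≈ y′ → x * y ≈ x′ * y′
*-cong {x} {x′} {y} {y′} h k =
  ≈-trans (*-congʳ h) (≈-trans (*-comm x′ y) (≈-trans (*-congʳ k) (*-comm y′ x′)))

ℝ-isCommutativeRing : IsCommutativeRing _≈_ _+_ _*_ -_ 0ℝ 1ℝ
ℝ-isCommutativeRing = record
  { isRing = record
    { +-isAbelianGroup = record
      { isGroup = record
        { isMonoid = record
          { isSemigroup = record
            { isMagma = record
              { isEquivalence = record { refl = ≈-refl ; sym = ≈-sym ; trans = ≈-trans }
              ; ∙-cong = +-cong
              }
            ; assoc = λ x y z → pointwise λ i → ℚₚ.+-assoc (seq x i) (seq y i) (seq z i)
            }
          ; identity = (λ x → pointwise λ i → ℚₚ.+-identityˡ (seq x i)) ,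
                       (λ x → pointwise λ i → ℚₚ.+-identityʳ (seq x i))
          }
        ; inverse = (λ x → pointwise λ i → ℚₚ.+-inverseˡ (seq x i)) ,
                    (λ x → pointwise λ i → ℚₚ.+-inverseʳ (seq x i))
        ; ⁻¹-cong = -‿cong
        }
      ; comm = λ x y → pointwise λ i → ℚₚ.+-comm (seq x i) (seq y i)
      }
    ; *-cong = *-cong
    ; *-assoc = λ x y z → pointwise λ i → ℚₚ.*-assoc (seq x i) (seq y i) (seq z i)
    ; *-identity = (λ x → pointwise λ i → ℚₚ.*-identityˡ (seq x i)) ,
                   (λ x → pointwise λ i → ℚₚ.*-identityʳ (seq x i))
    ; distrib = (λ x y z → pointwise λ i → ℚₚ.*-distribˡ-+ (seq x i) (seq y i) (seq z i)) ,
                (λ x y z → pointwise λ i → ℚₚ.*-distribʳ-+ (seq x i) (seq y i) (seq z i))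
    }
  ; *-comm = *-comm
  }

ℝ-commutativeRing : CommutativeRing 0ℓ 0ℓ
ℝ-commutativeRing = record { isCommutativeRing = ℝ-isCommutativeRing }

ℝ-almostCommutativeRing : ACR.AlmostCommutativeRing 0ℓ 0ℓ
ℝ-almostCommutativeRing = ACR.fromCommutativeRing ℝ-commutativeRing

-- Equality of reals is undecidable; polynomial identities are therefore normalised with rational
-- coefficients, whose equality `fromℚ-≈?` decides.
fromℚ-homomorphism : ℚₚ.+-*-rawRing ACR.-Raw-AlmostCommutative⟶ ℝ-almostCommutativeRing
fromℚ-homomorphism = record
  { ⟦_⟧    = fromℚ
  ; +-homo = λ _ _ → pointwise λ _ → ≡.refl
  ; *-homo = λ _ _ → pointwise λ _ → ≡.refl
  ; -‿homo = λ _ → pointwise λ _ → ≡.refl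
  ; 0-homo = ≈-refl
  ; 1-homo = ≈-refl
  }

fromℚ-≈? : ∀ p q → Maybe (fromℚ p ≈ fromℚ q)
fromℚ-≈? p q = Maybe.map (λ { ≡.refl → ≈-refl }) (dec⇒weaklyDec ℚₚ._≟_ p q)

module ℝ-Solver = RingSolver ℚₚ.+-*-rawRing ℝ-almostCommutativeRing fromℚ-homomorphism fromℚ-≈?

-- Constructive apartness from zero is expressed by having an inverse.

Invertible : ℝ → Set
Invertible x = ∃ λ y → x * y ≈ 1ℝ

module _ {x : ℝ} {ε : ℚ} (0<ε : 0ℚ ℚ.< ε) (ε≤x : Eventually λ i → ε ℚ.≤ seq x i) where
  private
    -- The maximum with ε agrees with `x` eventually and is positive at every index, so that a
    -- reciprocal exists everywhere and not only from some index on.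
    p : ℕ → ℚ
    p i = ε ℚ.⊔ seq x i

    0<p : ∀ i → 0ℚ ℚ.< p i
    0<p i = ℚₚ.<-≤-trans 0<ε (ℚₚ.p≤p⊔q ε (seq x i))

    instance
      p⁺ : ∀ {i} → ℚ.Positive (p i)
      p⁺ {i} = ℚ.positive (0<p i)
      p≢0 : ∀ {i} → ℚ.NonZero (p i)
      p≢0 {i} = ℚₚ.pos⇒nonZero (p i)
      ε⁺ : ℚ.Positive ε
      ε⁺ = ℚ.positive 0<ε
      ε≢0 : ℚ.NonZero ε
      ε≢0 = ℚₚ.pos⇒nonZero ε

    r : ℕ → ℚ
    r i = ℚ.1/ p i

    B : ℚ
    B = ℚ.1/ ε

    0<r : ∀ i → 0ℚ ℚ.< r i
    0<r i = ℚₚ.positive⁻¹ (r i) {{ℚₚ.1/pos⇒pos (p i)}}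

    0<B : 0ℚ ℚ.< B
    0<B = ℚₚ.positive⁻¹ B {{ℚₚ.1/pos⇒pos ε}}

    r≤B : ∀ i → r i ℚ.≤ B
    r≤B i = ℚₚ.*-cancelʳ-≤-pos ε (begin
      r i ℚ.* ε    ≤⟨ ℚₚ.*-monoˡ-≤-nonNeg (r i) {{ℚ.nonNegative (ℚₚ.<⇒≤ (0<r i))}} (ℚₚ.p≤p⊔q ε (seq x i)) ⟩
      r i ℚ.* p i  ≡⟨ ℚₚ.*-inverseˡ (p i) ⟩
      1ℚ           ≡⟨ ℚₚ.*-inverseˡ ε ⟨
      B ℚ.* ε      ∎)
      where open ℚₚ.≤-Reasoning

    ∣r∣≤B : ∀ i → ∣ r i ∣ ℚ.≤ B
    ∣r∣≤B i = subst (ℚ._≤ B) (≡.sym (ℚₚ.0≤p⇒∣p∣≡p (ℚₚ.<⇒≤ (0<r i)))) (r≤B i)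

    r-difference : ∀ i j → r i ℚ.- r j ≡ r i ℚ.* (r j ℚ.* (p j ℚ.- p i))
    r-difference i j = ≡.sym (begin
      r i ℚ.* (r j ℚ.* (p j ℚ.- p i))                        ≡⟨ expand (r i) (r j) (p i) (p j) ⟩
      r i ℚ.* (r j ℚ.* p j) ℚ.- r j ℚ.* (r i ℚ.* p i)
        ≡⟨ cong₂ (λ s t → r i ℚ.* s ℚ.- r j ℚ.* t) (ℚₚ.*-inverseˡ (p j)) (ℚₚ.*-inverseˡ (p i)) ⟩
      r i ℚ.* 1ℚ ℚ.- r j ℚ.* 1ℚ
        ≡⟨ cong₂ ℚ._-_ (ℚₚ.*-identityʳ (r i)) (ℚₚ.*-identityʳ (r j)) ⟩
      r i ℚ.- r j                                            ∎)
      where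
      open ≡.≡-Reasoning
      open +-*-Solver
      expand : ∀ a b c d → a ℚ.* (b ℚ.* (d ℚ.- c)) ≡ a ℚ.* (b ℚ.* d) ℚ.- b ℚ.* (a ℚ.* c)
      expand = solve 4 (λ a b c d → a :* (b :* (d :- c)) := a :* (b :* d) :- b :* (a :* c)) ≡.refl

    p≡x : ∀ {i} → ε ℚ.≤ seq x i → p i ≡ seq x i
    p≡x = ℚₚ.p≤q⇒p⊔q≡q

    -- By `r-difference` a difference of reciprocals carries two factors `r`, each at most `B`;
    -- hence the tolerance η is divided by `B` twice.
    r-cauchy : IsCauchy r
    r-cauchy η 0<η =
      let (δ , 0<δ , Bδ≡η) = divide B η 0<B 0<η
          (γ , 0<γ , Bγ≡δ) = divide B δ 0<B 0<δ
          (M , x-close)    = cauchy x γ 0<γ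
          (N , ε≤xᵢ)       = ε≤x
      in M ℕ.⊔ N , λ i j hi hj →
        let p-close : ∣ p j ℚ.- p i ∣ ℚ.< γ
            p-close = ≡.subst₂ (λ s t → ∣ s ℚ.- t ∣ ℚ.< γ)
              (≡.sym (p≡x (ε≤xᵢ j (ℕₚ.m⊔n≤o⇒n≤o M N hj))))
              (≡.sym (p≡x (ε≤xᵢ i (ℕₚ.m⊔n≤o⇒n≤o M N hi))))
              (x-close j i (ℕₚ.m⊔n≤o⇒m≤o M N hj) (ℕₚ.m⊔n≤o⇒m≤o M N hi))
            inner : ∣ r j ℚ.* (p j ℚ.- p i) ∣ ℚ.< δ
            inner = subst (∣ r j ℚ.* (p j ℚ.- p i) ∣ ℚ.<_) Bγ≡δ
              (∣*∣-< (r j) (p j ℚ.- p i) 0<B (∣r∣≤B j) p-close)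
        in ≡.subst₂ (λ s t → ∣ s ∣ ℚ.< t) (≡.sym (r-difference i j)) Bδ≡η
             (∣*∣-< (r i) (r j ℚ.* (p j ℚ.- p i)) 0<B (∣r∣≤B i) inner)

  bounded-below⇒invertible : Invertible x
  bounded-below⇒invertible = mkℝ r r-cauchy , *≈* λ η 0<η →
    let (N , ε≤xᵢ) = ε≤x in N , λ i N≤i →
      subst (λ q → ∣ q ∣ ℚ.< η) (≡.sym (begin
        seq x i ℚ.* r i ℚ.- 1ℚ  ≡⟨ cong (λ q → q ℚ.* r i ℚ.- 1ℚ) (p≡x (ε≤xᵢ i N≤i)) ⟨
        p i ℚ.* r i ℚ.- 1ℚ      ≡⟨ cong (ℚ._- 1ℚ) (ℚₚ.*-inverseʳ (p i)) ⟩
        1ℚ ℚ.- 1ℚ               ≡⟨ ℚₚ.+-inverseʳ 1ℚ ⟩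
        0ℚ                      ∎)) 0<η
    where open ≡.≡-Reasoning

0<⇒bounded-below : ∀ x → 0ℝ < x → Σ ℚ λ ε → (0ℚ ℚ.< ε) × Eventually λ i → ε ℚ.≤ seq x i
0<⇒bounded-below x (ε , 0<ε , N , h) = ε , 0<ε , N , λ i N≤i →
  subst (ℚ._≤ _) (ℚₚ.+-identityˡ ε) (h i N≤i)

positive⇒invertible : ∀ {x} → 0ℝ < x → Invertible x
positive⇒invertible {x} 0<x = let (_ , 0<ε , h) = 0<⇒bounded-below x 0<x in bounded-below⇒invertible 0<ε h

-- Adding a second square does not spoil the lower bound ε² of the first, whatever the sign of `y`.
positive⇒x²+y²-invertible : ∀ {x} y → 0ℝ < x → Invertible (x * x + y * y)
positive⇒x²+y²-invertible {x} y 0<x =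
  let (ε , 0<ε , N , ε≤x) = 0<⇒bounded-below x 0<x in
  bounded-below⇒invertible {ε = ε ℚ.* ε}
    (ℚₚ.positive⁻¹ (ε ℚ.* ε) {{ℚₚ.pos*pos⇒pos ε {{ℚ.positive 0<ε}} ε {{ℚ.positive 0<ε}}}})
    (N , λ i N≤i → begin
      ε ℚ.* ε                                      ≤⟨ square-mono 0<ε (ε≤x i N≤i) ⟩
      seq x i ℚ.* seq x i                          ≡⟨ ℚₚ.+-identityʳ _ ⟨
      seq x i ℚ.* seq x i ℚ.+ 0ℚ                   ≤⟨ ℚₚ.+-monoʳ-≤ (seq x i ℚ.* seq x i) (0≤q² (seq y i)) ⟩
      seq x i ℚ.* seq x i ℚ.+ seq y i ℚ.* seq y i  ∎)
  where
  open ℚₚ.≤-Reasoning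
  square-mono : ∀ {p q} → 0ℚ ℚ.< p → p ℚ.≤ q → p ℚ.* p ℚ.≤ q ℚ.* q
  square-mono {p} {q} 0<p p≤q = ℚₚ.≤-trans
    (ℚₚ.*-monoˡ-≤-nonNeg p {{ℚ.nonNegative (ℚₚ.<⇒≤ 0<p)}} p≤q)
    (ℚₚ.*-monoʳ-≤-nonNeg q {{ℚ.nonNegative (ℚₚ.≤-trans (ℚₚ.<⇒≤ 0<p) p≤q)}} p≤q)
  0≤p⇒0≤p² : ∀ p → 0ℚ ℚ.≤ p → 0ℚ ℚ.≤ p ℚ.* p
  0≤p⇒0≤p² p 0≤p = ℚₚ.nonNegative⁻¹ (p ℚ.* p) {{ℚₚ.nonNeg*nonNeg⇒nonNeg p {{p⁺}} p {{p⁺}}}}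
    where p⁺ = ℚ.nonNegative 0≤p
  ∣q∣²≡q² : ∀ q → ∣ q ∣ ℚ.* ∣ q ∣ ≡ q ℚ.* q
  ∣q∣²≡q² q with ∣ q ∣ | ℚₚ.∣p∣≡p∨∣p∣≡-p q
  ... | _ | inj₁ ≡.refl = ≡.refl
  ... | _ | inj₂ ≡.refl = solve 1 (λ p → (:- p) :* (:- p) := p :* p) ≡.refl q
    where open +-*-Solver
  0≤q² : ∀ q → 0ℚ ℚ.≤ q ℚ.* q
  0≤q² q = subst (0ℚ ℚ.≤_) (∣q∣²≡q² q) (0≤p⇒0≤p² ∣ q ∣ (ℚₚ.0≤∣p∣ q))

open CommutativeRing ℝ-commutativeRing
  using (setoid; +-congˡ; +-congʳ; *-congˡ; +-identityˡ; +-identityʳ; *-identityˡ; *-identityʳ;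
         zeroʳ; *-assoc; +-assoc; -‿inverseʳ; commutativeSemiring; reflexive)
open Exp commutativeSemiring using (^-homo-*; ^-distrib-*; ^-congˡ)
open SetoidReasoning setoid
open ℝ-Solver using (Polynomial; solve; _:=_; _:+_; _:*_; _:-_; :-_; con; _:^_)

:2 : ∀ {n} → Polynomial n
:2 = con 1ℚ :+ con 1ℚ

:norm : ∀ {n} → Polynomial n → Polynomial n → Polynomial n
:norm p q = p :* p :+ q :* q

:bracket : ∀ {n} → Polynomial n → Polynomial n → Polynomial n → Polynomial n → Polynomial n
:bracket p q p′ q′ = :2 :* (p :* q′ :- q :* p′)

-- Alternating sums of Vandermonde products

invertible-cancelˡ : ∀ {c z} → Invertible c → c * z ≈ 0ℝ → z ≈ 0ℝ
invertible-cancelˡ {c} {z} (c⁻¹ , cc⁻¹≈1) cz≈0 = begin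
  z               ≈⟨ *-identityˡ z ⟨
  1ℝ * z          ≈⟨ *-congʳ cc⁻¹≈1 ⟨
  c * c⁻¹ * z     ≈⟨ solve 3 (λ c d z → c :* d :* z := d :* (c :* z)) ≈-refl c c⁻¹ z ⟩
  c⁻¹ * (c * z)   ≈⟨ *-congˡ cz≈0 ⟩
  c⁻¹ * 0ℝ        ≈⟨ zeroʳ c⁻¹ ⟩
  0ℝ              ∎

-- The head is the last factor, so that on `applyDownFrom z k` this is literally `∏< k (φ ∘ z)`.
weightProduct : (ℕ → ℝ) → List ℕ → ℝ
weightProduct φ []       = 1ℝ
weightProduct φ (v ∷ vs) = weightProduct φ vs * φ v

weightProduct-1 : ∀ vs → weightProduct (λ _ → 1ℝ) vs ≈ 1ℝ
weightProduct-1 []       = ≈-refl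
weightProduct-1 (v ∷ vs) = ≈-trans (*-identityʳ _) (weightProduct-1 vs)

weightProduct-* : ∀ φ ψ vs →
  weightProduct (λ w → φ w * ψ w) vs ≈ weightProduct φ vs * weightProduct ψ vs
weightProduct-* φ ψ []       = ≈-sym (*-identityʳ 1ℝ)
weightProduct-* φ ψ (v ∷ vs) = ≈-trans (*-congʳ (weightProduct-* φ ψ vs))
  (solve 4 (λ a b c d → a :* b :* (c :* d) := a :* c :* (b :* d)) ≈-refl
    (weightProduct φ vs) (weightProduct ψ vs) (φ v) (ψ v))

weightProduct-cong : ∀ {φ ψ} → (∀ w → φ w ≈ ψ w) → ∀ vs → weightProduct φ vs ≈ weightProduct ψ vs
weightProduct-cong φ≈ψ []       = ≈-refl
weightProduct-cong φ≈ψ (v ∷ vs) = *-cong (weightProduct-cong φ≈ψ vs) (φ≈ψ v)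

module Vectors (p q : ℕ → ℝ) where

  -- The factor 2 gives squared distances and areas the same constant κ below.
  bracket : ℕ → ℕ → ℝ
  bracket v w = (1ℝ + 1ℝ) * (p v * q w - q v * p w)

  -- On a descending list every bracket has its smaller index first.
  vandermonde : List ℕ → ℝ
  vandermonde []       = 1ℝ
  vandermonde (v ∷ vs) = vandermonde vs * weightProduct (λ w → bracket w v) vs

  -- The alternating sum over the entries m of a list of the products of g m
  -- with the weights of the other entries and with their Vandermonde product.
  altSum : (g φ : ℕ → ℝ) → List ℕ → ℝ
  altSum g φ []       = 0ℝ
  -- When an entry other than `v` is deleted, `v` stays: its weight comes out in front, and its
  -- brackets with the surviving entries are absorbed into their weights.
  altSum g φ (v ∷ vs) =
    g v * (weightProduct φ vs * vandermonde vs) - φ v * altSum g (λ w → φ w * bracket w v) vs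

  altSum-cong : ∀ {g g′ φ φ′} → (∀ w → g w ≈ g′ w) → (∀ w → φ w ≈ φ′ w) →
    ∀ vs → altSum g φ vs ≈ altSum g′ φ′ vs
  altSum-cong g≈ φ≈ []       = ≈-refl
  altSum-cong g≈ φ≈ (v ∷ vs) = +-cong
    (*-cong (g≈ v) (*-congʳ (weightProduct-cong φ≈ vs)))
    (-‿cong (*-cong (φ≈ v) (altSum-cong g≈ (λ w → *-congʳ (φ≈ w)) vs)))

  altSum-+ : ∀ f g φ vs → altSum (λ w → f w + g w) φ vs ≈ altSum f φ vs + altSum g φ vs
  altSum-+ f g φ []       = ≈-sym (+-identityʳ 0ℝ)
  altSum-+ f g φ (v ∷ vs) = ≈-trans
    (+-congˡ (-‿cong (*-congˡ (altSum-+ f g _ vs))))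
    (solve 6 (λ a b c d e h →
        (a :+ b) :* c :- d :* (e :+ h) := (a :* c :- d :* e) :+ (b :* c :- d :* h)) ≈-refl
      (f v) (g v) (weightProduct φ vs * vandermonde vs) (φ v)
      (altSum f (λ w → φ w * bracket w v) vs) (altSum g (λ w → φ w * bracket w v) vs))

  altSum-*ˡ : ∀ c g φ vs → altSum (λ w → c * g w) φ vs ≈ c * altSum g φ vs
  altSum-*ˡ c g φ []       = ≈-sym (zeroʳ c)
  altSum-*ˡ c g φ (v ∷ vs) = ≈-trans
    (+-congˡ (-‿cong (*-congˡ (altSum-*ˡ c g _ vs))))
    (solve 5 (λ c a b d e → c :* a :* b :- d :* (c :* e) := c :* (a :* b :- d :* e)) ≈-refl
      c (g v) (weightProduct φ vs * vandermonde vs) (φ v) (altSum g (λ w → φ w * bracket w v) vs))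

  -- The deletion of an entry m loses exactly the weight `φ m`. The factor `φ m` next to `g m`
  -- restores it, so the full product over `vs` comes out.
  altSum-weight : ∀ g φ ψ vs →
    altSum (λ w → g w * φ w) (λ w → φ w * ψ w) vs ≈ weightProduct φ vs * altSum g ψ vs
  altSum-weight g φ ψ []       = ≈-sym (zeroʳ 1ℝ)
  altSum-weight g φ ψ (v ∷ vs) = begin
    g v * φ v * (weightProduct (λ w → φ w * ψ w) vs * vandermonde vs)
      - φ v * ψ v * altSum (λ w → g w * φ w) (λ w → φ w * ψ w * bracket w v) vs
      ≈⟨ +-cong (*-congˡ (*-congʳ (weightProduct-* φ ψ vs)))
           (-‿cong (*-congˡ (≈-trans
             (altSum-cong (λ _ → ≈-refl) (λ w → *-assoc (φ w) (ψ w) (bracket w v)) vs)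
             (altSum-weight g φ (λ w → ψ w * bracket w v) vs)))) ⟩
    g v * φ v * (Φ * Ψ * vandermonde vs) - φ v * ψ v * (Φ * A)
      ≈⟨ solve 7 (λ g φ ψ Φ Ψ V A → g :* φ :* (Φ :* Ψ :* V) :- φ :* ψ :* (Φ :* A)
           := Φ :* φ :* (g :* (Ψ :* V) :- ψ :* A)) ≈-refl (g v) (φ v) (ψ v) Φ Ψ (vandermonde vs) A ⟩
    Φ * φ v * (g v * (Ψ * vandermonde vs) - ψ v * A) ∎
    where
    Φ Ψ A : ℝ
    Φ = weightProduct φ vs
    Ψ = weightProduct ψ vs
    A = altSum g (λ w → ψ w * bracket w v) vs

  infixr 7 p·_ q·_
  infixr 6 _⊕_

  -- Homogeneous polynomials in the two coordinates, kept as syntax: the degree is the index, and an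
  -- induction can peel off one linear factor at a time.
  data Form : ℕ → Set where
    one     : Form 0
    p·_ q·_ : ∀ {k} → Form k → Form (suc k)
    _⊕_     : ∀ {k} → Form k → Form k → Form k

  ⟦_⟧ : ∀ {k} → Form k → ℕ → ℝ
  ⟦ one ⟧   v = 1ℝ
  ⟦ p· f ⟧  v = p v * ⟦ f ⟧ v
  ⟦ q· f ⟧  v = q v * ⟦ f ⟧ v
  ⟦ f ⊕ g ⟧ v = ⟦ f ⟧ v + ⟦ g ⟧ v

  Independent : List ℕ → Set
  Independent = AllPairs λ v w → Invertible (bracket v w)

  unweighted : ℕ → ℝ
  unweighted _ = 1ℝ

  -- The factor `bracket m v` kills the term m = v. In each other term it restores the bracket with
  -- `v` that the deletion of m removed, so all these brackets come out and the sum without `v` is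
  -- left.
  altSum-bracket-head : ∀ g v vs →
    altSum (λ m → g m * bracket m v) unweighted (v ∷ vs)
      ≈ - (weightProduct (λ m → bracket m v) vs * altSum g unweighted vs)
  altSum-bracket-head g v vs = begin
    g v * bracket v v * W - 1ℝ * altSum (λ m → g m * bracket m v) (λ m → 1ℝ * bracket m v) vs
      ≈⟨ +-congˡ (-‿cong (*-congˡ (altSum-cong (λ _ → ≈-refl) (λ m → *-comm 1ℝ (bracket m v)) vs))) ⟩
    g v * bracket v v * W - 1ℝ * altSum (λ m → g m * bracket m v) (λ m → bracket m v * 1ℝ) vs
      ≈⟨ +-congˡ (-‿cong (*-congˡ (altSum-weight g (λ m → bracket m v) unweighted vs))) ⟩
    g v * bracket v v * W - 1ℝ * A
      ≈⟨ solve 5 (λ g p q W A → g :* :bracket p q p q :* W :- con 1ℚ :* A := :- A) ≈-refl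
           (g v) (p v) (q v) W A ⟩
    - A ∎
    where
    W A : ℝ
    W = weightProduct unweighted vs * vandermonde vs
    A = weightProduct (λ m → bracket m v) vs * altSum g unweighted vs

  -- The mechanism is the same with `w` in place of `v`. The sign is opposite to that of the head
  -- case, because the sum changes sign when `v` and `w` are exchanged.
  altSum-bracket-second : ∀ g v w vs →
    altSum (λ m → g m * bracket m w) unweighted (v ∷ w ∷ vs)
      ≈ bracket v w * weightProduct (λ m → bracket m w) vs * altSum g unweighted (v ∷ vs)
  altSum-bracket-second g v w vs = begin
    g v * bracket v w * (U * 1ℝ * (V * Π))
      - 1ℝ * (g w * bracket w w * (W * V)
        - 1ℝ * bracket w v * altSum (λ m → g m * bracket m w) (λ m → 1ℝ * bracket m v * bracket m w) vs)
      ≈⟨ +-congˡ (-‿cong (*-congˡ (+-congˡ (-‿cong (*-congˡ (≈-trans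
           (altSum-cong (λ _ → ≈-refl) (λ m →
             solve 2 (λ a b → con 1ℚ :* a :* b := b :* a) ≈-refl (bracket m v) (bracket m w)) vs)
           (altSum-weight g (λ m → bracket m w) (λ m → bracket m v) vs))))))) ⟩
    g v * bracket v w * (U * 1ℝ * (V * Π))
      - 1ℝ * (g w * bracket w w * (W * V) - 1ℝ * bracket w v * (Π * A))
      ≈⟨ solve 11 (λ gv gw pv qv pw qw U V W Π A →
           gv :* :bracket pv qv pw qw :* (U :* con 1ℚ :* (V :* Π))
             :- con 1ℚ :* (gw :* :bracket pw qw pw qw :* (W :* V) :- con 1ℚ :* :bracket pw qw pv qv :* (Π :* A))
           := :bracket pv qv pw qw :* Π :* (gv :* (U :* V) :- con 1ℚ :* A)) ≈-refl
           (g v) (g w) (p v) (q v) (p w) (q w) U V W Π A ⟩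
    bracket v w * Π * (g v * (U * V) - 1ℝ * A)
      ≈⟨ *-congˡ (+-congˡ (-‿cong (*-congˡ
           (altSum-cong (λ _ → ≈-refl) (λ m → ≈-sym (*-identityˡ (bracket m v))) vs)))) ⟩
    bracket v w * Π * altSum g unweighted (v ∷ vs) ∎
    where
    U V W Π A : ℝ
    U = weightProduct unweighted vs
    V = vandermonde vs
    W = weightProduct (λ m → 1ℝ * bracket m v) vs
    Π = weightProduct (λ m → bracket m w) vs
    A = altSum g (λ m → bracket m v) vs

  -- Each of the two terms of Cramer's rule for a linear form L removes v or w
  -- from the sum.
  altSum-linear : ∀ (L g : ℕ → ℝ) v w vs →
    (∀ m → bracket v w * L m ≈ L v * bracket m w - L w * bracket m v) →
    altSum g unweighted (v ∷ vs) ≈ 0ℝ → altSum g unweighted (w ∷ vs) ≈ 0ℝ →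
    bracket v w * altSum (λ m → L m * g m) unweighted (v ∷ w ∷ vs) ≈ 0ℝ
  altSum-linear L g v w vs cramer Av≈0 Aw≈0 = begin
    bracket v w * altSum (λ m → L m * g m) unweighted (v ∷ w ∷ vs)
      ≈⟨ altSum-*ˡ (bracket v w) (λ m → L m * g m) unweighted (v ∷ w ∷ vs) ⟨
    altSum (λ m → bracket v w * (L m * g m)) unweighted (v ∷ w ∷ vs)
      ≈⟨ altSum-cong (λ m → begin
           bracket v w * (L m * g m)                      ≈⟨ *-assoc (bracket v w) (L m) (g m) ⟨
           bracket v w * L m * g m                        ≈⟨ *-congʳ (cramer m) ⟩
           (L v * bracket m w - L w * bracket m v) * g m
             ≈⟨ solve 5 (λ a b c d e → (a :* b :- c :* d) :* e := a :* (e :* b) :+ (:- c) :* (e :* d))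
                  ≈-refl (L v) (bracket m w) (L w) (bracket m v) (g m) ⟩
           L v * (g m * bracket m w) + (- L w) * (g m * bracket m v) ∎)
         (λ _ → ≈-refl) (v ∷ w ∷ vs) ⟩
    altSum (λ m → L v * (g m * bracket m w) + (- L w) * (g m * bracket m v)) unweighted (v ∷ w ∷ vs)
      ≈⟨ altSum-+ (λ m → L v * (g m * bracket m w)) (λ m → (- L w) * (g m * bracket m v))
           unweighted (v ∷ w ∷ vs) ⟩
    altSum (λ m → L v * (g m * bracket m w)) unweighted (v ∷ w ∷ vs)
      + altSum (λ m → (- L w) * (g m * bracket m v)) unweighted (v ∷ w ∷ vs)
      ≈⟨ +-cong (altSum-*ˡ (L v) (λ m → g m * bracket m w) unweighted (v ∷ w ∷ vs))
           (altSum-*ˡ (- L w) (λ m → g m * bracket m v) unweighted (v ∷ w ∷ vs)) ⟩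
    L v * altSum (λ m → g m * bracket m w) unweighted (v ∷ w ∷ vs)
      + (- L w) * altSum (λ m → g m * bracket m v) unweighted (v ∷ w ∷ vs)
      ≈⟨ +-cong
           (*-congˡ (≈-trans (altSum-bracket-second g v w vs) (*-congˡ Av≈0)))
           (*-congˡ (≈-trans (altSum-bracket-head g v (w ∷ vs)) (-‿cong (*-congˡ Aw≈0)))) ⟩
    L v * (X * 0ℝ) + (- L w) * (- (Y * 0ℝ))
      ≈⟨ solve 4 (λ a b c d → a :* (b :* con 0ℚ) :+ (:- c) :* (:- (d :* con 0ℚ)) := con 0ℚ)
           ≈-refl (L v) X (L w) Y ⟩
    0ℝ ∎
    where
    X Y : ℝ
    X = bracket v w * weightProduct (λ m → bracket m w) vs
    Y = weightProduct (λ m → bracket m v) (w ∷ vs)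

  -- The number of vectors stays two above the degree: peeling off a linear factor lowers the degree
  -- by one, and each Cramer term loses one of `v` and `w`. Independence allows `bracket v w` to be
  -- cancelled at the end.
  altSum-form≈0 : ∀ {k} (f : Form k) v w vs → length vs ≡ k → Independent (v ∷ w ∷ vs) →
    altSum ⟦ f ⟧ unweighted (v ∷ w ∷ vs) ≈ 0ℝ
  -- Two vectors in degree zero: both deletions give 1, with opposite signs.
  altSum-form≈0 one v w [] _ _ =
    solve 1 (λ b → con 1ℚ :* (con 1ℚ :* con 1ℚ :* (con 1ℚ :* con 1ℚ))
      :- con 1ℚ :* (con 1ℚ :* (con 1ℚ :* con 1ℚ) :- b :* con 0ℚ) := con 0ℚ) ≈-refl (1ℝ * bracket w v)
  altSum-form≈0 (p· f) v w (t ∷ vs) eq ((vw ∷ v#) ∷ (w# ∷ vs#)) = invertible-cancelˡ vw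
    (altSum-linear p ⟦ f ⟧ v w (t ∷ vs) (λ m →
      solve 6 (λ pv qv pw qw pm qm →
        :bracket pv qv pw qw :* pm := pv :* :bracket pm qm pw qw :- pw :* :bracket pm qm pv qv) ≈-refl
        (p v) (q v) (p w) (q w) (p m) (q m))
      (altSum-form≈0 f v t vs (ℕₚ.suc-injective eq) (v# ∷ vs#))
      (altSum-form≈0 f w t vs (ℕₚ.suc-injective eq) (w# ∷ vs#)))
  altSum-form≈0 (q· f) v w (t ∷ vs) eq ((vw ∷ v#) ∷ (w# ∷ vs#)) = invertible-cancelˡ vw
    (altSum-linear q ⟦ f ⟧ v w (t ∷ vs) (λ m →
      solve 6 (λ pv qv pw qw pm qm →
        :bracket pv qv pw qw :* qm := qv :* :bracket pm qm pw qw :- qw :* :bracket pm qm pv qv) ≈-refl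
        (p v) (q v) (p w) (q w) (p m) (q m))
      (altSum-form≈0 f v t vs (ℕₚ.suc-injective eq) (v# ∷ vs#))
      (altSum-form≈0 f w t vs (ℕₚ.suc-injective eq) (w# ∷ vs#)))
  altSum-form≈0 (f ⊕ g) v w vs eq vs# = begin
    altSum (λ m → ⟦ f ⟧ m + ⟦ g ⟧ m) unweighted (v ∷ w ∷ vs)
      ≈⟨ altSum-+ ⟦ f ⟧ ⟦ g ⟧ unweighted (v ∷ w ∷ vs) ⟩
    altSum ⟦ f ⟧ unweighted (v ∷ w ∷ vs) + altSum ⟦ g ⟧ unweighted (v ∷ w ∷ vs)
      ≈⟨ +-cong (altSum-form≈0 f v w vs eq vs#) (altSum-form≈0 g v w vs eq vs#) ⟩
    0ℝ + 0ℝ ≈⟨ +-identityʳ 0ℝ ⟩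
    0ℝ ∎

-- Products over ranges and parity classes

∏< : ℕ → (ℕ → ℝ) → ℝ
∏< zero    f = 1ℝ
∏< (suc k) f = ∏< k f * f k

∏<-cong : ∀ k {f g} → (∀ i → i ℕ.< k → f i ≈ g i) → ∏< k f ≈ ∏< k g
∏<-cong zero    f≈g = ≈-refl
∏<-cong (suc k) f≈g =
  *-cong (∏<-cong k (λ i i<k → f≈g i (ℕₚ.m<n⇒m<1+n i<k))) (f≈g k ℕₚ.≤-refl)

∏<-cong! : ∀ k {f g} → (∀ i → f i ≈ g i) → ∏< k f ≈ ∏< k g
∏<-cong! k f≈g = ∏<-cong k (λ i _ → f≈g i)

∏<-cons : ∀ k f → ∏< (suc k) f ≈ f 0 * ∏< k (f ∘ suc)
∏<-cons zero    f = *-comm 1ℝ (f 0)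
∏<-cons (suc k) f = ≈-trans (*-congʳ (∏<-cons k f)) (*-assoc (f 0) _ _)

∏<-1 : ∀ k → ∏< k (λ _ → 1ℝ) ≈ 1ℝ
∏<-1 zero    = ≈-refl
∏<-1 (suc k) = ≈-trans (*-identityʳ _) (∏<-1 k)

∏<-* : ∀ k f g → ∏< k (λ i → f i * g i) ≈ ∏< k f * ∏< k g
∏<-* zero    f g = ≈-sym (*-identityʳ 1ℝ)
∏<-* (suc k) f g = ≈-trans (*-congʳ (∏<-* k f g))
  (solve 4 (λ a b c d → a :* b :* (c :* d) := a :* c :* (b :* d)) ≈-refl (∏< k f) (∏< k g) (f k) (g k))

∏<-+ : ∀ k l f → ∏< (k ℕ.+ l) f ≈ ∏< k f * ∏< l (λ i → f (k ℕ.+ i))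
∏<-+ zero    l f = ≈-sym (*-identityˡ _)
∏<-+ (suc k) l f = begin
  ∏< (suc (k ℕ.+ l)) f                                    ≈⟨ ∏<-cons (k ℕ.+ l) f ⟩
  f 0 * ∏< (k ℕ.+ l) (f ∘ suc)                            ≈⟨ *-congˡ (∏<-+ k l (f ∘ suc)) ⟩
  f 0 * (∏< k (f ∘ suc) * ∏< l (λ i → f (suc (k ℕ.+ i)))) ≈⟨ *-assoc _ _ _ ⟨
  f 0 * ∏< k (f ∘ suc) * ∏< l (λ i → f (suc (k ℕ.+ i)))   ≈⟨ *-congʳ (∏<-cons k f) ⟨
  ∏< (suc k) f * ∏< l (λ i → f (suc (k ℕ.+ i)))           ∎

∏<-const : ∀ k c → ∏< k (λ _ → c) ≈ c ^ k
∏<-const zero    c = ≈-refl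
∏<-const (suc k) c = ≈-trans (*-congʳ (∏<-const k c)) (*-comm _ c)

∏<-pairs : ∀ k f → ∏< (k ℕ.* 2) f ≈ ∏< k (λ j → f (j ℕ.* 2) * f (suc (j ℕ.* 2)))
∏<-pairs zero    f = ≈-refl
∏<-pairs (suc k) f = ≈-trans (*-assoc _ _ _) (*-congʳ (∏<-pairs k f))

∏<-double : ∀ k f → (∀ j → f (suc (j ℕ.* 2)) ≈ 1ℝ) → ∏< (k ℕ.* 2) f ≈ ∏< k (λ j → f (j ℕ.* 2))
∏<-double k f odd≈1 = ≈-trans (∏<-pairs k f)
  (∏<-cong! k (λ j → ≈-trans (*-congˡ (odd≈1 j)) (*-identityʳ _)))

-- A range whose two ends have the wanted parity has odd length 2k - 1; the missing last position is
-- trivial anyway. Truncation makes the formula right for the empty range too.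
∏<-double∸1 : ∀ k f → (∀ j → f (suc (j ℕ.* 2)) ≈ 1ℝ) →
  ∏< (k ℕ.* 2 ∸ 1) f ≈ ∏< k (λ j → f (j ℕ.* 2))
∏<-double∸1 zero    f odd≈1 = ≈-refl
∏<-double∸1 (suc k) f odd≈1 = *-congʳ (∏<-double k f odd≈1)

-- Exchange of the order of multiplication over all i ≤ l < L. It turns products ordered by the
-- first index of an area, as in S(m), into products ordered by the pair of its other two indices.
∏<-triangle : ∀ L (g : ℕ → ℕ → ℝ) →
  ∏< L (λ i → ∏< (L ∸ i) (λ t → g i (i ℕ.+ t))) ≈ ∏< L (λ l → ∏< (suc l) (λ i → g i l))
∏<-triangle zero    g = ≈-refl
∏<-triangle (suc L) g = begin
  ∏< L (λ i → ∏< (suc L ∸ i) (λ t → g i (i ℕ.+ t))) * ∏< (suc L ∸ L) (λ t → g L (L ℕ.+ t))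
    ≈⟨ *-cong (∏<-cong L row) lastRow ⟩
  ∏< L (λ i → ∏< (L ∸ i) (λ t → g i (i ℕ.+ t)) * g i L) * g L L
    ≈⟨ *-congʳ (≈-trans (∏<-* L _ _) (*-congʳ (∏<-triangle L g))) ⟩
  ∏< L (λ l → ∏< (suc l) (λ i → g i l)) * ∏< L (λ i → g i L) * g L L
    ≈⟨ *-assoc _ _ _ ⟩
  ∏< L (λ l → ∏< (suc l) (λ i → g i l)) * ∏< (suc L) (λ i → g i L) ∎
  where
  row : ∀ i → i ℕ.< L →
    ∏< (suc L ∸ i) (λ t → g i (i ℕ.+ t)) ≈ ∏< (L ∸ i) (λ t → g i (i ℕ.+ t)) * g i L
  row i i<L rewrite ℕₚ.+-∸-assoc 1 (ℕₚ.<⇒≤ i<L) | ℕₚ.m+[n∸m]≡n (ℕₚ.<⇒≤ i<L) = ≈-refl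
  lastRow : ∏< (suc L ∸ L) (λ t → g L (L ℕ.+ t)) ≈ g L L
  lastRow rewrite ℕₚ.m+n∸n≡m 1 L | ℕₚ.+-identityʳ L = *-identityˡ _

-- Factors of the wrong parity become 1 instead of being filtered out, which keeps the positions in
-- a product regular.
whenᵉ whenᵒ : ℕ → ℝ → ℝ
whenᵉ l y = if does (2 ∣? l) then y else 1ℝ
whenᵒ l y = if does (¬? (2 ∣? l)) then y else 1ℝ

2∣even : ∀ j → 2 ∣ j ℕ.* 2
2∣even j = divides j ≡.refl

2∤odd : ∀ j → ¬ 2 ∣ suc (j ℕ.* 2)
2∤odd j 2∣odd = contradiction
  (∣⇒≤ (∣m+n∣m⇒∣n (subst (2 ∣_) (ℕₚ.+-comm 1 (j ℕ.* 2)) 2∣odd) (2∣even j))) λ { (s≤s ()) }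

does-even : ∀ j → does (2 ∣? j ℕ.* 2) ≡ true
does-even j = dec-true (2 ∣? j ℕ.* 2) (2∣even j)

does-odd : ∀ j → does (2 ∣? suc (j ℕ.* 2)) ≡ false
does-odd j = dec-false (2 ∣? suc (j ℕ.* 2)) (2∤odd j)

module _ {l : ℕ} {y : ℝ} (j : ℕ) where
  whenᵉ-even : l ≡ j ℕ.* 2 → whenᵉ l y ≈ y
  whenᵉ-even ≡.refl rewrite does-even j = ≈-refl

  whenᵉ-odd : l ≡ suc (j ℕ.* 2) → whenᵉ l y ≈ 1ℝ
  whenᵉ-odd ≡.refl rewrite does-odd j = ≈-refl

  whenᵒ-even : l ≡ j ℕ.* 2 → whenᵒ l y ≈ 1ℝ
  whenᵒ-even ≡.refl rewrite does-even j = ≈-refl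

  whenᵒ-odd : l ≡ suc (j ℕ.* 2) → whenᵒ l y ≈ y
  whenᵒ-odd ≡.refl rewrite does-odd j = ≈-refl

foldr-applyUpTo : ∀ k f → foldr _*_ 1ℝ (applyUpTo f k) ≈ ∏< k f
foldr-applyUpTo zero    f = ≈-refl
foldr-applyUpTo (suc k) f =
  ≈-trans (*-congˡ (foldr-applyUpTo k (f ∘ suc))) (≈-sym (∏<-cons k f))

productOver-interval : ∀ α β f → ∏[ α ⋯ β ] f ≈ ∏< (suc β ∸ α) (λ i → f (α ℕ.+ i))
productOver-interval α β f = ≈-trans
  (reflexive (cong (foldr _*_ 1ℝ) (≡.trans (cong (map f) (Listₚ.map-applyUpTo id (α ℕ.+_) L))
    (Listₚ.map-applyUpTo (α ℕ.+_) f L))))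
  (foldr-applyUpTo L (λ i → f (α ℕ.+ i)))
  where L = suc β ∸ α

productOver-filter : ∀ {Q : ℕ → Set} (Q? : Decidable Q) f ls →
  productOver (filter Q? ls) f ≈ productOver ls (λ l → if does (Q? l) then f l else 1ℝ)
productOver-filter Q? f []       = ≈-refl
productOver-filter Q? f (l ∷ ls) with does (Q? l)
... | true  = *-congˡ (productOver-filter Q? f ls)
... | false = ≈-trans (productOver-filter Q? f ls) (≈-sym (*-identityˡ _))

∏ᵉ-interval : ∀ α β f → (∏ᵉ[ α ⋯ β ] f) ≈ ∏< (suc β ∸ α) (λ i → whenᵉ (α ℕ.+ i) (f (α ℕ.+ i)))
∏ᵉ-interval α β f = ≈-trans (productOver-filter (2 ∣?_) f (interval α β))
  (productOver-interval α β (λ l → whenᵉ l (f l)))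

∏ᵒ-interval : ∀ α β f → (∏ᵒ[ α ⋯ β ] f) ≈ ∏< (suc β ∸ α) (λ i → whenᵒ (α ℕ.+ i) (f (α ℕ.+ i)))
∏ᵒ-interval α β f = ≈-trans (productOver-filter (λ l → ¬? (2 ∣? l)) f (interval α β))
  (productOver-interval α β (λ l → whenᵒ l (f l)))

+-*2 : ∀ a j → a ℕ.* 2 ℕ.+ j ℕ.* 2 ≡ (a ℕ.+ j) ℕ.* 2
+-*2 a j = ≡.sym (ℕₚ.*-distribʳ-+ 2 a j)

+-*2+1 : ∀ a j → a ℕ.* 2 ℕ.+ suc (j ℕ.* 2) ≡ suc ((a ℕ.+ j) ℕ.* 2)
+-*2+1 a j = ≡.trans (ℕₚ.+-suc (a ℕ.* 2) (j ℕ.* 2)) (cong suc (+-*2 a j))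

∏ᵉ-evens : ∀ a c β f → suc β ∸ a ℕ.* 2 ≡ c ℕ.* 2 ∸ 1 →
  (∏ᵉ[ a ℕ.* 2 ⋯ β ] f) ≈ ∏< c (λ j → f ((a ℕ.+ j) ℕ.* 2))
∏ᵉ-evens a c β f eq = begin
  (∏ᵉ[ a ℕ.* 2 ⋯ β ] f)                                       ≈⟨ ∏ᵉ-interval (a ℕ.* 2) β f ⟩
  ∏< (suc β ∸ a ℕ.* 2) F                                      ≡⟨ cong (λ L → ∏< L F) eq ⟩
  ∏< (c ℕ.* 2 ∸ 1) F
    ≈⟨ ∏<-double∸1 c F (λ j → whenᵉ-odd (a ℕ.+ j) (+-*2+1 a j)) ⟩
  ∏< c (λ j → F (j ℕ.* 2))
    ≈⟨ ∏<-cong! c (λ j → ≈-trans (whenᵉ-even (a ℕ.+ j) (+-*2 a j)) (reflexive (cong f (+-*2 a j)))) ⟩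
  ∏< c (λ j → f ((a ℕ.+ j) ℕ.* 2))                            ∎
  where
  F : ℕ → ℝ
  F i = whenᵉ (a ℕ.* 2 ℕ.+ i) (f (a ℕ.* 2 ℕ.+ i))

∏ᵒ-odds : ∀ a c {α} β f → α ≡ suc (a ℕ.* 2) → suc β ∸ α ≡ c ℕ.* 2 ∸ 1 →
  (∏ᵒ[ α ⋯ β ] f) ≈ ∏< c (λ j → f (suc ((a ℕ.+ j) ℕ.* 2)))
∏ᵒ-odds a c {α} β f ≡.refl eq = begin
  (∏ᵒ[ α ⋯ β ] f)                                       ≈⟨ ∏ᵒ-interval α β f ⟩
  ∏< (suc β ∸ α) F                                      ≡⟨ cong (λ L → ∏< L F) eq ⟩
  ∏< (c ℕ.* 2 ∸ 1) F
    ≈⟨ ∏<-double∸1 c F (λ j → whenᵒ-even (suc (a ℕ.+ j)) (cong suc (+-*2+1 a j))) ⟩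
  ∏< c (λ j → F (j ℕ.* 2))
    ≈⟨ ∏<-cong! c (λ j → ≈-trans (whenᵒ-odd (a ℕ.+ j) (cong suc (+-*2 a j)))
         (reflexive (cong (f ∘ suc) (+-*2 a j)))) ⟩
  ∏< c (λ j → f (suc ((a ℕ.+ j) ℕ.* 2)))                ∎
  where
  F : ℕ → ℝ
  F i = whenᵒ (suc (a ℕ.* 2) ℕ.+ i) (f (suc (a ℕ.* 2) ℕ.+ i))

∑< : ℕ → (ℕ → ℝ) → ℝ
∑< zero    f = 0ℝ
∑< (suc k) f = ∑< k f + f k

∑<-cong : ∀ k {f g} → (∀ i → i ℕ.< k → f i ≈ g i) → ∑< k f ≈ ∑< k g
∑<-cong zero    f≈g = ≈-refl
∑<-cong (suc k) f≈g =
  +-cong (∑<-cong k (λ i i<k → f≈g i (ℕₚ.m<n⇒m<1+n i<k))) (f≈g k ℕₚ.≤-refl)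

∑<-*ˡ : ∀ k c f → ∑< k (λ i → c * f i) ≈ c * ∑< k f
∑<-*ˡ zero    c f = ≈-sym (zeroʳ c)
∑<-*ˡ (suc k) c f = ≈-trans (+-congʳ (∑<-*ˡ k c f))
  (solve 3 (λ c s t → c :* s :+ c :* t := c :* (s :+ t)) ≈-refl c (∑< k f) (f k))

∑<-cons : ∀ k f → ∑< (suc k) f ≈ f 0 + ∑< k (f ∘ suc)
∑<-cons zero    f = ≈-trans (+-identityˡ (f 0)) (≈-sym (+-identityʳ (f 0)))
∑<-cons (suc k) f = ≈-trans (+-congʳ (∑<-cons k f)) (+-assoc (f 0) _ _)

foldr-+-applyUpTo : ∀ k f → foldr _+_ 0ℝ (applyUpTo f k) ≈ ∑< k f
foldr-+-applyUpTo zero    f = ≈-refl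
foldr-+-applyUpTo (suc k) f =
  ≈-trans (+-congˡ (foldr-+-applyUpTo k (f ∘ suc))) (≈-sym (∑<-cons k f))

sumOver-interval : ∀ α β f → ∑[ α ⋯ β ] f ≈ ∑< (suc β ∸ α) (λ i → f (α ℕ.+ i))
sumOver-interval α β f = ≈-trans
  (reflexive (cong (foldr _+_ 0ℝ) (≡.trans (cong (map f) (Listₚ.map-applyUpTo id (α ℕ.+_) L))
    (Listₚ.map-applyUpTo (α ℕ.+_) f L))))
  (foldr-+-applyUpTo L (λ i → f (α ℕ.+ i)))
  where L = suc β ∸ α

-- The increasing enumeration of the numbers other than m. For m ≤ k, `applyDownFrom (skip m) k`
-- lists what is left of 0, ..., k after m is deleted.
skip : ℕ → ℕ → ℕ
skip zero    i       = suc i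
skip (suc m) zero    = zero
skip (suc m) (suc i) = suc (skip m i)

skip-< : ∀ {m i} → i ℕ.< m → skip m i ≡ i
skip-< {suc m} {zero}  _         = ≡.refl
skip-< {suc m} {suc i} (s≤s i<m) = cong suc (skip-< i<m)

skip-≥ : ∀ {m i} → m ℕ.≤ i → skip m i ≡ suc i
skip-≥ {zero}  _                   = ≡.refl
skip-≥ {suc m} {suc i} (s≤s m≤i)   = cong suc (skip-≥ m≤i)

skip-≤suc : ∀ m i → skip m i ℕ.≤ suc i
skip-≤suc zero    i       = ℕₚ.≤-refl
skip-≤suc (suc m) zero    = z≤n
skip-≤suc (suc m) (suc i) = s≤s (skip-≤suc m i)

∏<-skip : ∀ {m} k f → m ℕ.≤ k → ∏< k (f ∘ skip m) * f m ≈ ∏< (suc k) f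
∏<-skip {m} zero    f z≤n = ≈-refl
∏<-skip {m} (suc k) f m≤1+k with ℕₚ.m≤n⇒m<n∨m≡n m≤1+k
... | inj₂ ≡.refl = *-congʳ (∏<-cong (suc k) (λ i i<m → reflexive (cong f (skip-< i<m))))
... | inj₁ (s≤s m≤k) = begin
  ∏< k (f ∘ skip m) * f (skip m k) * f m   ≡⟨ cong (λ v → ∏< k (f ∘ skip m) * f v * f m) (skip-≥ m≤k) ⟩
  ∏< k (f ∘ skip m) * f (suc k) * f m
    ≈⟨ solve 3 (λ a b c → a :* b :* c := a :* c :* b) ≈-refl (∏< k (f ∘ skip m)) (f (suc k)) (f m) ⟩
  ∏< k (f ∘ skip m) * f m * f (suc k)      ≈⟨ *-congʳ (∏<-skip k f m≤k) ⟩
  ∏< (suc k) f * f (suc k)                 ∎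

weightProduct-applyDownFrom : ∀ φ z k → weightProduct φ (applyDownFrom z k) ≡ ∏< k (φ ∘ z)
weightProduct-applyDownFrom φ z zero    = ≡.refl
weightProduct-applyDownFrom φ z (suc k) = cong (_* φ (z k)) (weightProduct-applyDownFrom φ z k)

applyDownFrom-cong : ∀ {y z : ℕ → ℕ} k → (∀ i → i ℕ.< k → y i ≡ z i) →
  applyDownFrom y k ≡ applyDownFrom z k
applyDownFrom-cong zero    y≡z = ≡.refl
applyDownFrom-cong (suc k) y≡z = cong₂ _∷_ (y≡z k ℕₚ.≤-refl)
  (applyDownFrom-cong k (λ i i<k → y≡z i (ℕₚ.m<n⇒m<1+n i<k)))

module _ (p q : ℕ → ℝ) where
  open Vectors p q

  deletions : (g φ : ℕ → ℝ) → ℕ → ℕ → ℝ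
  deletions g φ k m = g m *
    (weightProduct φ (applyDownFrom (skip m) k) * vandermonde (applyDownFrom (skip m) k))

  -- In `altSum` the head, here the largest index k, has sign +, whereas the explicit sum gives it
  -- (-1)^k; hence the global sign.
  ∑-deletions : ∀ g φ k → ∑< (suc k) (λ m → (- 1ℝ) ^ m * deletions g φ k m)
    ≈ (- 1ℝ) ^ k * altSum g φ (applyDownFrom id (suc k))
  ∑-deletions g φ zero = solve 2 (λ a b →
    con 0ℚ :+ con 1ℚ :* (a :* (con 1ℚ :* con 1ℚ)) := con 1ℚ :* (a :* (con 1ℚ :* con 1ℚ) :- b :* con 0ℚ))
    ≈-refl (g 0) (φ 0)
  ∑-deletions g φ (suc k) = begin
    ∑< (suc k) (λ m → (- 1ℝ) ^ m * deletions g φ (suc k) m) + (- 1ℝ) ^ suc k * deletions g φ (suc k) (suc k)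
      ≈⟨ +-cong (∑<-cong (suc k) keep-last)
           (*-congˡ (reflexive (cong (λ vs → g (suc k) * (weightProduct φ vs * vandermonde vs))
             (applyDownFrom-cong (suc k) (λ i → skip-<))))) ⟩
    ∑< (suc k) (λ m → φ (suc k) * ((- 1ℝ) ^ m * deletions g ψ k m)) + (- 1ℝ) ^ suc k * W
      ≈⟨ +-congʳ (≈-trans (∑<-*ˡ (suc k) (φ (suc k)) _) (*-congˡ (∑-deletions g ψ k))) ⟩
    φ (suc k) * ((- 1ℝ) ^ k * A) + (- 1ℝ) ^ suc k * W
      ≈⟨ solve 4 (λ f s A W → f :* (s :* A) :+ (:- con 1ℚ) :* s :* W := (:- con 1ℚ) :* s :* (W :- f :* A))
           ≈-refl (φ (suc k)) ((- 1ℝ) ^ k) A W ⟩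
    (- 1ℝ) ^ suc k * (W - φ (suc k) * A) ∎
    where
    ψ : ℕ → ℝ
    ψ w = φ w * bracket w (suc k)
    W A : ℝ
    W = g (suc k) * (weightProduct φ (applyDownFrom id (suc k)) * vandermonde (applyDownFrom id (suc k)))
    A = altSum g ψ (applyDownFrom id (suc k))
    -- For m ≤ k the last vertex survives. Moving its weight to the front and its brackets into the
    -- weights reproduces the recursion of `altSum`.
    keep-last : ∀ m → m ℕ.< suc k →
      (- 1ℝ) ^ m * deletions g φ (suc k) m ≈ φ (suc k) * ((- 1ℝ) ^ m * deletions g ψ k m)
    keep-last m (s≤s m≤k) rewrite skip-≥ m≤k = ≈-trans
      (solve 6 (λ s g Φ f V B → s :* (g :* (Φ :* f :* (V :* B))) := f :* (s :* (g :* (Φ :* B :* V))))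
        ≈-refl ((- 1ℝ) ^ m) (g m) (weightProduct φ zs) (φ (suc k)) (vandermonde zs)
        (weightProduct (λ w → bracket w (suc k)) zs))
      (*-congˡ (*-congˡ (*-congˡ (*-congʳ (≈-sym (weightProduct-* φ (λ w → bracket w (suc k)) zs))))))
      where zs = applyDownFrom (skip m) k

-- The products of sides and areas

^-double : ∀ c j → c ^ (j ℕ.* 2) ≈ (c * c) ^ j
^-double c zero    = ≈-refl
^-double c (suc j) = ≈-trans (≈-sym (*-assoc c c _)) (*-congˡ (^-double c j))

-- Meant for β = [r s] and e = κ ν_r ν_s: the base e β² is then x_{rs}, and a single β is left for
-- the Vandermonde product.
^-odd-split : ∀ e β j → (e * β) ^ suc (j ℕ.* 2) ≈ (e * (β * β)) ^ j * (e ^ suc j * β)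
^-odd-split e β j = begin
  e * β * (e * β) ^ (j ℕ.* 2)                ≈⟨ *-congˡ (^-double (e * β) j) ⟩
  e * β * (e * β * (e * β)) ^ j
    ≈⟨ *-congˡ (≈-trans (^-congˡ j (solve 2 (λ e β → e :* β :* (e :* β) := e :* (β :* β) :* e) ≈-refl e β))
         (^-distrib-* (e * (β * β)) e j)) ⟩
  e * β * ((e * (β * β)) ^ j * e ^ j)
    ≈⟨ solve 4 (λ e β A B → e :* β :* (A :* B) := A :* (e :* B :* β)) ≈-refl e β ((e * (β * β)) ^ j) (e ^ j) ⟩
  (e * (β * β)) ^ j * (e ^ suc j * β)        ∎

-- The exponent of κ after h rows, as row j contributes j + 1.
triangular : ℕ → ℕ
triangular zero    = zero
triangular (suc h) = triangular h ℕ.+ suc h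

module Rows (p q ν : ℕ → ℝ) (κ : ℝ) (n : ℕ) (X : ℕ → ℕ → ℝ) (S : ℕ → ℕ → ℕ → ℝ)
  (X≈ : ∀ {v w} → v ℕ.< n → w ℕ.< n →
    X v w ≈ κ * (ν v * ν w) * (Vectors.bracket p q v w * Vectors.bracket p q v w))
  (S≈ : ∀ {u v w} → u ℕ.< n → v ℕ.< n → w ℕ.< n →
    S u v w ≈ κ * (ν u * ν v * ν w) *
      (Vectors.bracket p q u v * Vectors.bracket p q v w * Vectors.bracket p q u w))
  where

  open Vectors p q

  -- The contribution of the entries 2j+1 and 2j+2 of the sequence z to its
  -- Vandermonde product, with the factors κ and ν that accompany it.
  rowFactor : (ℕ → ℕ) → ℕ → ℝ
  rowFactor z j = (κ * (ν r * ν s)) ^ suc j * ∏< (suc (j ℕ.* 2)) (ν ∘ z)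
    * (∏< (suc (j ℕ.* 2)) (λ i → bracket (z i) r) * ∏< (suc (suc (j ℕ.* 2))) (λ i → bracket (z i) s))
    where
    r s : ℕ
    r = z (suc (j ℕ.* 2))
    s = z (suc (suc (j ℕ.* 2)))

  module _ (z : ℕ → ℕ) (j : ℕ) (z<n : ∀ {i} → i ℕ.< suc (suc (suc (j ℕ.* 2))) → z i ℕ.< n) where
    private
      r s : ℕ
      r = z (suc (j ℕ.* 2))
      s = z (suc (suc (j ℕ.* 2)))
      r<n : r ℕ.< n
      r<n = z<n (ℕₚ.m≤n⇒m≤1+n ℕₚ.≤-refl)
      s<n : s ℕ.< n
      s<n = z<n ℕₚ.≤-refl
      e β : ℝ
      e = κ * (ν r * ν s)
      β = bracket r s
      F : ℕ → ℝ
      F i = ν (z i) * (bracket (z i) r * bracket (z i) s)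

      ∏F : ∀ k → ∏< k F
        ≈ ∏< k (ν ∘ z) * (∏< k (λ i → bracket (z i) r) * ∏< k (λ i → bracket (z i) s))
      ∏F k = ≈-trans (∏<-* k _ _) (*-congˡ (∏<-* k _ _))

    row-product : ∏< (suc (j ℕ.* 2)) (λ i → S (z i) r s) ≈ X r s ^ j * rowFactor z j
    row-product = begin
      ∏< k (λ i → S (z i) r s)
        ≈⟨ ∏<-cong k (λ i i<k → ≈-trans
             (S≈ (z<n (ℕₚ.m<n⇒m<1+n (ℕₚ.m<n⇒m<1+n i<k))) r<n s<n)
             (solve 7 (λ κ u r s ur rs us →
               κ :* (u :* r :* s) :* (ur :* rs :* us) := κ :* (r :* s) :* rs :* (u :* (ur :* us)))
               ≈-refl κ (ν (z i)) (ν r) (ν s) (bracket (z i) r) β (bracket (z i) s))) ⟩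
      ∏< k (λ i → e * β * F i)
        ≈⟨ ≈-trans (∏<-* k _ F) (*-cong (∏<-const k (e * β)) (∏F k)) ⟩
      (e * β) ^ suc (j ℕ.* 2) * (A * (B * C))
        ≈⟨ *-congʳ (≈-trans (^-odd-split e β j) (*-congʳ (^-congˡ j (≈-sym (X≈ r<n s<n))))) ⟩
      X r s ^ j * (e ^ suc j * β) * (A * (B * C))
        ≈⟨ solve 6 (λ x e β A B C → x :* (e :* β) :* (A :* (B :* C)) := x :* (e :* A :* (B :* (C :* β))))
             ≈-refl (X r s ^ j) (e ^ suc j) β A B C ⟩
      X r s ^ j * (e ^ suc j * A * (B * (C * β))) ∎
      where
      k : ℕ
      k = suc (j ℕ.* 2)
      A B C : ℝ
      A = ∏< k (ν ∘ z)
      B = ∏< k (λ i → bracket (z i) r)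
      C = ∏< k (λ i → bracket (z i) s)

    -- S_{uvr} S_{uvs} has the same brackets between u, v and r, s as S_{urs} S_{vrs}, but [u v]²
    -- instead of [r s]², hence x_{uv} instead of x_{rs}. The earlier entries are paired as 2t, 2t +
    -- 1; the entry 2j left over supplies the single [r s] of the row.
    mixed-row-product :
      S (z (j ℕ.* 2)) r s
        * ∏< j (λ t → S (z (t ℕ.* 2)) (z (suc (t ℕ.* 2))) r * S (z (t ℕ.* 2)) (z (suc (t ℕ.* 2))) s)
      ≈ ∏< j (λ t → X (z (t ℕ.* 2)) (z (suc (t ℕ.* 2)))) * rowFactor z j
    mixed-row-product = begin
      S (z k) r s
        * ∏< j (λ t → S (z (t ℕ.* 2)) (z (suc (t ℕ.* 2))) r * S (z (t ℕ.* 2)) (z (suc (t ℕ.* 2))) s)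
        ≈⟨ *-cong
             (S≈ (z<n (ℕₚ.m<n⇒m<1+n (ℕₚ.m<n⇒m<1+n ℕₚ.≤-refl))) r<n s<n)
             (∏<-cong j pair) ⟩
      κ * (ν (z k) * ν r * ν s) * (bracket (z k) r * β * bracket (z k) s)
        * ∏< j (λ t → X (z (t ℕ.* 2)) (z (suc (t ℕ.* 2))) * (e * (F (t ℕ.* 2) * F (suc (t ℕ.* 2)))))
        ≈⟨ *-congˡ (≈-trans (∏<-* j _ _) (*-congˡ (≈-trans (∏<-* j _ _)
             (*-cong (∏<-const j e) (≈-trans (≈-sym (∏<-pairs j F)) (∏F k)))))) ⟩
      κ * (ν (z k) * ν r * ν s) * (bracket (z k) r * β * bracket (z k) s) * (Y * (e ^ j * (A * (B * C))))
        ≈⟨ solve 12 (λ κ u r s ur β us Y E A B C →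
             κ :* (u :* r :* s) :* (ur :* β :* us) :* (Y :* (E :* (A :* (B :* C))))
             := Y :* (κ :* (r :* s) :* E :* (A :* u) :* (B :* ur :* (C :* us :* β))))
             ≈-refl κ (ν (z k)) (ν r) (ν s) (bracket (z k) r) β (bracket (z k) s) Y (e ^ j) A B C ⟩
      Y * rowFactor z j ∎
      where
      k : ℕ
      k = j ℕ.* 2
      Y A B C : ℝ
      Y = ∏< j (λ t → X (z (t ℕ.* 2)) (z (suc (t ℕ.* 2))))
      A = ∏< k (ν ∘ z)
      B = ∏< k (λ i → bracket (z i) r)
      C = ∏< k (λ i → bracket (z i) s)
      pair : ∀ t → t ℕ.< j →
        S (z (t ℕ.* 2)) (z (suc (t ℕ.* 2))) r * S (z (t ℕ.* 2)) (z (suc (t ℕ.* 2))) s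
        ≈ X (z (t ℕ.* 2)) (z (suc (t ℕ.* 2))) * (e * (F (t ℕ.* 2) * F (suc (t ℕ.* 2))))
      pair t t<j = begin
        S u v r * S u v s
          ≈⟨ *-cong (S≈ u<n v<n r<n) (S≈ u<n v<n s<n) ⟩
        κ * (ν u * ν v * ν r) * (bracket u v * bracket v r * bracket u r)
          * (κ * (ν u * ν v * ν s) * (bracket u v * bracket v s * bracket u s))
          ≈⟨ solve 10 (λ κ u v r s uv vr ur vs us →
               κ :* (u :* v :* r) :* (uv :* vr :* ur) :* (κ :* (u :* v :* s) :* (uv :* vs :* us))
               := κ :* (u :* v) :* (uv :* uv)
                    :* (κ :* (r :* s) :* (u :* (ur :* us) :* (v :* (vr :* vs)))))
               ≈-refl κ (ν u) (ν v) (ν r) (ν s) (bracket u v) (bracket v r) (bracket u r)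
               (bracket v s) (bracket u s) ⟩
        κ * (ν u * ν v) * (bracket u v * bracket u v) * (e * (F (t ℕ.* 2) * F (suc (t ℕ.* 2))))
          ≈⟨ *-congʳ (X≈ u<n v<n) ⟨
        X u v * (e * (F (t ℕ.* 2) * F (suc (t ℕ.* 2)))) ∎
        where
        u v : ℕ
        u = z (t ℕ.* 2)
        v = z (suc (t ℕ.* 2))
        v′<k : suc (t ℕ.* 2) ℕ.< k
        v′<k = ℕₚ.*-monoˡ-≤ 2 t<j
        v<n : v ℕ.< n
        v<n = z<n (ℕₚ.m<n⇒m<1+n (ℕₚ.m<n⇒m<1+n (ℕₚ.m<n⇒m<1+n v′<k)))
        u<n : u ℕ.< n
        u<n = z<n (ℕₚ.m<n⇒m<1+n (ℕₚ.m<n⇒m<1+n (ℕₚ.m<n⇒m<1+n (ℕₚ.<-trans ℕₚ.≤-refl v′<k))))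

  -- In row j the weights ν of the earlier vertices gain one power, and the two new ones enter with
  -- j + 1 powers at once. After h rows all of them have the same exponent h, while the brackets of
  -- each row extend the Vandermonde product by two vertices.
  ∏-rowFactor : ∀ z h → ∏< h (rowFactor z) ≈
    κ ^ triangular h * ∏< (suc (h ℕ.* 2)) (ν ∘ z) ^ h * vandermonde (applyDownFrom z (suc (h ℕ.* 2)))
  ∏-rowFactor z zero    = solve 0 (con 1ℚ := con 1ℚ :* con 1ℚ :* (con 1ℚ :* con 1ℚ)) ≈-refl
  ∏-rowFactor z (suc h) = begin
    ∏< h (rowFactor z) * rowFactor z h
      ≈⟨ *-cong (∏-rowFactor z h)
           (*-congʳ (*-congʳ (^-distrib-* κ (ν r * ν s) (suc h)))) ⟩
    κ ^ triangular h * A ^ h * V * (κ ^ suc h * (ν r * ν s) ^ suc h * A * (B * C))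
      ≈⟨ solve 8 (λ K Aʰ V κ E A B C →
           K :* Aʰ :* V :* (κ :* E :* A :* (B :* C)) := K :* κ :* (A :* Aʰ :* E) :* (V :* B :* C))
           ≈-refl (κ ^ triangular h) (A ^ h) V (κ ^ suc h) ((ν r * ν s) ^ suc h) A B C ⟩
    κ ^ triangular h * κ ^ suc h * (A ^ suc h * (ν r * ν s) ^ suc h) * (V * B * C)
      ≈⟨ *-cong
           (*-cong (≈-sym (^-homo-* κ (triangular h) (suc h)))
             (≈-trans (≈-sym (^-distrib-* A (ν r * ν s) (suc h)))
               (^-congˡ (suc h) (≈-sym (*-assoc A (ν r) (ν s))))))
           (reflexive (cong₂ (λ b c → V * b * c)
             (≡.sym (weightProduct-applyDownFrom (λ w → bracket w r) z (suc (h ℕ.* 2))))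
             (≡.sym (weightProduct-applyDownFrom (λ w → bracket w s) z (suc (suc (h ℕ.* 2))))))) ⟩
    κ ^ triangular (suc h) * (A * ν r * ν s) ^ suc h
      * vandermonde (applyDownFrom z (suc (suc h ℕ.* 2))) ∎
    where
    r s : ℕ
    r = z (suc (h ℕ.* 2))
    s = z (suc (suc (h ℕ.* 2)))
    A B C V : ℝ
    A = ∏< (suc (h ℕ.* 2)) (ν ∘ z)
    B = ∏< (suc (h ℕ.* 2)) (λ i → bracket (z i) r)
    C = ∏< (suc (suc (h ℕ.* 2))) (λ i → bracket (z i) s)
    V = vandermonde (applyDownFrom z (suc (h ℕ.* 2)))

-- Regrouping the areas by the pair l, l + 1

∏<-swap : ∀ a b (f : ℕ → ℕ → ℝ) → ∏< a (λ i → ∏< b (f i)) ≈ ∏< b (λ j → ∏< a (λ i → f i j))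
∏<-swap zero    b f = ≈-sym (∏<-1 b)
∏<-swap (suc a) b f = ≈-trans (*-congʳ (∏<-swap a b f)) (≈-sym (∏<-* b _ _))

∏<-double-odd : ∀ k f → (∀ j → f (j ℕ.* 2) ≈ 1ℝ) →
  ∏< (k ℕ.* 2) f ≈ ∏< k (λ j → f (suc (j ℕ.* 2)))
∏<-double-odd k f even≈1 = ≈-trans (∏<-pairs k f)
  (∏<-cong! k (λ j → ≈-trans (*-congʳ (even≈1 j)) (*-identityˡ _)))

∏<-triangle-long : ∀ L k (g : ℕ → ℕ → ℝ) →
  ∏< (L ℕ.+ k) (λ i → ∏< (L ∸ i) (λ t → g i (i ℕ.+ t))) ≈ ∏< L (λ l → ∏< (suc l) (λ i → g i l))
∏<-triangle-long L k g = begin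
  ∏< (L ℕ.+ k) row                              ≈⟨ ∏<-+ L k row ⟩
  ∏< L row * ∏< k (λ i → row (L ℕ.+ i))
    ≈⟨ *-cong (∏<-triangle L g) (≈-trans (∏<-cong! k empty) (∏<-1 k)) ⟩
  ∏< L (λ l → ∏< (suc l) (λ i → g i l)) * 1ℝ    ≈⟨ *-identityʳ _ ⟩
  ∏< L (λ l → ∏< (suc l) (λ i → g i l))         ∎
  where
  row : ℕ → ℝ
  row i = ∏< (L ∸ i) (λ t → g i (i ℕ.+ t))
  empty : ∀ i → row (L ℕ.+ i) ≈ 1ℝ
  empty i rewrite ≡.trans (≡.sym (ℕₚ.∸-+-assoc L L i)) (≡.trans (cong (_∸ i) (ℕₚ.n∸n≡0 L)) (ℕₚ.0∸n≡0 i)) = ≈-refl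

double∸-cancel : ∀ a c {k} → k ≡ a ℕ.+ c → k ℕ.* 2 ∸ 1 ∸ a ℕ.* 2 ≡ c ℕ.* 2 ∸ 1
double∸-cancel a c ≡.refl = ≡.trans (ℕₚ.∸-+-assoc ((a ℕ.+ c) ℕ.* 2) 1 (a ℕ.* 2))
  (≡.trans (cong ((a ℕ.+ c) ℕ.* 2 ∸_) (ℕₚ.+-comm 1 (a ℕ.* 2)))
  (≡.trans (≡.sym (ℕₚ.∸-+-assoc ((a ℕ.+ c) ℕ.* 2) (a ℕ.* 2) 1))
    (cong (_∸ 1) (≡.trans (cong (_∸ a ℕ.* 2) (≡.sym (+-*2 a c))) (ℕₚ.m+n∸m≡n (a ℕ.* 2) (c ℕ.* 2))))))

suc∸1∸ : ∀ L i → L ∸ suc i ≡ L ∸ 1 ∸ i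
suc∸1∸ L i = ≡.sym (ℕₚ.∸-+-assoc L 1 i)

odd%2 : ∀ j → suc (j ℕ.* 2) % 2 ≡ 1
odd%2 j = [m+kn]%n≡m%n 1 j 2

even%2 : ∀ j → (j ℕ.* 2) % 2 ≡ 0
even%2 j = m*n%n≡0 j 2

data Parity : ℕ → Set where
  even : ∀ j → Parity (j ℕ.* 2)
  odd  : ∀ j → Parity (suc (j ℕ.* 2))

parity : ∀ n → Parity n
parity zero = even 0
parity (suc n) with parity n
... | even j = odd j
... | odd  j = even (suc j)

^1 : ∀ y → y ^ 1 ≈ y
^1 y = *-identityʳ y

module _ (f : ℕ → ℕ → ℝ) where

  private
    -- Position (i, l) stands for first index i + 1 and pair index l + 2, so that a pair index above
    -- the first index means i ≤ l.
    g : ℕ → ℕ → ℝ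
    g i l = whenᵉ (suc (suc l)) (f (suc i) (suc (suc l)))

    column-even : ∀ j → ∏< (suc (j ℕ.* 2)) (λ i → g i (j ℕ.* 2)) ≈
      ∏< (suc (j ℕ.* 2)) (λ i → f (suc i) (suc j ℕ.* 2))
    column-even j = ∏<-cong! (suc (j ℕ.* 2)) (λ i → whenᵉ-even (suc j) ≡.refl)

    column-odd : ∀ j → ∏< (suc (suc (j ℕ.* 2))) (λ i → g i (suc (j ℕ.* 2))) ≈ 1ℝ
    column-odd j = ≈-trans (∏<-cong! (suc (suc (j ℕ.* 2))) (λ i → whenᵉ-odd (suc j) ≡.refl)) (∏<-1 (suc (suc (j ℕ.* 2))))

  -- After the exchange, each even pair index l meets every first index 1, ..., l - 1.
  ∏ᵉ-rows : ∀ μ →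
    ∏< (suc (μ ℕ.* 2)) (λ i → ∏ᵉ[ suc i ℕ.+ 1 ⋯ μ ℕ.* 2 ] f (suc i)) ≈
    ∏< μ (λ j → ∏< (suc (j ℕ.* 2)) (λ i → f (suc i) (suc j ℕ.* 2)))
  ∏ᵉ-rows μ = begin
    ∏< (suc (μ ℕ.* 2)) (λ i → ∏ᵉ[ suc i ℕ.+ 1 ⋯ μ ℕ.* 2 ] f (suc i))
      ≈⟨ ∏<-cong! (suc (μ ℕ.* 2)) row ⟩
    ∏< (suc (μ ℕ.* 2)) (λ i → ∏< (μ ℕ.* 2 ∸ 1 ∸ i) (λ t → g i (i ℕ.+ t)))
      ≡⟨ cong (λ k → ∏< k (λ i → ∏< (μ ℕ.* 2 ∸ 1 ∸ i) (λ t → g i (i ℕ.+ t)))) (proj₂ (extra μ)) ⟩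
    ∏< (μ ℕ.* 2 ∸ 1 ℕ.+ proj₁ (extra μ)) (λ i → ∏< (μ ℕ.* 2 ∸ 1 ∸ i) (λ t → g i (i ℕ.+ t)))
      ≈⟨ ∏<-triangle-long (μ ℕ.* 2 ∸ 1) (proj₁ (extra μ)) g ⟩
    ∏< (μ ℕ.* 2 ∸ 1) (λ l → ∏< (suc l) (λ i → g i l))
      ≈⟨ ∏<-double∸1 μ (λ l → ∏< (suc l) (λ i → g i l)) column-odd ⟩
    ∏< μ (λ j → ∏< (suc (j ℕ.* 2)) (λ i → g i (j ℕ.* 2)))
      ≈⟨ ∏<-cong! μ column-even ⟩
    ∏< μ (λ j → ∏< (suc (j ℕ.* 2)) (λ i → f (suc i) (suc j ℕ.* 2))) ∎
    where
    row : ∀ i → (∏ᵉ[ suc i ℕ.+ 1 ⋯ μ ℕ.* 2 ] f (suc i)) ≈ ∏< (μ ℕ.* 2 ∸ 1 ∸ i) (λ t → g i (i ℕ.+ t))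
    row i = ≈-trans (∏ᵉ-interval (suc i ℕ.+ 1) (μ ℕ.* 2) (f (suc i)))
      (reflexive (≡.trans
        (cong (λ α → ∏< (suc (μ ℕ.* 2) ∸ α) (λ t → whenᵉ (α ℕ.+ t) (f (suc i) (α ℕ.+ t)))) (ℕₚ.+-comm (suc i) 1))
        (cong (λ L → ∏< L (λ t → g i (i ℕ.+ t))) (suc∸1∸ (μ ℕ.* 2) i))))
    -- The rows beyond the triangle, all empty: the first indices 2μ and 2μ + 1, or only 1 when μ =
    -- 0.
    extra : ∀ μ → ∃ λ k → suc (μ ℕ.* 2) ≡ μ ℕ.* 2 ∸ 1 ℕ.+ k
    extra zero    = 1 , ≡.refl
    extra (suc μ) = 2 , cong suc (ℕₚ.+-comm 2 (μ ℕ.* 2))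

  -- The factor with exponent k mod 2 supplies the entry l = k + 1, which is
  -- even exactly when k is odd.
  ∏ᵉ-rows-from-k+2 : ∀ c →
    ∏< (suc (c ℕ.* 2)) (λ i →
      f (suc i) (suc i ℕ.+ 1) ^ (suc i % 2) * (∏ᵉ[ suc i ℕ.+ 2 ⋯ suc (suc c ℕ.* 2) ] f (suc i))) ≈
    ∏< (suc c) (λ j → ∏< (suc (j ℕ.* 2)) (λ i → f (suc i) (suc j ℕ.* 2)))
  ∏ᵉ-rows-from-k+2 c = begin
    ∏< (suc (c ℕ.* 2)) (λ i →
      f (suc i) (suc i ℕ.+ 1) ^ (suc i % 2) * (∏ᵉ[ suc i ℕ.+ 2 ⋯ suc (suc c ℕ.* 2) ] f (suc i)))
      ≈⟨ ∏<-cong (suc (c ℕ.* 2)) row ⟩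
    ∏< (suc (c ℕ.* 2)) (λ i → ∏< (suc c ℕ.* 2 ∸ i) (λ t → g i (i ℕ.+ t)))
      ≈⟨ ≈-trans (*-congˡ last-row) (*-identityʳ _) ⟨
    ∏< (suc c ℕ.* 2) (λ i → ∏< (suc c ℕ.* 2 ∸ i) (λ t → g i (i ℕ.+ t)))
      ≈⟨ ∏<-triangle (suc c ℕ.* 2) g ⟩
    ∏< (suc c ℕ.* 2) (λ l → ∏< (suc l) (λ i → g i l))
      ≈⟨ ∏<-double (suc c) (λ l → ∏< (suc l) (λ i → g i l)) column-odd ⟩
    ∏< (suc c) (λ j → ∏< (suc (j ℕ.* 2)) (λ i → g i (j ℕ.* 2)))
      ≈⟨ ∏<-cong! (suc c) column-even ⟩
    ∏< (suc c) (λ j → ∏< (suc (j ℕ.* 2)) (λ i → f (suc i) (suc j ℕ.* 2))) ∎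
    where
    first : ∀ i → f (suc i) (suc i ℕ.+ 1) ^ (suc i % 2) ≈ g i (i ℕ.+ 0)
    first i rewrite ℕₚ.+-comm i 1 | ℕₚ.+-identityʳ i with parity i
    ... | even j rewrite odd%2 j = ≈-trans (^1 _) (≈-sym (whenᵉ-even (suc j) ≡.refl))
    ... | odd j rewrite even%2 (suc j) = ≈-sym (whenᵉ-odd (suc j) ≡.refl)
    row : ∀ i → i ℕ.< suc (c ℕ.* 2) →
      f (suc i) (suc i ℕ.+ 1) ^ (suc i % 2) * (∏ᵉ[ suc i ℕ.+ 2 ⋯ suc (suc c ℕ.* 2) ] f (suc i)) ≈
      ∏< (suc c ℕ.* 2 ∸ i) (λ t → g i (i ℕ.+ t))
    row i (s≤s i≤c) = begin
      f (suc i) (suc i ℕ.+ 1) ^ (suc i % 2) * (∏ᵉ[ suc i ℕ.+ 2 ⋯ suc (suc c ℕ.* 2) ] f (suc i))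
        ≈⟨ *-cong (first i) (∏ᵉ-interval (suc i ℕ.+ 2) (suc (suc c ℕ.* 2)) (f (suc i))) ⟩
      g i (i ℕ.+ 0) * ∏< (suc (suc (suc c ℕ.* 2)) ∸ (suc i ℕ.+ 2))
          (λ t → whenᵉ (suc i ℕ.+ 2 ℕ.+ t) (f (suc i) (suc i ℕ.+ 2 ℕ.+ t)))
        ≡⟨ cong (λ α → g i (i ℕ.+ 0) * ∏< (suc (suc (suc c ℕ.* 2)) ∸ α)
             (λ t → whenᵉ (α ℕ.+ t) (f (suc i) (α ℕ.+ t)))) (ℕₚ.+-comm (suc i) 2) ⟩
      g i (i ℕ.+ 0) * ∏< (suc (c ℕ.* 2) ∸ i) (λ t → g i (suc (i ℕ.+ t)))
        ≈⟨ *-congˡ (∏<-cong! (suc (c ℕ.* 2) ∸ i) (λ t → reflexive (cong (g i) (≡.sym (ℕₚ.+-suc i t))))) ⟩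
      g i (i ℕ.+ 0) * ∏< (suc (c ℕ.* 2) ∸ i) (λ t → g i (i ℕ.+ suc t))
        ≈⟨ ∏<-cons (suc (c ℕ.* 2) ∸ i) (λ t → g i (i ℕ.+ t)) ⟨
      ∏< (suc (suc (c ℕ.* 2) ∸ i)) (λ t → g i (i ℕ.+ t))
        ≡⟨ cong (λ L → ∏< L (λ t → g i (i ℕ.+ t))) (≡.sym (ℕₚ.+-∸-assoc 1 (ℕₚ.m≤n⇒m≤1+n i≤c))) ⟩
      ∏< (suc c ℕ.* 2 ∸ i) (λ t → g i (i ℕ.+ t)) ∎
    -- The row added to complete the triangle has one position, with the odd pair index 2c + 3, so
    -- it contributes 1.
    last-row : ∏< (suc c ℕ.* 2 ∸ suc (c ℕ.* 2)) (λ t → g (suc (c ℕ.* 2)) (suc (c ℕ.* 2) ℕ.+ t)) ≈ 1ℝ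
    last-row rewrite ℕₚ.m+n∸n≡m 1 (c ℕ.* 2) | ℕₚ.+-identityʳ (c ℕ.* 2) =
      ≈-trans (*-identityˡ _) (whenᵉ-odd (suc c) ≡.refl)

  module _ (h m : ℕ) where
    private
      k : ℕ → ℕ → ℝ
      k i l = whenᵒ (suc (suc (m ℕ.+ l))) (f (suc (m ℕ.+ i)) (suc (suc (m ℕ.+ l))))

    -- Here n = 2h + 4. Position (i, l) stands for first index m + 1 + i and pair index m + 2 + l,
    -- which again makes the range triangular.
    ∏ᵒ-triangle : (∏[ m ⋯ suc h ℕ.* 2 ∸ 1 ] λ i → ∏ᵒ[ i ℕ.+ 2 ⋯ suc (suc h ℕ.* 2) ] f (i ℕ.+ 1)) ≈
      ∏< (suc h ℕ.* 2 ∸ m) (λ l → ∏< (suc l) (λ i → k i l))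
    ∏ᵒ-triangle = ≈-trans
      (productOver-interval m (suc h ℕ.* 2 ∸ 1) (λ i → ∏ᵒ[ i ℕ.+ 2 ⋯ suc (suc h ℕ.* 2) ] f (i ℕ.+ 1)))
      (≈-trans (∏<-cong! (suc h ℕ.* 2 ∸ m) row) (∏<-triangle (suc h ℕ.* 2 ∸ m) k))
      where
      row : ∀ i → (∏ᵒ[ m ℕ.+ i ℕ.+ 2 ⋯ suc (suc h ℕ.* 2) ] f (m ℕ.+ i ℕ.+ 1)) ≈
        ∏< (suc h ℕ.* 2 ∸ m ∸ i) (λ t → k i (i ℕ.+ t))
      row i = begin
        (∏ᵒ[ m ℕ.+ i ℕ.+ 2 ⋯ suc (suc h ℕ.* 2) ] f (m ℕ.+ i ℕ.+ 1))
          ≡⟨ cong₂ (λ α β → ∏ᵒ[ α ⋯ suc (suc h ℕ.* 2) ] f β) (ℕₚ.+-comm (m ℕ.+ i) 2) (ℕₚ.+-comm (m ℕ.+ i) 1) ⟩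
        (∏ᵒ[ suc (suc (m ℕ.+ i)) ⋯ suc (suc h ℕ.* 2) ] f (suc (m ℕ.+ i)))
          ≈⟨ ∏ᵒ-interval (suc (suc (m ℕ.+ i))) (suc (suc h ℕ.* 2)) (f (suc (m ℕ.+ i))) ⟩
        ∏< (suc h ℕ.* 2 ∸ (m ℕ.+ i))
          (λ t → whenᵒ (suc (suc (m ℕ.+ i ℕ.+ t))) (f (suc (m ℕ.+ i)) (suc (suc (m ℕ.+ i ℕ.+ t)))))
          ≈⟨ ∏<-cong! (suc h ℕ.* 2 ∸ (m ℕ.+ i)) (λ t → reflexive (cong
               (λ s → whenᵒ (suc (suc s)) (f (suc (m ℕ.+ i)) (suc (suc s)))) (ℕₚ.+-assoc m i t))) ⟩
        ∏< (suc h ℕ.* 2 ∸ (m ℕ.+ i)) (λ t → k i (i ℕ.+ t))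
          ≡⟨ cong (λ L → ∏< L (λ t → k i (i ℕ.+ t))) (≡.sym (ℕₚ.∸-+-assoc (suc h ℕ.* 2) m i)) ⟩
        ∏< (suc h ℕ.* 2 ∸ m ∸ i) (λ t → k i (i ℕ.+ t)) ∎

  -- With m = 2μ + 1, the pair starting at l = 2(μ + j) + 3 meets all 2j + 1 vertices strictly
  -- between m and l.
  ∏ᵒ-triangle-odd : ∀ h μ δ → suc h ≡ μ ℕ.+ δ →
    (∏[ suc (μ ℕ.* 2) ⋯ suc h ℕ.* 2 ∸ 1 ] λ i → ∏ᵒ[ i ℕ.+ 2 ⋯ suc (suc h ℕ.* 2) ] f (i ℕ.+ 1)) ≈
    ∏< δ (λ j → ∏< (suc (j ℕ.* 2)) (λ i → f (suc (suc (μ ℕ.* 2 ℕ.+ i))) (suc (suc (μ ℕ.+ j) ℕ.* 2))))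
  ∏ᵒ-triangle-odd h μ δ eq = begin
    _ ≈⟨ ∏ᵒ-triangle h (suc (μ ℕ.* 2)) ⟩
    ∏< (suc h ℕ.* 2 ∸ suc (μ ℕ.* 2)) F
      ≡⟨ cong (λ L → ∏< L F) (double∸-cancel μ δ eq) ⟩
    ∏< (δ ℕ.* 2 ∸ 1) F
      ≈⟨ ∏<-double∸1 δ F (λ j → ≈-trans
           (∏<-cong! (suc (suc (j ℕ.* 2))) (λ i → whenᵒ-even (suc (suc (μ ℕ.+ j)))
             (cong (λ s → suc (suc (suc s))) (+-*2+1 μ j))))
           (∏<-1 (suc (suc (j ℕ.* 2))))) ⟩
    ∏< δ (λ j → F (j ℕ.* 2))
      ≈⟨ ∏<-cong! δ (λ j → ∏<-cong! (suc (j ℕ.* 2)) (λ i → ≈-trans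
           (whenᵒ-odd (suc (μ ℕ.+ j)) (cong (λ s → suc (suc (suc s))) (+-*2 μ j)))
           (reflexive (cong (λ s → f (suc (suc (μ ℕ.* 2 ℕ.+ i))) (suc (suc (suc s)))) (+-*2 μ j))))) ⟩
    ∏< δ (λ j → ∏< (suc (j ℕ.* 2)) (λ i → f (suc (suc (μ ℕ.* 2 ℕ.+ i))) (suc (suc (μ ℕ.+ j) ℕ.* 2)))) ∎
    where
    F : ℕ → ℝ
    F l = ∏< (suc l) (λ i → whenᵒ (suc (suc (suc (μ ℕ.* 2) ℕ.+ l)))
      (f (suc (suc (μ ℕ.* 2) ℕ.+ i)) (suc (suc (suc (μ ℕ.* 2) ℕ.+ l)))))

  -- With m = 2μ + 2, only 2j vertices lie strictly between m and l = 2(μ + j) + 3.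
  ∏ᵒ-triangle-even : ∀ h μ δ → suc h ≡ μ ℕ.+ δ →
    (∏[ suc μ ℕ.* 2 ⋯ suc h ℕ.* 2 ∸ 1 ] λ i → ∏ᵒ[ i ℕ.+ 2 ⋯ suc (suc h ℕ.* 2) ] f (i ℕ.+ 1)) ≈
    ∏< δ (λ j → ∏< (j ℕ.* 2) (λ i → f (suc (suc μ ℕ.* 2 ℕ.+ i)) (suc (suc (μ ℕ.+ j) ℕ.* 2))))
  ∏ᵒ-triangle-even h μ δ eq = begin
    _ ≈⟨ ∏ᵒ-triangle h (suc μ ℕ.* 2) ⟩
    ∏< (suc h ℕ.* 2 ∸ suc μ ℕ.* 2) F
      ≡⟨ cong (λ L → ∏< L F) (triangle-size δ eq) ⟩
    ∏< ((δ ∸ 1) ℕ.* 2) F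
      ≈⟨ ∏<-double-odd (δ ∸ 1) F (λ j → ≈-trans
           (∏<-cong! (suc (j ℕ.* 2)) (λ i → whenᵒ-even (suc (suc (μ ℕ.+ j)))
             (cong (λ s → suc (suc (suc (suc s)))) (+-*2 μ j))))
           (∏<-1 (suc (j ℕ.* 2)))) ⟩
    ∏< (δ ∸ 1) (λ j → F (suc (j ℕ.* 2)))
      ≈⟨ ∏<-cong! (δ ∸ 1) (λ j → ∏<-cong! (suc j ℕ.* 2) (λ i → ≈-trans
           (whenᵒ-odd (suc (μ ℕ.+ suc j)) (index j))
           (reflexive (cong (f (suc (suc μ ℕ.* 2 ℕ.+ i))) (index j))))) ⟩
    ∏< (δ ∸ 1) (λ j → G (suc j))
      ≈⟨ prepend δ ⟩
    ∏< δ G ∎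
    where
    F G : ℕ → ℝ
    F l = ∏< (suc l) (λ i → whenᵒ (suc (suc (suc μ ℕ.* 2 ℕ.+ l)))
      (f (suc (suc μ ℕ.* 2 ℕ.+ i)) (suc (suc (suc μ ℕ.* 2 ℕ.+ l)))))
    G j = ∏< (j ℕ.* 2) (λ i → f (suc (suc μ ℕ.* 2 ℕ.+ i)) (suc (suc (μ ℕ.+ j) ℕ.* 2)))
    index : ∀ j → suc (suc (suc μ ℕ.* 2 ℕ.+ suc (j ℕ.* 2))) ≡ suc (suc (μ ℕ.+ suc j) ℕ.* 2)
    index j = cong (λ s → suc (suc s)) (≡.trans (+-*2+1 (suc μ) j) (cong (λ s → suc (s ℕ.* 2)) (≡.sym (ℕₚ.+-suc μ j))))
    triangle-size : ∀ δ → suc h ≡ μ ℕ.+ δ → suc h ℕ.* 2 ∸ suc μ ℕ.* 2 ≡ (δ ∸ 1) ℕ.* 2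
    triangle-size δ eq = ≡.trans (≡.sym (ℕₚ.*-distribʳ-∸ 2 (suc h) (suc μ))) (cong (ℕ._* 2)
      (≡.trans (cong (_∸ suc μ) eq) (≡.trans (suc∸1∸′ (μ ℕ.+ δ) μ) (cong (_∸ 1) (ℕₚ.m+n∸m≡n μ δ)))))
      where
      suc∸1∸′ : ∀ a b → a ∸ suc b ≡ a ∸ b ∸ 1
      suc∸1∸′ a b = ≡.trans (cong (a ∸_) (ℕₚ.+-comm 1 b)) (≡.sym (ℕₚ.∸-+-assoc a b 1))
    -- The pair right after m, j = 0, meets no vertex in between; its empty column is added so that
    -- the index agrees with that of the rows.
    prepend : ∀ δ → ∏< (δ ∸ 1) (λ j → G (suc j)) ≈ ∏< δ G
    prepend zero    = ≈-refl
    prepend (suc δ) = ≈-sym (≈-trans (∏<-cons δ G) (*-identityˡ _))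

-- Vertices are counted from zero: side v is the paper's x_{v+1,v+2}. The polygon
-- has n = 2h + 2 vertices.
module SideProducts (h₀ : ℕ) (x : ℕ → ℕ → ℝ) where

  h n : ℕ
  h = suc h₀
  n = suc h ℕ.* 2

  side : ℕ → ℝ
  side v = x (suc v) (suc (suc v))

  -- With labels from one, these are x_{2j+2,2j+3}^j and x_{2j+3,2j+4}^j, the powers for row j when
  -- the deleted vertex lies after its pair or before it.
  evenSides oddSides : ℕ → ℝ
  evenSides j = side (suc (j ℕ.* 2)) ^ j
  oddSides  j = side (suc j ℕ.* 2) ^ j

  side-power : ∀ v j → x (suc v) (suc v ℕ.+ 1) ^ (j ℕ.* 2 / 2) ≡ side v ^ j
  side-power v j = cong₂ (λ w e → x (suc v) w ^ e) (ℕₚ.+-comm (suc v) 1) (m*n/n≡m j 2)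

  ∏-split : ∀ {μ δ} f → h ≡ μ ℕ.+ δ → ∏< h f ≈ ∏< μ f * ∏< δ (λ j → f (μ ℕ.+ j))
  ∏-split {μ} {δ} f eq = ≈-trans (reflexive (cong (λ L → ∏< L f) eq)) (∏<-+ μ δ f)

  μ+j<h : ∀ {μ δ j} → h ≡ μ ℕ.+ δ → j ℕ.< δ → μ ℕ.+ j ℕ.< h
  μ+j<h {μ} {δ} {j} eq j<δ = subst (μ ℕ.+ j ℕ.<_) (≡.sym eq) (ℕₚ.+-monoʳ-< μ j<δ)

  μ≤h : ∀ {μ δ} → h ≡ μ ℕ.+ δ → μ ℕ.≤ h
  μ≤h {μ} {δ} eq = subst (μ ℕ.≤_) (≡.sym eq) (ℕₚ.m≤m+n μ δ)

  x-evens : ∀ a c → suc h ≡ suc a ℕ.+ c →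
    (∏ᵉ[ suc a ℕ.* 2 ⋯ h ℕ.* 2 ] λ l → x l (l ℕ.+ 1) ^ ((l ∸ 2) / 2)) ≈ ∏< c (λ j → evenSides (a ℕ.+ j))
  x-evens a c eq = ≈-trans
    (∏ᵉ-evens (suc a) c (h ℕ.* 2) (λ l → x l (l ℕ.+ 1) ^ ((l ∸ 2) / 2)) (double∸-cancel (suc a) c eq))
    (∏<-cong! c (λ j → reflexive (side-power (suc ((a ℕ.+ j) ℕ.* 2)) (a ℕ.+ j))))

  -- For m = 1 the lower bound m - 1 is 0, and the extra entry l = 0 has truncated exponent 0.
  x-evens-from-0 :
    (∏ᵉ[ 0 ⋯ h ℕ.* 2 ] λ l → x l (l ℕ.+ 1) ^ ((l ∸ 2) / 2)) ≈ ∏< h evenSides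
  x-evens-from-0 = ≈-trans
    (∏ᵉ-evens 0 (suc h) (h ℕ.* 2) f ≡.refl)
    (≈-trans (∏<-cons h (λ j → f (j ℕ.* 2)))
    (≈-trans (*-identityˡ _)
      (∏<-cong! h (λ j → reflexive (side-power (suc (j ℕ.* 2)) j)))))
    where
    f : ℕ → ℝ
    f l = x l (l ℕ.+ 1) ^ ((l ∸ 2) / 2)

  *2∸3 : ∀ μ → μ ℕ.* 2 ∸ 3 ≡ (μ ∸ 1) ℕ.* 2 ∸ 1
  *2∸3 zero    = ≡.refl
  *2∸3 (suc μ) = ≡.refl

  -- The product begins at l = 5 because x_{34} would have exponent 0.
  x-odds : ∀ μ →
    (∏ᵒ[ 5 ⋯ suc (μ ℕ.* 2) ] λ l → x l (l ℕ.+ 1) ^ ((l ∸ 3) / 2)) ≈ ∏< μ oddSides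
  x-odds μ = ≈-trans
    (∏ᵒ-odds 2 (μ ∸ 1) (suc (μ ℕ.* 2)) (λ l → x l (l ℕ.+ 1) ^ ((l ∸ 3) / 2)) ≡.refl (*2∸3 μ))
    (≈-trans (∏<-cong! (μ ∸ 1) (λ j → reflexive (side-power (suc (suc j) ℕ.* 2) (suc j)))) (prepend μ))
    where
    prepend : ∀ μ → ∏< (μ ∸ 1) (λ j → oddSides (suc j)) ≈ ∏< μ oddSides
    prepend zero    = ≈-refl
    prepend (suc μ) = ≈-sym (≈-trans (∏<-cons μ oddSides) (*-identityˡ _))

  x-odds-shifted : ∀ c →
    (∏ᵒ[ 5 ⋯ suc (c ℕ.* 2) ] λ l → x l (l ℕ.+ 1) ^ ((l ∸ 5) / 2)) ≈
    ∏< (c ∸ 1) (λ j → side (suc (suc j) ℕ.* 2) ^ j)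
  x-odds-shifted c = ≈-trans
    (∏ᵒ-odds 2 (c ∸ 1) (suc (c ℕ.* 2)) (λ l → x l (l ℕ.+ 1) ^ ((l ∸ 5) / 2)) ≡.refl (*2∸3 c))
    (∏<-cong! (c ∸ 1) (λ j → reflexive (side-power (suc (suc j) ℕ.* 2) j)))

  -- Going from exponents (l - 5) / 2 to (l - 3) / 2 takes one factor x_{l,l+1} for each odd l ≥ 5.
  -- With x_{12} and x_{34} these form the plain product of odd sides left by the straddling row.
  -- For c = 0 that product stops at x_{12}, and x_{34} stays behind: the reason for b = 1 at m = 5.
  ∏-oddSides : ∀ c → ∏< c oddSides * (side 0 * side 2) ≈
    side 2 ^ (if does (c ℕₚ.≟ 0) then 1 else 0) * ∏< (suc c) (λ t → side (t ℕ.* 2))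
      * ∏< (c ∸ 1) (λ j → side (suc (suc j) ℕ.* 2) ^ j)
  ∏-oddSides zero    = solve 2 (λ a b → con 1ℚ :* (a :* b) := b :* con 1ℚ :* (con 1ℚ :* a) :* con 1ℚ)
    ≈-refl (side 0) (side 2)
  ∏-oddSides (suc c) = begin
    ∏< (suc c) oddSides * (side 0 * side 2)
      ≈⟨ *-congʳ (≈-trans (∏<-cons c oddSides) (*-identityˡ _)) ⟩
    ∏< c (λ j → Y j * Y j ^ j) * (side 0 * side 2)
      ≈⟨ *-congʳ (∏<-* c Y (λ j → Y j ^ j)) ⟩
    ∏< c Y * Z * (side 0 * side 2)
      ≈⟨ solve 4 (λ Y Z a b → Y :* Z :* (a :* b) := con 1ℚ :* (a :* (b :* Y)) :* Z) ≈-refl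
           (∏< c Y) Z (side 0) (side 2) ⟩
    1ℝ * (side 0 * (side 2 * ∏< c Y)) * Z
      ≈⟨ *-congʳ (*-congˡ (≈-trans (∏<-cons (suc c) (λ t → side (t ℕ.* 2)))
           (*-congˡ (∏<-cons c (λ t → side (suc t ℕ.* 2)))))) ⟨
    1ℝ * ∏< (suc (suc c)) (λ t → side (t ℕ.* 2)) * Z ∎
    where
    Y : ℕ → ℝ
    Y j = side (suc (suc j) ℕ.* 2)
    Z : ℝ
    Z = ∏< c (λ j → Y j ^ j)

-- The rows of S(m): before, after and across the deleted vertex

module SkipRows (h₀ : ℕ) (p q ν : ℕ → ℝ) (κ : ℝ) (x : ℕ → ℕ → ℝ) (S : ℕ → ℕ → ℕ → ℝ)
  (x≈ : ∀ {v w} → v ℕ.< suc (suc h₀) ℕ.* 2 → w ℕ.< suc (suc h₀) ℕ.* 2 →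
    x (suc v) (suc w)
      ≈ κ * (ν v * ν w) * (Vectors.bracket p q v w * Vectors.bracket p q v w))
  (S≈ : ∀ {u v w} → u ℕ.< suc (suc h₀) ℕ.* 2 → v ℕ.< suc (suc h₀) ℕ.* 2 → w ℕ.< suc (suc h₀) ℕ.* 2 →
    S (suc u) (suc v) (suc w) ≈ κ * (ν u * ν v * ν w) *
      (Vectors.bracket p q u v * Vectors.bracket p q v w * Vectors.bracket p q u w))
  where

  open SideProducts h₀ x public
  open Rows p q ν κ n (λ v w → x (suc v) (suc w)) (λ u v w → S (suc u) (suc v) (suc w)) x≈ S≈

  area : ℕ → ℕ → ℝ
  area k l = S k l (l ℕ.+ 1)

  area-suc : ∀ u v → area (suc u) (suc v) ≡ S (suc u) (suc v) (suc (suc v))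
  area-suc u v = cong (S (suc u) (suc v)) (ℕₚ.+-comm (suc v) 1)

  skip-bound : ∀ m {j} → j ℕ.< h → ∀ {i} → i ℕ.< suc (suc (suc (j ℕ.* 2))) → skip m i ℕ.< n
  skip-bound m j<h {i} (s≤s i≤) = s≤s (ℕₚ.≤-trans (skip-≤suc m i)
    (ℕₚ.≤-trans (s≤s i≤) (s≤s (ℕₚ.*-monoˡ-≤ 2 j<h))))

  -- All vertices of the row lie below m, where `skip m` is the identity.
  rowBefore : ∀ m j → j ℕ.< h → suc (suc (suc (j ℕ.* 2))) ℕ.≤ m →
    ∏< (suc (j ℕ.* 2)) (λ i → area (suc i) (suc j ℕ.* 2)) ≈ evenSides j * rowFactor (skip m) j
  rowBefore m j j<h 3+2j≤m = begin
    ∏< k (λ i → area (suc i) (suc j ℕ.* 2))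
      ≈⟨ ∏<-cong k (λ i i<k → reflexive (≡.trans (area-suc i k) (≡.sym (≡.trans
           (cong₂ (λ r s → S (suc (skip m i)) (suc r) (suc s)) skip-r skip-s)
           (cong (λ v → S (suc v) (suc k) (suc (suc k)))
             (skip-< (ℕₚ.<-≤-trans i<k (ℕₚ.≤-trans (ℕₚ.n≤1+n k) 2+k≤m′)))))))) ⟩
    ∏< k (λ i → S (suc (skip m i)) (suc (skip m k)) (suc (skip m (suc k))))
      ≈⟨ row-product (skip m) j (skip-bound m j<h) ⟩
    x (suc (skip m k)) (suc (skip m (suc k))) ^ j * rowFactor (skip m) j
      ≡⟨ cong₂ (λ r s → x (suc r) (suc s) ^ j * rowFactor (skip m) j) skip-r skip-s ⟩
    evenSides j * rowFactor (skip m) j ∎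
    where
    k : ℕ
    k = suc (j ℕ.* 2)
    2+k≤m′ : suc k ℕ.≤ m
    2+k≤m′ = ℕₚ.<⇒≤ 3+2j≤m
    skip-r : skip m k ≡ k
    skip-r = skip-< 2+k≤m′
    skip-s : skip m (suc k) ≡ suc k
    skip-s = skip-< 3+2j≤m

  -- The pair lies above m and moves up by one, to an odd side; the earlier vertices split into m
  -- below the gap and c above it.
  rowAfter : ∀ m c j → j ℕ.< h → suc (j ℕ.* 2) ≡ m ℕ.+ c →
    ∏< m (λ i → area (suc i) (suc (suc j ℕ.* 2)))
      * ∏< c (λ i → area (suc (suc (m ℕ.+ i))) (suc (suc j ℕ.* 2)))
    ≈ oddSides j * rowFactor (skip m) j
  rowAfter m c j j<h eq = begin
    ∏< m (λ i → area (suc i) (suc (suc k))) * ∏< c (λ i → area (suc (suc (m ℕ.+ i))) (suc (suc k)))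
      ≈⟨ *-cong
           (∏<-cong m (λ i i<m → reflexive (≡.trans (area-suc i (suc k)) (≡.sym (cong₃ (skip-< i<m))))))
           (∏<-cong! c (λ i → reflexive (≡.trans (area-suc (suc (m ℕ.+ i)) (suc k))
             (≡.sym (cong₃ (skip-≥ (ℕₚ.m≤m+n m i))))))) ⟩
    ∏< m F * ∏< c (λ i → F (m ℕ.+ i))
      ≈⟨ ∏<-+ m c F ⟨
    ∏< (m ℕ.+ c) F
      ≡⟨ cong (λ L → ∏< L F) (≡.sym eq) ⟩
    ∏< k F
      ≈⟨ row-product (skip m) j (skip-bound m j<h) ⟩
    x (suc (skip m k)) (suc (skip m (suc k))) ^ j * rowFactor (skip m) j
      ≡⟨ cong₂ (λ r s → x (suc r) (suc s) ^ j * rowFactor (skip m) j) skip-r skip-s ⟩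
    oddSides j * rowFactor (skip m) j ∎
    where
    k : ℕ
    k = suc (j ℕ.* 2)
    F : ℕ → ℝ
    F i = S (suc (skip m i)) (suc (skip m k)) (suc (skip m (suc k)))
    m≤k : m ℕ.≤ k
    m≤k = subst (m ℕ.≤_) (≡.sym eq) (ℕₚ.m≤m+n m c)
    skip-r : skip m k ≡ suc k
    skip-r = skip-≥ m≤k
    skip-s : skip m (suc k) ≡ suc (suc k)
    skip-s = skip-≥ (ℕₚ.m≤n⇒m≤1+n m≤k)
    cong₃ : ∀ {u v} → u ≡ v →
      S (suc u) (suc (skip m k)) (suc (skip m (suc k))) ≡ S (suc v) (suc (suc k)) (suc (suc (suc k)))
    cong₃ u≡v = ≡.trans (cong₂ (λ r s → S _ (suc r) (suc s)) skip-r skip-s)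
      (cong (λ v → S (suc v) (suc (suc k)) (suc (suc (suc k)))) u≡v)

  -- For the pair r, s on either side of a removed vertex, the formula has
  -- S_{k,k+1,r} S_{k,k+1,s} (k odd) where the other rows have
  -- S_{k,r,s} S_{k+1,r,s}: this trades the factor x_{r,s} for x_{k,k+1}.
  rowAcross : ∀ j → j ℕ.< h → let m = suc j ℕ.* 2 ; k = suc (j ℕ.* 2) in
    S k (suc k) (suc (suc (suc k)))
      * ∏< j (λ t → S (suc (t ℕ.* 2)) (suc t ℕ.* 2) (suc k)
          * S (suc (t ℕ.* 2)) (suc t ℕ.* 2) (suc (suc (suc k))))
    ≈ ∏< j (λ t → side (t ℕ.* 2)) * rowFactor (skip m) j
  rowAcross j j<h = begin
    S k (suc k) (suc (suc (suc k)))
      * ∏< j (λ t → S (suc (t ℕ.* 2)) (suc t ℕ.* 2) (suc k)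
          * S (suc (t ℕ.* 2)) (suc t ℕ.* 2) (suc (suc (suc k))))
      ≈⟨ *-cong (reflexive (≡.sym (≡.trans
             (cong₂ (λ u s → S (suc u) (suc (skip m k)) (suc s)) (skip-< {m} {j ℕ.* 2} (ℕₚ.m<n⇒m<1+n ℕₚ.≤-refl)) skip-s)
             (cong (λ r → S k (suc r) (suc (suc (suc k)))) skip-r))))
           (∏<-cong j (λ t t<j → reflexive (≡.sym (cong₂ _*_ (pair t t<j skip-r) (pair t t<j skip-s))))) ⟩
    S (suc (skip m (j ℕ.* 2))) (suc (skip m k)) (suc (skip m (suc k)))
      * ∏< j (λ t → S (suc (skip m (t ℕ.* 2))) (suc (skip m (suc (t ℕ.* 2)))) (suc (skip m k))
          * S (suc (skip m (t ℕ.* 2))) (suc (skip m (suc (t ℕ.* 2)))) (suc (skip m (suc k))))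
      ≈⟨ mixed-row-product (skip m) j (skip-bound m j<h) ⟩
    ∏< j (λ t → x (suc (skip m (t ℕ.* 2))) (suc (skip m (suc (t ℕ.* 2))))) * rowFactor (skip m) j
      ≈⟨ *-congʳ (∏<-cong j (λ t t<j → reflexive
           (cong₂ (λ u v → x (suc u) (suc v)) (skip-< (2t<m t t<j)) (skip-< (2t+1<m t t<j))))) ⟩
    ∏< j (λ t → side (t ℕ.* 2)) * rowFactor (skip m) j ∎
    where
    m k : ℕ
    m = suc j ℕ.* 2
    k = suc (j ℕ.* 2)
    skip-r : skip m k ≡ k
    skip-r = skip-< ℕₚ.≤-refl
    skip-s : skip m (suc k) ≡ suc (suc k)
    skip-s = skip-≥ ℕₚ.≤-refl
    2t+1<m : ∀ t → t ℕ.< j → suc (t ℕ.* 2) ℕ.< m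
    2t+1<m t t<j = ℕₚ.m<n⇒m<1+n (ℕₚ.m<n⇒m<1+n (ℕₚ.*-monoˡ-≤ 2 t<j))
    2t<m : ∀ t → t ℕ.< j → t ℕ.* 2 ℕ.< m
    2t<m t t<j = ℕₚ.<-trans ℕₚ.≤-refl (2t+1<m t t<j)
    pair : ∀ t → t ℕ.< j → ∀ {r r′} → r ≡ r′ →
      S (suc (skip m (t ℕ.* 2))) (suc (skip m (suc (t ℕ.* 2)))) (suc r)
      ≡ S (suc (t ℕ.* 2)) (suc t ℕ.* 2) (suc r′)
    pair t t<j {r} ≡.refl = cong₂ (λ u v → S (suc u) (suc v) (suc r)) (skip-< (2t<m t t<j)) (skip-< (2t+1<m t t<j))

  areaOdds : ∀ k μ δ {α} → h ≡ μ ℕ.+ δ → α ≡ suc (suc μ ℕ.* 2) →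
    (∏ᵒ[ α ⋯ suc (h ℕ.* 2) ] area k) ≈ ∏< δ (λ j → area k (suc (suc (μ ℕ.+ j) ℕ.* 2)))
  areaOdds k μ δ eq ≡.refl = ∏ᵒ-odds (suc μ) δ (suc (h ℕ.* 2)) (area k) ≡.refl
    (double∸-cancel (suc μ) δ (cong suc eq))

  -- Below an even label lie 2μ + 1 vertices, the first one and μ whole pairs. No pair straddles the
  -- gap: rows j < μ lie before it and all others after it.
  S-even : ∀ μ δ → h ≡ μ ℕ.+ δ →
    (∏[ 1 ⋯ suc (μ ℕ.* 2) ] λ k →
        (∏ᵉ[ k ℕ.+ 1 ⋯ μ ℕ.* 2 ] area k) * (∏ᵒ[ suc μ ℕ.* 2 ℕ.+ 1 ⋯ suc (h ℕ.* 2) ] area k))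
      * (∏[ suc μ ℕ.* 2 ⋯ h ℕ.* 2 ∸ 1 ] λ k → ∏ᵒ[ k ℕ.+ 2 ⋯ suc (h ℕ.* 2) ] area (k ℕ.+ 1))
    ≈ ∏< μ evenSides * ∏< δ (λ j → oddSides (μ ℕ.+ j)) * ∏< h (rowFactor (skip (suc (μ ℕ.* 2))))
  S-even μ δ eq = begin
    (∏[ 1 ⋯ m ] λ k → A k * B k) * T
      ≈⟨ *-cong (≈-trans (productOver-interval 1 m (λ k → A k * B k)) (∏<-* m _ _))
           (∏ᵒ-triangle-even area h₀ μ δ eq) ⟩
    ∏< m (λ i → A (suc i)) * ∏< m (λ i → B (suc i)) * T′
      ≈⟨ *-congʳ (*-cong
           (≈-trans (∏ᵉ-rows area μ)
             (≈-trans (∏<-cong μ (λ j j<μ → rowBefore m j (ℕₚ.<-≤-trans j<μ (μ≤h eq)) (s≤s (ℕₚ.*-monoˡ-≤ 2 j<μ))))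
               (∏<-* μ evenSides R)))
           (≈-trans (∏<-cong! m (λ i → areaOdds (suc i) μ δ eq (ℕₚ.+-comm (suc μ ℕ.* 2) 1)))
             (∏<-swap m δ _))) ⟩
    ∏< μ evenSides * ∏< μ R * ∏< δ (λ j → ∏< m (λ i → area (suc i) (suc (suc (μ ℕ.+ j) ℕ.* 2)))) * T′
      ≈⟨ *-assoc _ _ _ ⟩
    ∏< μ evenSides * ∏< μ R * (∏< δ (λ j → ∏< m (λ i → area (suc i) (suc (suc (μ ℕ.+ j) ℕ.* 2)))) * T′)
      ≈⟨ *-congˡ (≈-trans (≈-sym (∏<-* δ _ _)) (≈-trans
           (∏<-cong δ (λ j j<δ → rowAfter m (j ℕ.* 2) (μ ℕ.+ j) (μ+j<h eq j<δ) (cong suc (≡.sym (+-*2 μ j)))))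
           (∏<-* δ _ _))) ⟩
    ∏< μ evenSides * ∏< μ R * (∏< δ (λ j → oddSides (μ ℕ.+ j)) * ∏< δ (λ j → R (μ ℕ.+ j)))
      ≈⟨ solve 4 (λ a b c d → a :* b :* (c :* d) := a :* c :* (b :* d)) ≈-refl
           (∏< μ evenSides) (∏< μ R) (∏< δ (λ j → oddSides (μ ℕ.+ j))) (∏< δ (λ j → R (μ ℕ.+ j))) ⟩
    ∏< μ evenSides * ∏< δ (λ j → oddSides (μ ℕ.+ j)) * (∏< μ R * ∏< δ (λ j → R (μ ℕ.+ j)))
      ≈⟨ *-congˡ (∏-split {μ} {δ} R eq) ⟨
    ∏< μ evenSides * ∏< δ (λ j → oddSides (μ ℕ.+ j)) * ∏< h R ∎
    where
    m : ℕ
    m = suc (μ ℕ.* 2)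
    R : ℕ → ℝ
    R = rowFactor (skip m)
    A B : ℕ → ℝ
    A k = ∏ᵉ[ k ℕ.+ 1 ⋯ μ ℕ.* 2 ] area k
    B k = ∏ᵒ[ suc μ ℕ.* 2 ℕ.+ 1 ⋯ suc (h ℕ.* 2) ] area k
    T T′ : ℝ
    T = ∏[ suc μ ℕ.* 2 ⋯ h ℕ.* 2 ∸ 1 ] λ k → ∏ᵒ[ k ℕ.+ 2 ⋯ suc (h ℕ.* 2) ] area (k ℕ.+ 1)
    T′ = ∏< δ (λ j → ∏< (j ℕ.* 2) (λ i → area (suc (suc μ ℕ.* 2 ℕ.+ i)) (suc (suc (μ ℕ.+ j) ℕ.* 2))))

  T-odd : ∀ μ → ℝ
  T-odd μ = ∏[ suc (μ ℕ.* 2) ⋯ h ℕ.* 2 ∸ 1 ] λ k → ∏ᵒ[ k ℕ.+ 2 ⋯ suc (h ℕ.* 2) ] area (k ℕ.+ 1)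

  rowsAfter-odd : ∀ μ δ → h ≡ μ ℕ.+ δ →
    ∏< δ (λ j → ∏< (μ ℕ.* 2) (λ i → area (suc i) (suc (suc (μ ℕ.+ j) ℕ.* 2)))) * T-odd μ
    ≈ ∏< δ (λ j → oddSides (μ ℕ.+ j)) * ∏< δ (λ j → rowFactor (skip (μ ℕ.* 2)) (μ ℕ.+ j))
  rowsAfter-odd μ δ eq = ≈-trans (*-congˡ (∏ᵒ-triangle-odd area h₀ μ δ eq))
    (≈-trans (≈-sym (∏<-* δ _ _)) (≈-trans
      (∏<-cong δ (λ j j<δ → rowAfter (μ ℕ.* 2) (suc (j ℕ.* 2)) (μ ℕ.+ j) (μ+j<h eq j<δ) (≡.sym (+-*2+1 μ j))))
      (∏<-* δ _ _)))

  S-one : T-odd 0 ≈ ∏< h oddSides * ∏< h (rowFactor (skip 0))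
  S-one = begin
    T-odd 0                                          ≈⟨ *-identityˡ _ ⟨
    1ℝ * T-odd 0                                     ≈⟨ *-congʳ (∏<-1 h) ⟨
    ∏< h (λ _ → 1ℝ) * T-odd 0                        ≈⟨ rowsAfter-odd 0 h ≡.refl ⟩
    ∏< h oddSides * ∏< h (rowFactor (skip 0))        ∎

  areaProductOdds : ∀ (ks : ℕ → ℝ) μ δ {α} → h ≡ μ ℕ.+ δ → α ≡ suc (suc μ ℕ.* 2) →
    (∏ᵒ[ α ⋯ suc (h ℕ.* 2) ] ks) ≈ ∏< δ (λ j → ks (suc (suc (μ ℕ.+ j) ℕ.* 2)))
  areaProductOdds ks μ δ eq ≡.refl = ∏ᵒ-odds (suc μ) δ (suc (h ℕ.* 2)) ks ≡.refl
    (double∸-cancel (suc μ) δ (cong suc eq))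

  -- For m = 3 the index m - 3 is 0, so the third area in the product is 1 by convention. The
  -- straddling pair 2, 4 is row 0, which has the single area S_{124}.
  S-three : S 1 2 4 * (∏ᵒ[ 5 ⋯ suc (h ℕ.* 2) ] λ l → area 2 l * area 1 l * 1ℝ) * T-odd 1
    ≈ ∏< h₀ (λ j → oddSides (suc j)) * ∏< h (rowFactor (skip 2))
  S-three = begin
    S 1 2 4 * (∏ᵒ[ 5 ⋯ suc (h ℕ.* 2) ] λ l → area 2 l * area 1 l * 1ℝ) * T-odd 1
      ≈⟨ *-congʳ (*-congˡ (≈-trans (areaProductOdds (λ l → area 2 l * area 1 l * 1ℝ) 1 h₀ ≡.refl ≡.refl)
           (∏<-cong! h₀ (λ j → solve 2 (λ a b → b :* a :* con 1ℚ := con 1ℚ :* a :* b) ≈-refl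
             (area 1 (suc (suc (suc j) ℕ.* 2))) (area 2 (suc (suc (suc j) ℕ.* 2))))))) ⟩
    S 1 2 4 * Q * T-odd 1                     ≈⟨ *-assoc _ _ _ ⟩
    S 1 2 4 * (Q * T-odd 1)
      ≈⟨ *-cong (≈-trans (≈-sym (*-identityʳ _)) (≈-trans (rowAcross 0 (s≤s z≤n)) (*-identityˡ _)))
           (rowsAfter-odd 1 h₀ ≡.refl) ⟩
    R 0 * (∏< h₀ (λ j → oddSides (suc j)) * ∏< h₀ (λ j → R (suc j)))
      ≈⟨ solve 3 (λ a b c → a :* (b :* c) := b :* (a :* c)) ≈-refl
           (R 0) (∏< h₀ (λ j → oddSides (suc j))) (∏< h₀ (λ j → R (suc j))) ⟩
    ∏< h₀ (λ j → oddSides (suc j)) * (R 0 * ∏< h₀ (λ j → R (suc j)))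
      ≈⟨ *-congˡ (∏<-cons h₀ R) ⟨
    ∏< h₀ (λ j → oddSides (suc j)) * ∏< h R   ∎
    where
    R : ℕ → ℝ
    R = rowFactor (skip 2)
    Q : ℝ
    Q = ∏< h₀ (λ j → ∏< 2 (λ i → area (suc i) (suc (suc (suc j) ℕ.* 2))))

  -- Here row c + 1 is the straddling pair m - 1, m + 1: it uses S_{m-2,m-1,m+1} and, for odd k, the
  -- areas of k, k + 1 with m - 1 and with m + 1. The factor S_{k,k+1,k+2} completes the rows before
  -- the gap. In the rows after it, first indices up to m - 4 come from the last product and m - 3,
  -- m - 2, m - 1 from the triple one.
  S-odd : ∀ c δ → h ≡ suc (suc c) ℕ.+ δ → let m = suc (suc (suc c) ℕ.* 2) in
    S (m ∸ 2) (m ∸ 1) (m ℕ.+ 1)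
      * (∏ᵒ[ m ℕ.+ 2 ⋯ suc (h ℕ.* 2) ] λ l → area (m ∸ 1) l * area (m ∸ 2) l * area (m ∸ 3) l)
      * T-odd (suc (suc c))
      * (∏[ 1 ⋯ m ∸ 4 ] λ k →
          (S k (k ℕ.+ 1) (k ℕ.+ 2) * S k (k ℕ.+ 1) (m ∸ 1) * S k (k ℕ.+ 1) (m ℕ.+ 1)) ^ (k % 2)
          * (∏ᵉ[ k ℕ.+ 2 ⋯ m ∸ 2 ] area k)
          * (∏ᵒ[ m ℕ.+ 2 ⋯ suc (h ℕ.* 2) ] area k))
    ≈ ∏< (suc c) evenSides * ∏< (suc c) (λ t → side (t ℕ.* 2)) * ∏< δ (λ j → oddSides (suc (suc c) ℕ.+ j))
        * ∏< h (rowFactor (skip (suc (suc c) ℕ.* 2)))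
  S-odd c δ eq = begin
    M₀ * Q₀ * T * (∏[ 1 ⋯ K ] F)
      ≈⟨ *-cong (*-congʳ (*-congˡ (areaProductOdds _ μ δ eq (ℕₚ.+-comm m 2))))
           (≈-trans (productOver-interval 1 K F) (∏<-cong! K splitF)) ⟩
    M₀ * Q₁ * T * ∏< K (λ i → A (suc i) * B (suc i) * C (suc i))
      ≈⟨ *-congˡ (≈-trans (∏<-* K _ _) (*-congʳ (∏<-* K _ _))) ⟩
    M₀ * Q₁ * T * (∏< K (λ i → A (suc i)) * ∏< K (λ i → B (suc i)) * ∏< K (λ i → C (suc i)))
      ≈⟨ *-congˡ (*-cong (*-cong rowsA rowsB) (∏<-swap K δ _)) ⟩
    M₀ * Q₁ * T * (E * ∏< (suc c) R * B′ * C′)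
      ≈⟨ solve 7 (λ M Q T E R B C → M :* Q :* T :* (E :* R :* B :* C) := E :* R :* (M :* B) :* (C :* Q :* T))
           ≈-refl M₀ Q₁ T E (∏< (suc c) R) B′ C′ ⟩
    E * ∏< (suc c) R * (M₀ * B′) * (C′ * Q₁ * T)
      ≈⟨ *-cong (*-congˡ across) (≈-trans (*-congʳ after) (rowsAfter-odd μ δ eq)) ⟩
    E * ∏< (suc c) R * (Y * R (suc c)) * (O * Rδ)
      ≈⟨ solve 6 (λ E R Y r O D → E :* R :* (Y :* r) :* (O :* D) := E :* Y :* O :* (R :* r :* D))
           ≈-refl E (∏< (suc c) R) Y (R (suc c)) O Rδ ⟩
    E * Y * O * (∏< μ R * Rδ)
      ≈⟨ *-congˡ (∏-split {μ} {δ} R eq) ⟨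
    E * Y * O * ∏< h R ∎
    where
    μ m K : ℕ
    μ = suc (suc c)
    m = suc (μ ℕ.* 2)
    K = suc (c ℕ.* 2)
    R A B C F : ℕ → ℝ
    R = rowFactor (skip (μ ℕ.* 2))
    F k = (S k (k ℕ.+ 1) (k ℕ.+ 2) * S k (k ℕ.+ 1) (m ∸ 1) * S k (k ℕ.+ 1) (m ℕ.+ 1)) ^ (k % 2)
      * (∏ᵉ[ k ℕ.+ 2 ⋯ m ∸ 2 ] area k)
      * (∏ᵒ[ m ℕ.+ 2 ⋯ suc (h ℕ.* 2) ] area k)
    A k = area k (k ℕ.+ 1) ^ (k % 2) * (∏ᵉ[ k ℕ.+ 2 ⋯ m ∸ 2 ] area k)
    B k = (S k (k ℕ.+ 1) (m ∸ 1) * S k (k ℕ.+ 1) (suc m)) ^ (k % 2)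
    C k = ∏< δ (λ j → area k (suc (suc (μ ℕ.+ j) ℕ.* 2)))
    M₀ Q₀ Q₁ T E B′ C′ Y O Rδ : ℝ
    M₀ = S (m ∸ 2) (m ∸ 1) (m ℕ.+ 1)
    Q₀ = ∏ᵒ[ m ℕ.+ 2 ⋯ suc (h ℕ.* 2) ] λ l → area (m ∸ 1) l * area (m ∸ 2) l * area (m ∸ 3) l
    Q₁ = ∏< δ (λ j → let l = suc (suc (μ ℕ.+ j) ℕ.* 2) in area (m ∸ 1) l * area (m ∸ 2) l * area (m ∸ 3) l)
    T = T-odd μ
    E = ∏< (suc c) evenSides
    B′ = ∏< (suc c) (λ t → S (suc (t ℕ.* 2)) (suc t ℕ.* 2) (m ∸ 1) * S (suc (t ℕ.* 2)) (suc t ℕ.* 2) (suc m))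
    C′ = ∏< δ (λ j → ∏< K (λ i → area (suc i) (suc (suc (μ ℕ.+ j) ℕ.* 2))))
    Y = ∏< (suc c) (λ t → side (t ℕ.* 2))
    O = ∏< δ (λ j → oddSides (μ ℕ.+ j))
    Rδ = ∏< δ (λ j → R (μ ℕ.+ j))
    splitF : ∀ i → F (suc i) ≈ A (suc i) * B (suc i) * C (suc i)
    splitF i = begin
      (a * s * t) ^ e * D * (∏ᵒ[ m ℕ.+ 2 ⋯ suc (h ℕ.* 2) ] area k)
        ≈⟨ *-cong (*-congʳ (≈-trans (^-congˡ e (*-assoc a s t)) (^-distrib-* a (s * t) e)))
             (areaOdds k μ δ eq (ℕₚ.+-comm m 2)) ⟩
      a ^ e * (s * t) ^ e * D * C k
        ≡⟨ cong₂ (λ u v → S k (k ℕ.+ 1) u ^ e * (s * S k (k ℕ.+ 1) v) ^ e * D * C k)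
             (≡.trans (ℕₚ.+-suc k 1) (ℕₚ.+-comm 1 (k ℕ.+ 1))) (ℕₚ.+-comm m 1) ⟩
      area k (k ℕ.+ 1) ^ e * B k * D * C k
        ≈⟨ solve 4 (λ a b d c → a :* b :* d :* c := a :* d :* b :* c) ≈-refl
             (area k (k ℕ.+ 1) ^ e) (B k) D (C k) ⟩
      A k * B k * C k ∎
      where
      k e : ℕ
      k = suc i
      e = k % 2
      a s t D : ℝ
      a = S k (k ℕ.+ 1) (k ℕ.+ 2)
      s = S k (k ℕ.+ 1) (m ∸ 1)
      t = S k (k ℕ.+ 1) (m ℕ.+ 1)
      D = ∏ᵉ[ k ℕ.+ 2 ⋯ m ∸ 2 ] area k
    c<h : ∀ {j} → j ℕ.< μ → j ℕ.< h
    c<h j<μ = ℕₚ.<-≤-trans j<μ (μ≤h eq)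
    rowsA : ∏< K (λ i → A (suc i)) ≈ E * ∏< (suc c) R
    rowsA = ≈-trans (∏ᵉ-rows-from-k+2 area c)
      (≈-trans (∏<-cong (suc c) (λ j j<1+c → rowBefore (μ ℕ.* 2) j (c<h (ℕₚ.m<n⇒m<1+n j<1+c))
        (ℕₚ.m≤n⇒m≤1+n (s≤s (ℕₚ.*-monoˡ-≤ 2 j<1+c)))))
        (∏<-* (suc c) evenSides R))
    rowsB : ∏< K (λ i → B (suc i)) ≈ B′
    rowsB = ≈-trans (∏<-double∸1 (suc c) (λ i → B (suc i)) (λ j → reflexive
        (cong ((S (suc j ℕ.* 2) (suc j ℕ.* 2 ℕ.+ 1) (m ∸ 1) * S (suc j ℕ.* 2) (suc j ℕ.* 2 ℕ.+ 1) (suc m)) ^_)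
          (even%2 (suc j)))))
      (∏<-cong! (suc c) (λ t → ≈-trans
        (reflexive (cong₂ (λ l e → (S (suc (t ℕ.* 2)) l (m ∸ 1) * S (suc (t ℕ.* 2)) l (suc m)) ^ e)
          (ℕₚ.+-comm (suc (t ℕ.* 2)) 1) (odd%2 t)))
        (^1 _)))
    across : M₀ * B′ ≈ Y * R (suc c)
    across = ≈-trans
      (*-congʳ (reflexive (cong (S (m ∸ 2) (m ∸ 1)) (ℕₚ.+-comm m 1))))
      (rowAcross (suc c) (c<h ℕₚ.≤-refl))
    after : C′ * Q₁ ≈ ∏< δ (λ j → ∏< (μ ℕ.* 2) (λ i → area (suc i) (suc (suc (μ ℕ.+ j) ℕ.* 2))))
    after = ≈-trans (≈-sym (∏<-* δ _ _)) (∏<-cong! δ (λ j → let l = suc (suc (μ ℕ.+ j) ℕ.* 2) in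
      solve 4 (λ P a b c → P :* (a :* b :* c) := P :* c :* b :* a) ≈-refl
        (∏< K (λ i → area (suc i) l)) (area (m ∸ 1) l) (area (m ∸ 2) l) (area (m ∸ 3) l)))

-- Side powers for odd m

xᵒₘ : ∀ {n} → Polygon n → ℕ → ℝ
xᵒₘ {n} P m = if does (n ℕₚ.≟ 6) then Frieze.xᵒ₆ P m else Frieze.xᵒ P m

-- Splitting on `h₁` separates n = 6 from n > 6 and makes the tests in the exponents compute. For n
-- > 6, b = c = 1; for n = 6, x_{34} is absent on both sides.
xᵒ-one : ∀ h₁ (P : Polygon (suc (suc (suc h₁)) ℕ.* 2)) →
  let
    open Frieze P
    open SideProducts (suc h₁) x
  in
  xᵒₘ P 1 ≈ side 0 * side 2 ^ c * ∏< h evenSides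
xᵒ-one zero P = ≈-trans (*-congʳ (*-congˡ x-evens-from-0))
  (solve 2 (λ a E → a :* con 1ℚ :* E :* con 1ℚ := a :* con 1ℚ :* E) ≈-refl (side 0) (∏< h evenSides))
  where
  open Frieze P
  open SideProducts 1 x
xᵒ-one (suc h₁) P = ≈-trans (*-congʳ (*-congˡ x-evens-from-0))
  (solve 3 (λ a b E → a :* con 1ℚ :* (b :* con 1ℚ) :* con 1ℚ :* con 1ℚ :* E :* con 1ℚ
    := a :* (b :* con 1ℚ) :* E) ≈-refl (side 0) (side 2) (∏< h evenSides))
  where
  open Frieze P
  open SideProducts (suc (suc h₁)) x

xᵒ-three : ∀ h₁ (P : Polygon (suc (suc (suc h₁)) ℕ.* 2)) →
  let
    open Frieze P
    open SideProducts (suc h₁) x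
  in
  xᵒₘ P 3 ≈ side 0 * side 2 ^ c * ∏< h evenSides
xᵒ-three zero P = ≈-trans (*-congʳ (*-congˡ (x-evens 0 h ≡.refl)))
  (solve 2 (λ a E → a :* con 1ℚ :* E :* con 1ℚ := a :* con 1ℚ :* E) ≈-refl (side 0) (∏< h evenSides))
  where
  open Frieze P
  open SideProducts 1 x
xᵒ-three (suc h₁) P = ≈-trans (*-congʳ (*-congˡ (x-evens 0 h ≡.refl)))
  (solve 3 (λ a b E → a :* con 1ℚ :* (b :* con 1ℚ) :* con 1ℚ :* con 1ℚ :* E :* con 1ℚ
    := a :* (b :* con 1ℚ) :* E) ≈-refl (side 0) (side 2) (∏< h evenSides))
  where
  open Frieze P
  open SideProducts (suc (suc h₁)) x

-- The product of odd sides on the left is the one that S(m) leaves from the straddling row; only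
-- with it does x(m) reach the full powers of the odd sides.
xᵒ-odd : ∀ h₁ (P : Polygon (suc (suc (suc h₁)) ℕ.* 2)) →
  let
    open Frieze P
    open SideProducts (suc h₁) x
  in
  ∀ k δ → h ≡ suc (suc k) ℕ.+ δ →
  xᵒₘ P (suc (suc (suc k) ℕ.* 2)) * ∏< (suc k) (λ t → side (t ℕ.* 2)) ≈
    side 0 * side 2 ^ c * (∏< (suc (suc k)) oddSides * ∏< (suc δ) (λ j → evenSides (suc k ℕ.+ j)))
-- For n = 6 only m = 5 remains. The product of odd sides is then x_{12} alone, which x(5) lacks
-- because a = 0.
xᵒ-odd zero P zero zero _ = ≈-trans (*-congʳ (*-cong (*-congˡ (x-evens 1 1 ≡.refl)) (x-odds 2)))
  (solve 3 (λ a E O → con 1ℚ :* E :* O :* (con 1ℚ :* a) := a :* con 1ℚ :* (O :* E)) ≈-refl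
    (side 0) (∏< 1 (λ j → evenSides (suc j))) (∏< 2 oddSides))
  where
  open Frieze P
  open SideProducts 1 x
xᵒ-odd (suc h₁) P k δ eq = begin
  xᵒ m * Y
    ≈⟨ *-congʳ (*-cong (*-cong (*-cong (*-cong (*-congˡ (reflexive (cong (side 2 ^_) (b-exponent k))))
           (reflexive (cong (side (suc k ℕ.* 2) ^_) (m*n/n≡m k 2))))
           (reflexive (side-power (suc (suc k) ℕ.* 2) (suc k))))
         (x-evens (suc k) (suc δ) (cong suc (≡.trans eq (≡.sym (ℕₚ.+-suc (suc k) δ))))))
         (x-odds-shifted k)) ⟩
  1ℝ * B * oddSides k * oddSides (suc k) * E * Z * Y
    ≈⟨ solve 6 (λ B O O′ E Z Y → con 1ℚ :* B :* O :* O′ :* E :* Z :* Y := B :* Y :* Z :* (O :* O′ :* E))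
         ≈-refl B (oddSides k) (oddSides (suc k)) E Z Y ⟩
  B * Y * Z * (oddSides k * oddSides (suc k) * E)
    ≈⟨ *-congʳ (∏-oddSides k) ⟨
  ∏< k oddSides * (side 0 * side 2) * (oddSides k * oddSides (suc k) * E)
    ≈⟨ solve 6 (λ P a b O O′ E → P :* (a :* b) :* (O :* O′ :* E) := a :* (b :* con 1ℚ) :* (P :* O :* O′ :* E))
         ≈-refl (∏< k oddSides) (side 0) (side 2) (oddSides k) (oddSides (suc k)) E ⟩
  side 0 * side 2 ^ 1 * (∏< (suc (suc k)) oddSides * E) ∎
  where
  open Frieze P
  open SideProducts (suc (suc h₁)) x
  m : ℕ
  m = suc (suc (suc k) ℕ.* 2)
  Y Z B E : ℝ
  Y = ∏< (suc k) (λ t → side (t ℕ.* 2))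
  Z = ∏< (k ∸ 1) (λ j → side (suc (suc j) ℕ.* 2) ^ j)
  B = side 2 ^ (if does (k ℕₚ.≟ 0) then 1 else 0)
  E = ∏< (suc δ) (λ j → evenSides (suc k ℕ.+ j))
  b-exponent : ∀ k → b (suc (suc (suc k) ℕ.* 2)) ≡ (if does (k ℕₚ.≟ 0) then 1 else 0)
  b-exponent zero    = ≡.refl
  b-exponent (suc k) = ≡.refl

-- Every x(m) S(m) as a common factor times its rows

module Terms (h₁ : ℕ) (P : Polygon (suc (suc (suc h₁)) ℕ.* 2)) (p q ν : ℕ → ℝ) (κ : ℝ)
  (x≈ : ∀ {v w} → v ℕ.< suc (suc (suc h₁)) ℕ.* 2 → w ℕ.< suc (suc (suc h₁)) ℕ.* 2 →
    Frieze.x P (suc v) (suc w)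
      ≈ κ * (ν v * ν w) * (Vectors.bracket p q v w * Vectors.bracket p q v w))
  (S≈ : ∀ {u v w} → u ℕ.< suc (suc (suc h₁)) ℕ.* 2 → v ℕ.< suc (suc (suc h₁)) ℕ.* 2 →
    w ℕ.< suc (suc (suc h₁)) ℕ.* 2 →
    Frieze.S P (suc u) (suc v) (suc w) ≈ κ * (ν u * ν v * ν w) *
      (Vectors.bracket p q u v * Vectors.bracket p q v w * Vectors.bracket p q u w))
  where

  open Frieze P
  open SkipRows (suc h₁) p q ν κ x S x≈ S≈
  open Rows p q ν κ n (λ v w → x (suc v) (suc w)) (λ u v w → S (suc u) (suc v) (suc w)) x≈ S≈ public
    using (rowFactor; ∏-rowFactor)

  commonFactor : ℝ
  commonFactor = side 0 * side 2 ^ c * (∏< h evenSides * ∏< h oddSides)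

  rows : ℕ → ℝ
  rows m = ∏< h (rowFactor (skip m))

  -- S(m) has the even sides of the rows before m and the odd sides of the rows after it; x(m) has
  -- the other two halves.
  even-term : ∀ μ δ → h ≡ μ ℕ.+ δ →
    xᵉ (suc μ ℕ.* 2) * Sᵉ (suc μ ℕ.* 2) ≈ commonFactor * rows (suc (μ ℕ.* 2))
  even-term μ δ eq = begin
    xᵉ (suc μ ℕ.* 2) * Sᵉ (suc μ ℕ.* 2)
      ≈⟨ *-cong (*-cong (*-congˡ (x-evens μ δ (cong suc eq))) (x-odds μ)) (S-even μ δ eq) ⟩
    side 0 * side 2 ^ c * E′ * O * (E * O′ * R)
      ≈⟨ solve 7 (λ s t E E′ O O′ R →
           s :* t :* E′ :* O :* (E :* O′ :* R) := s :* t :* ((E :* E′) :* (O :* O′)) :* R) ≈-refl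
           (side 0) (side 2 ^ c) E E′ O O′ R ⟩
    side 0 * side 2 ^ c * (E * E′ * (O * O′)) * R
      ≈⟨ *-congʳ (*-congˡ (*-cong (∏-split {μ} {δ} evenSides eq) (∏-split {μ} {δ} oddSides eq))) ⟨
    commonFactor * R ∎
    where
    E E′ O O′ R : ℝ
    E = ∏< μ evenSides
    E′ = ∏< δ (λ j → evenSides (μ ℕ.+ j))
    O = ∏< μ oddSides
    O′ = ∏< δ (λ j → oddSides (μ ℕ.+ j))
    R = rows (suc (μ ℕ.* 2))

  -- For m = 1 the indices m - 1, m - 2 and m - 3 are all 0, so every area outside `T-odd 0` is 1.
  one-term : xᵒₘ P 1 * Sᵒ 1 ≈ commonFactor * rows 0
  one-term = begin
    xᵒₘ P 1 * Sᵒ 1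
      ≈⟨ *-cong (xᵒ-one h₁ P) (≈-trans (*-identityʳ _) (*-congʳ (≈-trans (*-identityˡ _)
           (≈-trans (areaProductOdds (λ _ → 1ℝ * 1ℝ * 1ℝ) 0 h ≡.refl ≡.refl)
             (≈-trans (∏<-cong! h (λ _ → ≈-trans (*-identityʳ _) (*-identityˡ _))) (∏<-1 h)))))) ⟩
    side 0 * side 2 ^ c * ∏< h evenSides * (1ℝ * T-odd 0)
      ≈⟨ *-congˡ (*-congˡ S-one) ⟩
    side 0 * side 2 ^ c * ∏< h evenSides * (1ℝ * (∏< h oddSides * rows 0))
      ≈⟨ solve 4 (λ s E O R → s :* E :* (con 1ℚ :* (O :* R)) := s :* (E :* O) :* R) ≈-refl
           (side 0 * side 2 ^ c) (∏< h evenSides) (∏< h oddSides) (rows 0) ⟩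
    commonFactor * rows 0 ∎

  three-term : xᵒₘ P 3 * Sᵒ 3 ≈ commonFactor * rows 2
  three-term = begin
    xᵒₘ P 3 * Sᵒ 3
      ≈⟨ *-cong (xᵒ-three h₁ P) (≈-trans (*-identityʳ _) S-three) ⟩
    side 0 * side 2 ^ c * ∏< h evenSides * (∏< (suc h₁) (oddSides ∘ suc) * rows 2)
      ≈⟨ solve 4 (λ s E O R → s :* E :* (O :* R) := s :* (E :* (con 1ℚ :* O)) :* R) ≈-refl
           (side 0 * side 2 ^ c) (∏< h evenSides) (∏< (suc h₁) (oddSides ∘ suc)) (rows 2) ⟩
    side 0 * side 2 ^ c * (∏< h evenSides * (1ℝ * ∏< (suc h₁) (oddSides ∘ suc))) * rows 2
      ≈⟨ *-congʳ (*-congˡ (*-congˡ (∏<-cons (suc h₁) oddSides))) ⟨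
    commonFactor * rows 2 ∎

  -- The even and the odd sides are split at places differing by one: the straddling row k + 1 gives
  -- a power of neither side, so x(m) supplies both.
  odd-term : ∀ k δ → h ≡ suc (suc k) ℕ.+ δ → let m = suc (suc (suc k) ℕ.* 2) in
    xᵒₘ P m * Sᵒ m ≈ commonFactor * rows (suc (suc k) ℕ.* 2)
  odd-term k δ eq = begin
    X * Sᵒ m
      ≈⟨ *-congˡ (S-odd k δ eq) ⟩
    X * (E * Y * O′ * R)
      ≈⟨ solve 5 (λ X E Y O R → X :* (E :* Y :* O :* R) := X :* Y :* (E :* O :* R)) ≈-refl X E Y O′ R ⟩
    X * Y * (E * O′ * R)
      ≈⟨ *-congʳ (xᵒ-odd h₁ P k δ eq) ⟩
    side 0 * side 2 ^ c * (O * E′) * (E * O′ * R)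
      ≈⟨ solve 6 (λ s E E′ O O′ R →
           s :* (O :* E′) :* (E :* O′ :* R) := s :* ((E :* E′) :* (O :* O′)) :* R) ≈-refl
           (side 0 * side 2 ^ c) E E′ O O′ R ⟩
    side 0 * side 2 ^ c * (E * E′ * (O * O′)) * R
      ≈⟨ *-congʳ (*-congˡ (*-cong
           (∏-split {suc k} {suc δ} evenSides (≡.trans eq (≡.sym (ℕₚ.+-suc (suc k) δ))))
           (∏-split {suc (suc k)} {δ} oddSides eq))) ⟨
    commonFactor * R ∎
    where
    m : ℕ
    m = suc (suc (suc k) ℕ.* 2)
    X E E′ O O′ Y R : ℝ
    X = xᵒₘ P m
    E = ∏< (suc k) evenSides
    E′ = ∏< (suc δ) (λ j → evenSides (suc k ℕ.+ j))
    O = ∏< (suc (suc k)) oddSides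
    O′ = ∏< δ (λ j → oddSides (suc (suc k) ℕ.+ j))
    Y = ∏< (suc k) (λ t → side (t ℕ.* 2))
    R = rows (suc (suc k) ℕ.* 2)

-- The alternating identity for powers of the norm

module _ (p q : ℕ → ℝ) where
  open Vectors p q

  normSquared : ℕ → ℝ
  normSquared v = p v * p v + q v * q v

  normPower : ∀ k → Form (k ℕ.* 2)
  normPower zero    = one
  normPower (suc k) = p· p· normPower k ⊕ q· q· normPower k

  ⟦normPower⟧ : ∀ k v → ⟦ normPower k ⟧ v ≈ normSquared v ^ k
  ⟦normPower⟧ zero    v = ≈-refl
  ⟦normPower⟧ (suc k) v = ≈-trans
    (solve 3 (λ p q f → p :* (p :* f) :+ q :* (q :* f) := (p :* p :+ q :* q) :* f) ≈-refl
      (p v) (q v) (⟦ normPower k ⟧ v))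
    (*-congˡ (⟦normPower⟧ k v))

  -- The form ∣u∣^{2k} has degree 2k, two less than the number of vectors, as `altSum-form≈0`
  -- requires.
  alternatingIdentity : ∀ k →
    (∀ {v w} → w ℕ.< v → v ℕ.< suc k ℕ.* 2 → Invertible (bracket v w)) →
    ∑< (suc k ℕ.* 2) (λ m → (- 1ℝ) ^ m *
      (normSquared m ^ k * vandermonde (applyDownFrom (skip m) (suc (k ℕ.* 2))))) ≈ 0ℝ
  alternatingIdentity k inv = begin
    ∑< (suc k ℕ.* 2) (λ m → (- 1ℝ) ^ m * (normSquared m ^ k * vandermonde (zs m)))
      ≈⟨ ∑<-cong (suc k ℕ.* 2) (λ m _ → *-congˡ (*-cong (≈-sym (⟦normPower⟧ k m))
           (≈-trans (≈-sym (*-identityˡ _)) (*-congʳ (≈-sym (weightProduct-1 (zs m))))))) ⟩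
    ∑< (suc k ℕ.* 2) (λ m → (- 1ℝ) ^ m * deletions p q ⟦ normPower k ⟧ unweighted (suc (k ℕ.* 2)) m)
      ≈⟨ ∑-deletions p q ⟦ normPower k ⟧ unweighted (suc (k ℕ.* 2)) ⟩
    (- 1ℝ) ^ suc (k ℕ.* 2) * altSum ⟦ normPower k ⟧ unweighted (applyDownFrom id (suc k ℕ.* 2))
      ≈⟨ *-congˡ (altSum-form≈0 (normPower k) (suc (k ℕ.* 2)) (k ℕ.* 2) (applyDownFrom id (k ℕ.* 2))
           (Listₚ.length-applyDownFrom id (k ℕ.* 2))
           (AllPairsₚ.applyDownFrom⁺₁ id (suc k ℕ.* 2) inv)) ⟩
    (- 1ℝ) ^ suc (k ℕ.* 2) * 0ℝ
      ≈⟨ zeroʳ _ ⟩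
    0ℝ ∎
    where
    zs : ℕ → List ℕ
    zs m = applyDownFrom (skip m) (suc (k ℕ.* 2))

module FriezeSum (h₁ : ℕ) (P : Polygon (suc (suc (suc h₁)) ℕ.* 2)) (p q ν : ℕ → ℝ) (κ : ℝ)
  (x≈ : ∀ {v w} → v ℕ.< suc (suc (suc h₁)) ℕ.* 2 → w ℕ.< suc (suc (suc h₁)) ℕ.* 2 →
    Frieze.x P (suc v) (suc w)
      ≈ κ * (ν v * ν w) * (Vectors.bracket p q v w * Vectors.bracket p q v w))
  (S≈ : ∀ {u v w} → u ℕ.< suc (suc (suc h₁)) ℕ.* 2 → v ℕ.< suc (suc (suc h₁)) ℕ.* 2 →
    w ℕ.< suc (suc (suc h₁)) ℕ.* 2 →
    Frieze.S P (suc u) (suc v) (suc w) ≈ κ * (ν u * ν v * ν w) *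
      (Vectors.bracket p q u v * Vectors.bracket p q v w * Vectors.bracket p q u w))
  (normed : ∀ v → normSquared p q v * ν v ≈ 1ℝ)
  (independent : ∀ {v w} → w ℕ.< v → v ℕ.< suc (suc (suc h₁)) ℕ.* 2 →
    Invertible (Vectors.bracket p q v w))
  where

  open Frieze P
  open Vectors p q
  open Terms h₁ P p q ν κ x≈ S≈

  private
    h k n : ℕ
    h = suc (suc h₁)
    k = suc (h ℕ.* 2)
    n = suc h ℕ.* 2

  xₘ-even : ∀ j → xₘ (j ℕ.* 2) * Sₘ (j ℕ.* 2) ≡ xᵉ (j ℕ.* 2) * Sᵉ (j ℕ.* 2)
  xₘ-even j = cong (λ t → (if t then xᵉ (j ℕ.* 2) else xᵒₘ P (j ℕ.* 2))
    * (if t then Sᵉ (j ℕ.* 2) else Sᵒ (j ℕ.* 2))) (does-even j)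

  xₘ-odd : ∀ j → let m = suc (j ℕ.* 2) in xₘ m * Sₘ m ≡ xᵒₘ P m * Sᵒ m
  xₘ-odd j = cong (λ t → (if t then xᵉ (suc (j ℕ.* 2)) else xᵒₘ P (suc (j ℕ.* 2)))
    * (if t then Sᵉ (suc (j ℕ.* 2)) else Sᵒ (suc (j ℕ.* 2)))) (does-odd j)

  term : ∀ m → m ℕ.< n → xₘ (suc m) * Sₘ (suc m) ≈ commonFactor * rows m
  term m m<n with parity m
  -- Here m counts from zero, so an odd m belongs to the even label m + 1 = 2μ + 2.
  ... | odd μ =
    let (δ , eq) = ℕₚ.m≤n⇒∃[o]m+o≡n (ℕₚ.*-cancelʳ-≤ μ h 2 (ℕ.s≤s⁻¹ (ℕ.s≤s⁻¹ m<n)))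
    in ≈-trans (reflexive (xₘ-even (suc μ))) (even-term μ δ (≡.sym eq))
  ... | even zero          = ≈-trans (reflexive (xₘ-odd 0)) one-term
  ... | even (suc zero)    = ≈-trans (reflexive (xₘ-odd 1)) three-term
  ... | even (suc (suc j)) =
    let (δ , eq) = ℕₚ.m≤n⇒∃[o]m+o≡n (ℕ.s≤s⁻¹ (ℕₚ.*-cancelʳ-< 2 (suc (suc j)) (suc h) m<n))
    in ≈-trans (reflexive (xₘ-odd (suc (suc j)))) (odd-term j δ (≡.sym eq))

  ∏ν : ∀ m → m ℕ.< n → ∏< k (ν ∘ skip m) ≈ ∏< n ν * normSquared p q m
  ∏ν m (s≤s m≤k) = begin
    ∏< k (ν ∘ skip m)                                ≈⟨ *-identityʳ _ ⟨
    ∏< k (ν ∘ skip m) * 1ℝ                           ≈⟨ *-congˡ (normed m) ⟨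
    ∏< k (ν ∘ skip m) * (normSquared p q m * ν m)
      ≈⟨ solve 3 (λ a b c → a :* (b :* c) := a :* c :* b) ≈-refl
           (∏< k (ν ∘ skip m)) (normSquared p q m) (ν m) ⟩
    ∏< k (ν ∘ skip m) * ν m * normSquared p q m      ≈⟨ *-congʳ (∏<-skip k ν m≤k) ⟩
    ∏< n ν * normSquared p q m                       ∎

  signedTerm : ℕ → ℝ
  signedTerm m = (- 1ℝ) ^ m *
    (normSquared p q m ^ h * vandermonde (applyDownFrom (skip m) k))

  scale : ℝ
  scale = commonFactor * (κ ^ triangular h * ∏< n ν ^ h)

  summand : ∀ m → m ℕ.< n →
    (- 1ℝ) ^ (suc m ℕ.+ 1) * xₘ (suc m) * Sₘ (suc m) ≈ scale * signedTerm m
  summand m m<n = begin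
    (- 1ℝ) ^ (suc m ℕ.+ 1) * xₘ (suc m) * Sₘ (suc m)
      ≈⟨ ≈-trans (*-assoc _ _ _) (*-cong (reflexive (cong ((- 1ℝ) ^_) (ℕₚ.+-comm (suc m) 1))) (term m m<n)) ⟩
    - 1ℝ * (- 1ℝ * s) * (commonFactor * rows m)
      ≈⟨ *-congˡ (*-congˡ (≈-trans (∏-rowFactor (skip m) h)
           (*-congʳ (*-congˡ (≈-trans (^-congˡ h (∏ν m m<n)) (^-distrib-* (∏< n ν) (normSquared p q m) h)))))) ⟩
    - 1ℝ * (- 1ℝ * s) * (commonFactor * (K * (D * N) * V))
      ≈⟨ solve 6 (λ s C K D N V → :- con 1ℚ :* (:- con 1ℚ :* s) :* (C :* (K :* (D :* N) :* V))
           := C :* (K :* D) :* (s :* (N :* V))) ≈-refl s commonFactor K D N V ⟩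
    scale * signedTerm m ∎
    where
    s K D N V : ℝ
    s = (- 1ℝ) ^ m
    K = κ ^ triangular h
    D = ∏< n ν ^ h
    N = normSquared p q m ^ h
    V = vandermonde (applyDownFrom (skip m) k)

  sum≈0 : (∑[ 1 ⋯ n ] λ m → (- 1ℝ) ^ (m ℕ.+ 1) * xₘ m * Sₘ m) ≈ 0ℝ
  sum≈0 = begin
    (∑[ 1 ⋯ n ] λ m → (- 1ℝ) ^ (m ℕ.+ 1) * xₘ m * Sₘ m)
      ≈⟨ sumOver-interval 1 n (λ m → (- 1ℝ) ^ (m ℕ.+ 1) * xₘ m * Sₘ m) ⟩
    ∑< n (λ m → (- 1ℝ) ^ (suc m ℕ.+ 1) * xₘ (suc m) * Sₘ (suc m))
      ≈⟨ ≈-trans (∑<-cong n summand) (∑<-*ˡ n scale signedTerm) ⟩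
    scale * ∑< n signedTerm
      ≈⟨ *-congˡ (alternatingIdentity p q h independent) ⟩
    scale * 0ℝ
      ≈⟨ zeroʳ scale ⟩
    0ℝ ∎

-- Geometry of the circle

:dot : ∀ {n} → Polynomial n → Polynomial n → Polynomial n → Polynomial n → Polynomial n
:dot c d p q = :2 :* (p :* c :+ q :* d)

-- The points of a circle through (x₀ , y₀) with centre (x₀ + c , y₀ + d):
-- the vector (p v , q v) is parallel to the chord from (x₀ , y₀) to pt v, or
-- to the tangent if pt v is (x₀ , y₀) itself.
module CircleThrough (x₀ y₀ c d : ℝ) (pt : ℕ → Point) (p q ν : ℕ → ℝ)
  -- The line through (x₀ , y₀) in direction u meets the circle again at the offset 2 (u · c) u /
  -- ∣u∣², stated without division; it is zero for the tangent.
  (chordˣ : ∀ v → normSquared p q v * (xᶜ (pt v) - x₀) ≈ (1ℝ + 1ℝ) * (p v * c + q v * d) * p v)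
  (chordʸ : ∀ v → normSquared p q v * (yᶜ (pt v) - y₀) ≈ (1ℝ + 1ℝ) * (p v * c + q v * d) * q v)
  (normed : ∀ v → normSquared p q v * ν v ≈ 1ℝ)
  where

  open Vectors p q

  κ : ℝ
  κ = c * c + d * d

  private
    N zˣ zʸ : ℕ → ℝ
    N = normSquared p q
    zˣ v = (1ℝ + 1ℝ) * (p v * c + q v * d) * p v
    zʸ v = (1ℝ + 1ℝ) * (p v * c + q v * d) * q v

    normalise : ∀ {v e z} → N v * e ≈ z → e ≈ ν v * z
    normalise {v} {e} {z} Ne≈z = begin
      e                ≈⟨ *-identityˡ e ⟨
      1ℝ * e           ≈⟨ *-congʳ (normed v) ⟨
      N v * ν v * e    ≈⟨ solve 3 (λ N ν e → N :* ν :* e := ν :* (N :* e)) ≈-refl (N v) (ν v) e ⟩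
      ν v * (N v * e)  ≈⟨ *-congˡ Ne≈z ⟩
      ν v * z          ∎

    -- The sine rules become identities of polynomials only after homogenisation: every term is
    -- multiplied by N ν = 1 for each vector missing from it.
    rescale : ∀ v {e} → e ≈ N v * ν v * e
    rescale v {e} = ≈-sym (≈-trans (*-congʳ (normed v)) (*-identityˡ e))

  sqDist≈ : ∀ v w → sqDist (pt v) (pt w) ≈ κ * (ν v * ν w) * (bracket v w * bracket v w)
  sqDist≈ v w = begin
    (xᶜ W - xᶜ V) ^ 2 + (yᶜ W - yᶜ V) ^ 2
      ≈⟨ solve 6 (λ xV yV xW yW x₀ y₀ → (xW :- xV) :^ 2 :+ (yW :- yV) :^ 2
           := ((xW :- x₀) :- (xV :- x₀)) :^ 2 :+ ((yW :- y₀) :- (yV :- y₀)) :^ 2) ≈-refl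
           (xᶜ V) (yᶜ V) (xᶜ W) (yᶜ W) x₀ y₀ ⟩
    ((xᶜ W - x₀) - (xᶜ V - x₀)) ^ 2 + ((yᶜ W - y₀) - (yᶜ V - y₀)) ^ 2
      ≈⟨ +-cong (^-congˡ 2 (+-cong (eˣ v w) (-‿cong (eˣ w v)))) (^-congˡ 2 (+-cong (eʸ v w) (-‿cong (eʸ w v)))) ⟩
    (N v * ν v * (ν w * zˣ w) - N w * ν w * (ν v * zˣ v)) ^ 2
      + (N v * ν v * (ν w * zʸ w) - N w * ν w * (ν v * zʸ v)) ^ 2
      ≈⟨ solve 8 (λ pv qv pw qw c d νv νw →
           (:norm pv qv :* νv :* (νw :* (:dot c d pw qw :* pw)) :- :norm pw qw :* νw :* (νv :* (:dot c d pv qv :* pv))) :^ 2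
           :+ (:norm pv qv :* νv :* (νw :* (:dot c d pw qw :* qw)) :- :norm pw qw :* νw :* (νv :* (:dot c d pv qv :* qv))) :^ 2
           := :norm pv qv :* νv :* (:norm pw qw :* νw :* (:norm c d :* (νv :* νw) :* (:bracket pv qv pw qw :* :bracket pv qv pw qw)))) ≈-refl
           (p v) (q v) (p w) (q w) c d (ν v) (ν w) ⟩
    N v * ν v * (N w * ν w * (κ * (ν v * ν w) * (bracket v w * bracket v w)))
      ≈⟨ ≈-trans (rescale w) (rescale v) ⟨
    κ * (ν v * ν w) * (bracket v w * bracket v w) ∎
    where
    V W : Point
    V = pt v
    W = pt w
    eˣ : ∀ v w → xᶜ (pt w) - x₀ ≈ N v * ν v * (ν w * zˣ w)
    eˣ v w = ≈-trans (normalise (chordˣ w)) (rescale v)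
    eʸ : ∀ v w → yᶜ (pt w) - y₀ ≈ N v * ν v * (ν w * zʸ w)
    eʸ v w = ≈-trans (normalise (chordʸ w)) (rescale v)

  area₄≈ : ∀ u v w → area₄ (pt u) (pt v) (pt w) ≈
    κ * (ν u * ν v * ν w) * (bracket u v * bracket v w * bracket u w)
  area₄≈ u v w = begin
    (1ℝ + 1ℝ) * ((xᶜ V - xᶜ U) * (yᶜ W - yᶜ U) - (yᶜ V - yᶜ U) * (xᶜ W - xᶜ U))
      -- The signed area is the sum over the three triangles with apex (x₀ , y₀), whose sides from
      -- the apex are chords.
      ≈⟨ solve 8 (λ xU yU xV yV xW yW x₀ y₀ →
           :2 :* ((xV :- xU) :* (yW :- yU) :- (yV :- yU) :* (xW :- xU))
           := :bracket (xU :- x₀) (yU :- y₀) (xV :- x₀) (yV :- y₀)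
             :+ :bracket (xV :- x₀) (yV :- y₀) (xW :- x₀) (yW :- y₀)
             :+ :bracket (xW :- x₀) (yW :- y₀) (xU :- x₀) (yU :- y₀)) ≈-refl
           (xᶜ U) (yᶜ U) (xᶜ V) (yᶜ V) (xᶜ W) (yᶜ W) x₀ y₀ ⟩
    e u v + e v w + e w u
      ≈⟨ +-cong (+-cong (pair w u v) (pair u v w)) (pair v w u) ⟩
    N w * ν w * z u v + N u * ν u * z v w + N v * ν v * z w u
      ≈⟨ solve 11 (λ pu qu pv qv pw qw c d νu νv νw →
           let Z = λ ν p q ν′ p′ q′ → :bracket (ν :* (:dot c d p q :* p)) (ν :* (:dot c d p q :* q))
                                        (ν′ :* (:dot c d p′ q′ :* p′)) (ν′ :* (:dot c d p′ q′ :* q′)) in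
           :norm pw qw :* νw :* Z νu pu qu νv pv qv :+ :norm pu qu :* νu :* Z νv pv qv νw pw qw
             :+ :norm pv qv :* νv :* Z νw pw qw νu pu qu
           := :norm c d :* (νu :* νv :* νw) :* (:bracket pu qu pv qv :* :bracket pv qv pw qw :* :bracket pu qu pw qw)) ≈-refl
           (p u) (q u) (p v) (q v) (p w) (q w) c d (ν u) (ν v) (ν w) ⟩
    κ * (ν u * ν v * ν w) * (bracket u v * bracket v w * bracket u w) ∎
    where
    U V W : Point
    U = pt u
    V = pt v
    W = pt w
    e z : ℕ → ℕ → ℝ
    e v w = (1ℝ + 1ℝ) * ((xᶜ (pt v) - x₀) * (yᶜ (pt w) - y₀) - (yᶜ (pt v) - y₀) * (xᶜ (pt w) - x₀))
    z v w = (1ℝ + 1ℝ) * (ν v * zˣ v * (ν w * zʸ w) - ν v * zʸ v * (ν w * zˣ w))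
    pair : ∀ t v w → e v w ≈ N t * ν t * z v w
    pair t v w = ≈-trans
      (*-congˡ (+-cong
        (*-cong (normalise (chordˣ v)) (normalise (chordʸ w)))
        (-‿cong (*-cong (normalise (chordʸ v)) (normalise (chordˣ w))))))
      (rescale t)

-- Chords of a cyclic polygon and their inverses

Invertible-cong : ∀ {x y} → x ≈ y → Invertible x → Invertible y
Invertible-cong x≈y (z , xz≈1) = z , ≈-trans (*-congʳ (≈-sym x≈y)) xz≈1

Invertible-factorˡ : ∀ {x y} → Invertible (x * y) → Invertible x
Invertible-factorˡ {x} {y} (z , xyz≈1) = y * z , ≈-trans (≈-sym (*-assoc x y z)) xyz≈1

Invertible-* : ∀ {x y} → Invertible x → Invertible y → Invertible (x * y)
Invertible-* {x} {y} (x⁻¹ , xx⁻¹≈1) (y⁻¹ , yy⁻¹≈1) = x⁻¹ * y⁻¹ , (begin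
  x * y * (x⁻¹ * y⁻¹)    ≈⟨ solve 4 (λ a b c d → a :* b :* (c :* d) := a :* c :* (b :* d)) ≈-refl x y x⁻¹ y⁻¹ ⟩
  x * x⁻¹ * (y * y⁻¹)    ≈⟨ *-cong xx⁻¹≈1 yy⁻¹≈1 ⟩
  1ℝ * 1ℝ                ≈⟨ *-identityʳ 1ℝ ⟩
  1ℝ                     ∎)

Invertible-neg : ∀ {x} → Invertible x → Invertible (- x)
Invertible-neg {x} (y , xy≈1) = - y ,
  ≈-trans (solve 2 (λ x y → :- x :* (:- y) := x :* y) ≈-refl x y) xy≈1

Invertible-2 : Invertible (1ℝ + 1ℝ)
Invertible-2 = fromℚ ½ , pointwise (λ _ → ≡.refl)

module CyclicPolygon {k : ℕ} (P : Polygon (suc (suc (suc k))))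
  (cyclic : IsCyclic P) (anticlockwise : IsAnticlockwise P) where

  open IsCyclic cyclic

  private
    last : ℕ
    last = suc (suc k)

  -- With the last vertex as base, any i < j before it form with it a triple in the order that
  -- `IsAnticlockwise` speaks of.
  base : Point
  base = P (fromℕ< (ℕₚ.n<1+n last))

  -- Being the base is decided on indices, as equality of points is undecidable. All indices from
  -- `last` on count as the base, so that the norm at every natural number is invertible.
  data Vertex (v : ℕ) : Set where
    other     : .(v<last : v ℕ.< last) → Vertex v
    basePoint : Vertex v

  classify : ∀ v → Vertex v
  classify v with v ℕₚ.<? last
  ... | yes v<last = other v<last
  ... | no  _      = basePoint

  classify-base : ∀ {v} → ¬ v ℕ.< last → classify v ≡ basePoint
  classify-base {v} v≮last with v ℕₚ.<? last
  ... | yes v<last = contradiction v<last v≮last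
  ... | no  _      = ≡.refl

  pointOf : ∀ {v} → Vertex v → Point
  pointOf (other v<last) = P (fromℕ< (ℕₚ.m<n⇒m<1+n v<last))
  pointOf basePoint          = base

  pt : ℕ → Point
  pt v = pointOf (classify v)

  x₀ y₀ c₁ c₂ : ℝ
  x₀ = xᶜ base
  y₀ = yᶜ base
  c₁ = xᶜ centre - x₀
  c₂ = yᶜ centre - y₀

  -- At the base point the chord degenerates; there the tangent, orthogonal
  -- to the radius, takes its place.
  pOf qOf : ∀ {v} → Vertex v → ℝ
  pOf t@(other _) = xᶜ (pointOf t) - x₀
  pOf basePoint       = - ((1ℝ + 1ℝ) * c₂)
  qOf t@(other _) = yᶜ (pointOf t) - y₀
  qOf basePoint       = (1ℝ + 1ℝ) * c₁

  p q : ℕ → ℝ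
  p v = pOf (classify v)
  q v = qOf (classify v)

  open Vectors p q

  pt≡ : ∀ {v} (v<n : v ℕ.< suc last) → pt v ≡ P (fromℕ< v<n)
  pt≡ {v} v<n with v ℕₚ.<? last
  ... | yes _      = ≡.refl
  ... | no  v≮last with ℕₚ.m≤n⇒m<n∨m≡n (ℕ.s≤s⁻¹ v<n)
  ...   | inj₁ v<last  = contradiction v<last v≮last
  ...   | inj₂ ≡.refl  = ≡.refl

  on-circle-pt : ∀ {v} (t : Vertex v) → sqDist centre (pointOf t) ≈ radius ^ 2
  on-circle-pt (other _) = on-circle _
  on-circle-pt basePoint     = on-circle _

  -- The difference of the circle equations at the vertex and at the base, expanded about the base.
  chord-norm : ∀ {v} (t : Vertex v) →
    let ex = xᶜ (pointOf t) - x₀ ; ey = yᶜ (pointOf t) - y₀ in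
    ex * ex + ey * ey ≈ (1ℝ + 1ℝ) * (ex * c₁ + ey * c₂)
  chord-norm t = begin
    ex * ex + ey * ey
      ≈⟨ solve 6 (λ x y x₀ y₀ ox oy →
           (x :- x₀) :* (x :- x₀) :+ (y :- y₀) :* (y :- y₀)
           := :2 :* ((x :- x₀) :* (ox :- x₀) :+ (y :- y₀) :* (oy :- y₀))
             :+ (((x :- ox) :^ 2 :+ (y :- oy) :^ 2) :- ((x₀ :- ox) :^ 2 :+ (y₀ :- oy) :^ 2))) ≈-refl
           (xᶜ A) (yᶜ A) x₀ y₀ (xᶜ centre) (yᶜ centre) ⟩
    (1ℝ + 1ℝ) * (ex * c₁ + ey * c₂) + (sqDist centre A - sqDist centre base)
      ≈⟨ +-congˡ (≈-trans (+-cong (on-circle-pt t) (-‿cong (on-circle _))) (-‿inverseʳ (radius ^ 2))) ⟩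
    (1ℝ + 1ℝ) * (ex * c₁ + ey * c₂) + 0ℝ
      ≈⟨ +-identityʳ _ ⟩
    (1ℝ + 1ℝ) * (ex * c₁ + ey * c₂) ∎
    where
    A : Point
    A = pointOf t
    ex ey : ℝ
    ex = xᶜ A - x₀
    ey = yᶜ A - y₀

  chordˣ : ∀ v → normSquared p q v * (xᶜ (pt v) - x₀) ≈ (1ℝ + 1ℝ) * (p v * c₁ + q v * c₂) * p v
  chordˣ v with classify v
  ... | t@(other _) = *-congʳ (chord-norm t)
  ... | basePoint       = solve 4 (λ N x₀ c d → N :* (x₀ :- x₀)
    := :2 :* (:- (:2 :* d) :* c :+ :2 :* c :* d)
         :* (:- (:2 :* d))) ≈-refl _ x₀ c₁ c₂

  chordʸ : ∀ v → normSquared p q v * (yᶜ (pt v) - y₀) ≈ (1ℝ + 1ℝ) * (p v * c₁ + q v * c₂) * q v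
  chordʸ v with classify v
  ... | t@(other _) = *-congʳ (chord-norm t)
  ... | basePoint       = solve 4 (λ N y₀ c d → N :* (y₀ :- y₀)
    := :2 :* (:- (:2 :* d) :* c :+ :2 :* c :* d)
         :* (:2 :* c)) ≈-refl _ y₀ c₁ c₂

  radius-invertible : Invertible (radius ^ 2)
  radius-invertible = Invertible-* R⁻¹ (Invertible-* R⁻¹ (1ℝ , *-identityʳ 1ℝ))
    where R⁻¹ = positive⇒invertible radius-pos

  area-positive : ∀ {i j} (i<j : i ℕ.< j) (j<last : j ℕ.< last) →
    0ℝ < area₄ (pt i) (pt j) base
  area-positive {i} {j} i<j j<last =
    ≡.subst₂ (λ A B → 0ℝ < area₄ A B base) (≡.sym (pt≡ i<n)) (≡.sym (pt≡ j<n))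
      (anticlockwise (fromℕ< i<n) (fromℕ< j<n) (fromℕ< (ℕₚ.n<1+n last))
        (≡.subst₂ ℕ._<_ (≡.sym (Finₚ.toℕ-fromℕ< i<n)) (≡.sym (Finₚ.toℕ-fromℕ< j<n)) i<j)
        (≡.subst₂ ℕ._<_ (≡.sym (Finₚ.toℕ-fromℕ< j<n)) (≡.sym (Finₚ.toℕ-fromℕ< (ℕₚ.n<1+n last))) j<last))
    where
    j<n : j ℕ.< suc last
    j<n = ℕₚ.m<n⇒m<1+n j<last
    i<n : i ℕ.< suc last
    i<n = ℕₚ.<-trans i<j j<n

  p-other : ∀ {v} → v ℕ.< last → p v ≡ xᶜ (pt v) - x₀
  p-other {v} v<last with v ℕₚ.<? last
  ... | yes _      = ≡.refl
  ... | no  v≮last = contradiction v<last v≮last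

  q-other : ∀ {v} → v ℕ.< last → q v ≡ yᶜ (pt v) - y₀
  q-other {v} v<last with v ℕₚ.<? last
  ... | yes _      = ≡.refl
  ... | no  v≮last = contradiction v<last v≮last

  bracket≈area : ∀ {i j} → i ℕ.< last → j ℕ.< last → bracket i j ≈ area₄ (pt i) (pt j) base
  bracket≈area {i} {j} i<last j<last
    rewrite p-other i<last | q-other i<last | p-other j<last | q-other j<last =
    solve 6 (λ x y x′ y′ x₀ y₀ →
      :2 :* ((x :- x₀) :* (y′ :- y₀) :- (y :- y₀) :* (x′ :- x₀))
      := :2 :* ((x′ :- x) :* (y₀ :- y) :- (y′ :- y) :* (x₀ :- x))) ≈-refl
      (xᶜ (pt i)) (yᶜ (pt i)) (xᶜ (pt j)) (yᶜ (pt j)) x₀ y₀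

  -- By Lagrange's identity the product of the two squared norms is bounded
  -- below by the square of an area.
  norm-product-invertible : ∀ {i j} → i ℕ.< j → j ℕ.< last →
    Invertible (normSquared p q i * normSquared p q j)
  norm-product-invertible {i} {j} i<j j<last = Invertible-factorˡ (Invertible-cong
    (begin
      A * A + D * D
        ≈⟨ +-congʳ (*-cong A≈b A≈b) ⟩
      bracket i j * bracket i j + D * D
        ≈⟨ solve 4 (λ p q p′ q′ →
             :2 :* (p :* q′ :- q :* p′) :* (:2 :* (p :* q′ :- q :* p′))
               :+ :2 :* (p :* p′ :+ q :* q′) :* (:2 :* (p :* p′ :+ q :* q′))
             := (p :* p :+ q :* q) :* (p′ :* p′ :+ q′ :* q′) :* (:2 :* :2)) ≈-refl (p i) (q i) (p j) (q j) ⟩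
      normSquared p q i * normSquared p q j * ((1ℝ + 1ℝ) * (1ℝ + 1ℝ)) ∎)
    (positive⇒x²+y²-invertible D (area-positive i<j j<last)))
    where
    A D : ℝ
    A = area₄ (pt i) (pt j) base
    D = (1ℝ + 1ℝ) * (p i * p j + q i * q j)
    A≈b : A ≈ bracket i j
    A≈b = ≈-sym (bracket≈area (ℕₚ.<-trans i<j j<last) j<last)

  -- At the base the norm is four times the squared radius. Elsewhere it is a factor of an
  -- invertible product with the norm of a second chord.
  norm-invertible : ∀ v → Invertible (normSquared p q v)
  norm-invertible v = choose (v ℕₚ.<? last)
    where
    tangent-norm : Invertible (pOf {v} basePoint * pOf {v} basePoint + qOf {v} basePoint * qOf {v} basePoint)
    tangent-norm = Invertible-cong
      (≈-trans (*-congˡ (≈-sym (on-circle (fromℕ< (ℕₚ.n<1+n last)))))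
        (solve 4 (λ x₀ y₀ ox oy →
          :2 :* :2 :* ((x₀ :- ox) :^ 2 :+ (y₀ :- oy) :^ 2)
          := (:- (:2 :* (oy :- y₀))) :* (:- (:2 :* (oy :- y₀))) :+ :2 :* (ox :- x₀) :* (:2 :* (ox :- x₀))) ≈-refl
          x₀ y₀ (xᶜ centre) (yᶜ centre)))
      (Invertible-* (Invertible-* Invertible-2 Invertible-2) radius-invertible)
    other-norm : ∀ v → v ℕ.< last → Invertible (normSquared p q v)
    -- The second chord goes to vertex 1 for vertex 0, and to vertex 0 otherwise; both differ from
    -- the base since `last` is at least 2.
    other-norm zero    _      = Invertible-factorˡ (norm-product-invertible {0} {1} (s≤s z≤n) (s≤s (s≤s z≤n)))
    other-norm (suc v) v<last = Invertible-factorˡ (Invertible-cong (*-comm _ _)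
      (norm-product-invertible {0} {suc v} (s≤s z≤n) v<last))
    choose : Dec (v ℕ.< last) → Invertible (normSquared p q v)
    choose (yes v<last) = other-norm v v<last
    choose (no  v≮last) =
      subst (λ t → Invertible (pOf t * pOf t + qOf t * qOf t)) (≡.sym (classify-base v≮last)) tangent-norm

  ν : ℕ → ℝ
  ν v = proj₁ (norm-invertible v)

  normed : ∀ v → normSquared p q v * ν v ≈ 1ℝ
  normed v = proj₂ (norm-invertible v)

  open CircleThrough x₀ y₀ c₁ c₂ pt p q ν chordˣ chordʸ normed public using (κ; sqDist≈; area₄≈)

  -- The bracket of the doubled tangent with a chord u is -4 (u · c), and `chord-norm` replaces 2 (u
  -- · c) by ∣u∣².
  bracket-last : ∀ {w} → w ℕ.< last → bracket last w ≈ - ((1ℝ + 1ℝ) * normSquared p q w)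
  bracket-last {w} w<last rewrite p-other w<last | q-other w<last with last ℕₚ.<? last
  ... | yes last<last = contradiction last<last (ℕₚ.<-irrefl ≡.refl)
  ... | no _ = ≈-trans
    (solve 4 (λ p q c d →
      :2 :* (:- (:2 :* d) :* q :- :2 :* c :* p) := :- (:2 :* (:2 :* (p :* c :+ q :* d)))) ≈-refl
      (xᶜ (pt w) - x₀) (yᶜ (pt w) - y₀) c₁ c₂)
    (-‿cong (*-congˡ (≈-sym (chord-norm (classify w)))))

  -- Away from the base the bracket is minus a positive area, since `w` precedes `v`; at the base it
  -- is minus twice a squared norm.
  independent : ∀ {v w} → w ℕ.< v → v ℕ.< suc last → Invertible (bracket v w)
  independent {v} {w} w<v v<n with ℕₚ.m≤n⇒m<n∨m≡n (ℕ.s≤s⁻¹ v<n)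
  ... | inj₂ ≡.refl = Invertible-cong (≈-sym (bracket-last w<v))
    (Invertible-neg (Invertible-* Invertible-2 (norm-invertible w)))
  ... | inj₁ v<last = Invertible-cong
    (≈-trans (-‿cong (≈-sym (bracket≈area (ℕₚ.<-trans w<v v<last) v<last)))
      (solve 4 (λ p q p′ q′ → :- (:2 :* (p :* q′ :- q :* p′))
        := :2 :* (p′ :* q :- q′ :* p)) ≈-refl (p w) (q w) (p v) (q v)))
    (Invertible-neg (positive⇒invertible (area-positive w<v v<last)))

  open Frieze P

  vertex≡ : ∀ {v} → v ℕ.< suc last → vertex (suc v) ≡ just (pt v)
  vertex≡ {v} v<n with v ℕₚ.<? suc last
  ... | yes v<n′ = cong just (≡.sym (pt≡ v<n′))
  ... | no  v≮n  = contradiction v<n v≮n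

  x≈ : ∀ {v w} → v ℕ.< suc last → w ℕ.< suc last →
    x (suc v) (suc w) ≈ κ * (ν v * ν w) * (bracket v w * bracket v w)
  x≈ {v} {w} v<n w<n rewrite vertex≡ v<n | vertex≡ w<n = sqDist≈ v w

  S≈ : ∀ {u v w} → u ℕ.< suc last → v ℕ.< suc last → w ℕ.< suc last →
    S (suc u) (suc v) (suc w) ≈ κ * (ν u * ν v * ν w) * (bracket u v * bracket v w * bracket u w)
  S≈ {u} {v} {w} u<n v<n w<n rewrite vertex≡ u<n | vertex≡ v<n | vertex≡ w<n = area₄≈ u v w

theorem3p1 : ∀ (n : ℕ) → 4 <ℕ n → 2 ∣ n →
    (P : Polygon n) → IsCyclic P → IsAnticlockwise P →
    (∑[ 1 ⋯ n ] λ m → (- 1ℝ) ^ (m +ℕ 1) * Frieze.xₘ P m * Frieze.Sₘ P m) ≈ 0ℝ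
theorem3p1 _ () (divides 0 ≡.refl)
theorem3p1 _ (s≤s (s≤s ())) (divides 1 ≡.refl)
theorem3p1 _ (s≤s (s≤s (s≤s (s≤s ())))) (divides 2 ≡.refl)
-- With the cases 0, 2 and 4 excluded, n = 2h + 2 for h = h₁ + 2.
theorem3p1 _ _ (divides (suc (suc (suc h₁))) ≡.refl) P cyclic anticlockwise =
  FriezeSum.sum≈0 h₁ P p q ν κ x≈ S≈ normed independent
  where open CyclicPolygon P cyclic anticlockwise
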